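{- Let $G$ be a finite abelian group of order $a^2b^2$, where $a,b$ are positive integers with $\gcd(a,b)=1$, $a>1$, and $b$ odd with $b\ge 3$. Let $\epsilon\in\{1,-1\}$ and let $D\subseteq G$ be an $(a^2b^2,\ r(ab-\epsilon),\ \epsilon ab+r^2-3\epsilon r,\ r^2-\epsilon r)$-partial difference set in $G$. Let $t$ be the integer with $$t\le \frac{\epsilon ab-2\epsilon r+a}{2a}<t+1.$$ Then: (i) if $\epsilon=1$, either $$\frac{(a+1)b(b+1-2t)}{2(b+1)}-(b-1)\le r\le \frac{(a+1)b(b+1-2t)}{2(b+1)}$$ or $$\frac{(a-1)b(b-1-2t)}{2(b-1)}\le r\le \frac{(a-1)b(b-1-2t)}{2(b-1)}+(b+1);$$ (ii) if $\epsilon=-1$, either $$\frac{(a+1)b(b-1+2t)}{2(b-1)}-(b+1)\le r\le \frac{(a+1)b(b-1+2t)}{2(b-1)}$$ or $$\frac{(a-1)b(b+1+2t)}{2(b+1)}\le r\le \frac{(a-1)b(b+1+2t)}{2(b+1)}+(b-1).$$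
   Context: Let $G$ be a finite abelian group of order $v$ and $D\subseteq G$ with $|D|=k$. $D$ is a $(v,k,\lambda,\mu)$-partial difference set (PDS) in $G$ if the expressions $gh^{ -1}$ with $g,h\in D$, $g\neq h$, represent each non-identity element of $D$ exactly $\lambda$ times and each non-identity element of $G$ not in $D$ exactly $\mu$ times. A PDS with parameters $(n^2, r(n-\epsilon), \epsilon n+r^2-3\epsilon r, r^2-\epsilon r)$ is called of Latin square type if $\epsilon=1$ and of negative Latin square type if $\epsilon=-1$. -}

module Defs where

open import Level using (0ℓ)
open import Algebra.Bundles using (AbelianGroup)
open import Data.Nat as ℕ using (ℕ; zero; suc)
open import Data.Integer as ℤ using (ℤ)
open import Data.Rational as ℚ using (ℚ; 0ℚ)
open import Data.Fin using (Fin)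
open import Data.Fin.Subset using (Subset; _∈_; _∉_; ∣_∣)
open import Data.Fin.Subset.Properties using (_∈?_)
open import Data.List using (List; length; filter; map)
open import Data.Nat.ListAction using (sum)
open import Data.List.Base using (allFin)
open import Data.Product using (Σ; ∃; _×_; _,_)
open import Relation.Nullary using (¬_; Dec; yes; no)
open import Relation.Nullary.Decidable using (_×-dec_; ¬?)
open import Relation.Unary using (Decidable)
open import Relation.Binary.PropositionalEquality using (_≡_)
open import Data.Fin.Properties using (_≟_)
import Relation.Binary as B

record FiniteAbelianGroup : Set₁ where
  field
    abGroup : AbelianGroup 0ℓ 0ℓ
  open AbelianGroup abGroup public
  field
    order     : ℕ
    enum      : Fin order → Carrier
    enum-inj  : ∀ i j → enum i ≈ enum j → i ≡ j
    enum-surj : ∀ x → ∃ λ i → enum i ≈ x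
    _≈?_      : B.Decidable _≈_

countFin : ∀ {n} {P : Fin n → Set} → Decidable P → ℕ
countFin {n} P? = length (filter P? (allFin n))

module _ (G : FiniteAbelianGroup) where
  open FiniteAbelianGroup G

  -- Subsets of G are represented as subsets of the index set Fin order.
  -- Number of ways of writing (enum x) as g h⁻¹ with g, h ∈ D, g ≠ h.
  repCount : Subset order → Fin order → ℕ
  repCount D x =
    sum (map (λ i → countFin (λ j →
               (i ∈? D) ×-dec ((j ∈? D) ×-dec (¬? (i ≟ j) ×-dec
               (((enum i ∙ (enum j ⁻¹)) ≈? enum x))))))
             (allFin order))

  IsPDS : Subset order → ℤ → ℤ → ℤ → ℤ → Set
  IsPDS D v k λ′ μ =
    ℤ.+ order ≡ v ×
    ℤ.+ ∣ D ∣ ≡ k ×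
    (∀ x → ¬ (enum x ≈ ε) →
       (x ∈ D → ℤ.+ repCount D x ≡ λ′) ×
       (x ∉ D → ℤ.+ repCount D x ≡ μ))

-- p // d = p / d as a rational; only used with d > 0.
_//_ : ℤ → ℕ → ℚ
p // zero  = 0ℚ
p // suc d = p ℚ./ suc d

{-# OPTIONS --safe #-}
module Submission where

-- Put n = εab, r' = εr, b' = εb. Then P = D + r'·1 in ℤ[G] satisfies P² = nP + (r'² - r')G in both cases,
-- unless λ = μ, where n = 2r' and t = 0. Frobenius in 𝔽_p[G] shows that P is invariant under x ↦ xˢ for s
-- coprime to |G|. Write G = N × H with |N| = a², |H| = b².
--
-- Invariant elements of ℤ[N] are integral combinations of sums over cyclic subgroups, so they have integral
-- eigenvalues, and the common eigenspaces are cut out by quasi-idempotents with integral coefficients; these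
-- replace the characters of N. On a nontrivial eigenspace the component of P over h ∈ H acts as an integer a·x_h,
-- where Σ x_h = b'g with g ∈ {0, 1}; as x_h = x_{h⁻¹} and b is odd, y = x_e has the parity of g. Dually, the sums
-- of P over the cosets nH with n ≠ e are b'·(an integer with the parity of 1_D(n)).
--
-- Put |D ∩ N| = a·x₀ - r', |D ∩ H| = b'·x₁ - r' and T = (b' + 1)/2 - t, so that 0 ≤ aT - r' < a. Summing
-- (y - τ)² ≥ [y ≢ τ mod 2] for τ = T, T - 1 over the eigenspaces, and likewise over the cosets, gives four
-- quadratic inequalities in x₀, x₁ which force x₀ = (a + 1)T - r' for even T and x₀ = r' - (a - 1)(T - 1) for
-- odd T. Cauchy–Schwarz for the sums of P over the cosets of N gives 0 ≤ b'x₀ - r' ≤ b² - 1, which is the claim.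

open import Defs
open import Level using (0ℓ)
open import Algebra.Bundles using (AbelianGroup; CommutativeRing; CommutativeMonoid)
open import Algebra.Structures using (IsAbelianGroup)
import Algebra.Construct.Pointwise as Pointwise
open import Data.Nat as ℕ using (ℕ; zero; suc; _≥_)
import Data.Nat.Properties as ℕₚ
open import Data.Nat.GCD using (gcd; module Bézout)
open import Data.Nat.DivMod as DivMod using (_%_)
open import Data.Nat.Divisibility as ℕ∣ using () renaming (_∣_ to _∣ₙ_)
open import Data.Nat.Coprimality as Coprimality using (Coprime; coprime-Bézout)
open import Data.Nat.Primality using (Prime; euclidsLemma; prime⇒nonZero; prime[2]; ¬prime[1]; prime⇒irreducible)
open import Data.Nat.Primality.Factorisation using (factorise; factorisationHasAllPrimeFactors)
open import Data.Nat.Combinatorics using (_C_; nC1≡n; nCn≡1; nCk+nC[k+1]≡[n+1]C[k+1])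
open import Data.Nat.ListAction using (product) renaming (sum to sumₙ)
open import Data.Nat.ListAction.Properties using (∈⇒∣product)
import Data.Nat.Tactic.RingSolver as ℕSolver
open import Data.Integer as ℤ using (ℤ; +_; -_; _+_; _-_; _*_)
import Data.Integer.Properties as ℤₚ
import Algebra.Properties.AbelianGroup ℤₚ.+-0-abelianGroup as ℤ+
open import Data.Integer.Divisibility.Signed as ℤ∣ using (_∣_; divides)
open import Data.Integer.Tactic.RingSolver using (solve-∀)
open import Data.Rational as ℚ using (ℚ)
import Data.Rational.Properties as ℚₚ
import Data.Rational.Unnormalised as ℚᵘ
import Data.Rational.Unnormalised.Properties as ℚᵘₚ
open import Data.Fin as Fin using (Fin; toℕ; fromℕ; fromℕ<; inject₁)
import Data.Fin.Properties as Finₚ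
open import Data.Fin.Permutation using (permutation)
open import Data.Fin.Subset using (Subset; inside; outside) renaming (_∈_ to _∈ˢ_; ∣_∣ to ∣_∣ˢ)
open import Data.Fin.Subset.Properties using (_∈?_; drop-there)
import Data.Vec as Vec
open import Data.List using (List; []; _∷_; filter; map; length; tabulate; allFin)
open import Data.List.Membership.Propositional using () renaming (_∈_ to _∈ₗ_)
open import Data.List.Membership.Propositional.Properties using (∈-filter⁺; ∈-filter⁻)
open import Data.List.Relation.Unary.All using (All; []; _∷_)
import Data.List.Relation.Unary.All.Properties as All
open import Data.List.Relation.Unary.Any using (here; there)
open import Data.Product using (_×_; _,_; ∃; proj₁; proj₂)
open import Data.Sum using (_⊎_; inj₁; inj₂)
open import Data.Empty using (⊥; ⊥-elim)
open import Relation.Nullary using (¬_; Dec; yes; no)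
open import Relation.Nullary.Decidable using (¬?; _×-dec_)
open import Relation.Binary using (DecidableEquality)
open import Relation.Binary.PropositionalEquality using (_≡_; _≢_; refl; sym; trans; cong; cong₂; subst; subst₂; isEquivalence; module ≡-Reasoning)

-- Finite sums

-- Complex characters are avoided: in integral group rings divisibility, parity and positivity can
-- all be read off coefficients. The nontrivial character values of D are n - r' and -r', so the
-- shift by r' moves them to n and 0, and from then on only the quadratic equation matters. That
-- equation is derived for λ ≠ μ: the difference counts see D only through (λ - μ)·D, and from this
-- D = D⁻¹ and e ∉ D are recovered; if λ = μ they say nothing about D, hence the separate case.
-- Oddness of b enters through inversion on H, which fixes only the identity, so that a symmetric
-- sum has the parity of its term there. The inequalities are used in pairs: those from eigenspaces
-- and those from cosets differ by exchanging x₀ and x₁, and adding the two for one τ gives a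
-- statement about the deviations u, v of x₀, x₁ from the predicted value. It says that u² + v² is
-- at most -c(u + v) for τ = T and at most d(u + v) for τ = T - 1, with c and d nonnegative by the
-- choice of T. So u = v = 0.

∑ : {A : Set} → List A → (A → ℤ) → ℤ
∑ []       f = + 0
∑ (x ∷ xs) f = f x + ∑ xs f

module _ {A : Set} where

  ∑-cong : ∀ (xs : List A) {f g : A → ℤ} → (∀ x → f x ≡ g x) → ∑ xs f ≡ ∑ xs g
  ∑-cong []       f≡g = refl
  ∑-cong (x ∷ xs) f≡g = cong₂ _+_ (f≡g x) (∑-cong xs f≡g)

  ∑-zero : ∀ (xs : List A) → ∑ xs (λ _ → + 0) ≡ + 0
  ∑-zero []       = refl
  ∑-zero (x ∷ xs) = trans (ℤₚ.+-identityˡ _) (∑-zero xs)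

  ∑-+ : ∀ (xs : List A) (f g : A → ℤ) → ∑ xs (λ x → f x + g x) ≡ ∑ xs f + ∑ xs g
  ∑-+ []       f g = refl
  ∑-+ (x ∷ xs) f g = trans (cong (_+_ (f x + g x)) (∑-+ xs f g)) (interchange (f x) (g x) _ _)
    where
    interchange : ∀ a b c d → a + b + (c + d) ≡ a + c + (b + d)
    interchange = solve-∀

  ∑-*ˡ : ∀ (xs : List A) c (f : A → ℤ) → ∑ xs (λ x → c * f x) ≡ c * ∑ xs f
  ∑-*ˡ []       c f = sym (ℤₚ.*-zeroʳ c)
  ∑-*ˡ (x ∷ xs) c f = trans (cong (_+_ (c * f x)) (∑-*ˡ xs c f)) (sym (ℤₚ.*-distribˡ-+ c (f x) _))

  ∑-*ʳ : ∀ (xs : List A) c (f : A → ℤ) → ∑ xs (λ x → f x * c) ≡ ∑ xs f * c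
  ∑-*ʳ xs c f = trans (∑-cong xs λ x → ℤₚ.*-comm (f x) c) (trans (∑-*ˡ xs c f) (ℤₚ.*-comm c _))

  ∑-neg : ∀ (xs : List A) (f : A → ℤ) → ∑ xs (λ x → - f x) ≡ - ∑ xs f
  ∑-neg []       f = refl
  ∑-neg (x ∷ xs) f = trans (cong (_+_ (- f x)) (∑-neg xs f)) (sym (ℤₚ.neg-distrib-+ (f x) _))

  ∑-nonneg : ∀ (xs : List A) (f : A → ℤ) → (∀ x → + 0 ℤ.≤ f x) → + 0 ℤ.≤ ∑ xs f
  ∑-nonneg []       f f≥0 = ℤₚ.≤-refl
  ∑-nonneg (x ∷ xs) f f≥0 = ℤₚ.+-mono-≤ (f≥0 x) (∑-nonneg xs f f≥0)

  ∑-divides : ∀ (xs : List A) {d} (f : A → ℤ) → (∀ x → d ∣ f x) → d ∣ ∑ xs f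
  ∑-divides []       f d∣f = divides (+ 0) refl
  ∑-divides (x ∷ xs) f d∣f = ℤ∣.∣m∣n⇒∣m+n (d∣f x) (∑-divides xs f d∣f)

∑-swap : ∀ {A B : Set} (xs : List A) (ys : List B) (f : A → B → ℤ) →
  ∑ xs (λ x → ∑ ys (f x)) ≡ ∑ ys (λ y → ∑ xs (λ x → f x y))
∑-swap []       ys f = sym (∑-zero ys)
∑-swap (x ∷ xs) ys f = trans (cong (_+_ (∑ ys (f x))) (∑-swap xs ys f)) (sym (∑-+ ys (f x) _))

[_] : ∀ {P : Set} → Dec P → ℤ
[ yes _ ] = + 1
[ no _ ]  = + 0

[]-cong : ∀ {P Q : Set} (p? : Dec P) (q? : Dec Q) → (P → Q) → (Q → P) → [ p? ] ≡ [ q? ]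
[]-cong (yes p) (yes q) f g = refl
[]-cong (yes p) (no ¬q) f g = ⊥-elim (¬q (f p))
[]-cong (no ¬p) (yes q) f g = ⊥-elim (¬p (g q))
[]-cong (no ¬p) (no ¬q) f g = refl

[]-yes : ∀ {P : Set} (p? : Dec P) → P → [ p? ] ≡ + 1
[]-yes (yes _) p = refl
[]-yes (no ¬p) p = ⊥-elim (¬p p)

[]-no : ∀ {P : Set} (p? : Dec P) → ¬ P → [ p? ] ≡ + 0
[]-no (yes p) ¬p = ⊥-elim (¬p p)
[]-no (no _)  ¬p = refl

-- `δ-total` says in one equation that `elems` is complete and free of repetitions; in this form it
-- collapses a sum against `δ` directly.
record FinSet : Set₁ where
  field
    Carrier : Set
    _≟_     : DecidableEquality Carrier
    elems   : List Carrier

  δ : Carrier → Carrier → ℤ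
  δ x y = [ x ≟ y ]

  field
    δ-total : ∀ x → ∑ elems (δ x) ≡ + 1

  δ-refl : ∀ x → δ x x ≡ + 1
  δ-refl x = []-yes (x ≟ x) refl

  δ-subst : ∀ (f : Carrier → ℤ) x y → δ x y * f y ≡ δ x y * f x
  δ-subst f x y with x ≟ y
  ... | yes refl = refl
  ... | no _     = refl

  ∑δ : ∀ x f → ∑ elems (λ y → δ x y * f y) ≡ f x
  ∑δ x f = begin
    ∑ elems (λ y → δ x y * f y) ≡⟨ ∑-cong elems (δ-subst f x) ⟩
    ∑ elems (λ y → δ x y * f x) ≡⟨ ∑-*ʳ elems (f x) (δ x) ⟩
    ∑ elems (δ x) * f x         ≡⟨ cong (_* f x) (δ-total x) ⟩
    + 1 * f x                   ≡⟨ ℤₚ.*-identityˡ (f x) ⟩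
    f x                         ∎
    where open ≡-Reasoning

  ∑-≥-term : ∀ x f → (∀ y → x ≢ y → + 0 ℤ.≤ f y) → f x ℤ.≤ ∑ elems f
  ∑-≥-term x f f≥0 = subst (ℤ._≤ ∑ elems f) (ℤₚ.+-identityˡ (f x))
    (subst (+ 0 + f x ℤ.≤_) split (ℤₚ.+-monoˡ-≤ (f x) (∑-nonneg elems rest rest≥0)))
    where
    rest : Carrier → ℤ
    rest y = f y - δ x y * f y
    rest≥0 : ∀ y → + 0 ℤ.≤ rest y
    rest≥0 y with x ≟ y
    ... | yes refl = ℤₚ.≤-reflexive (cancel (f x))
      where
      cancel : ∀ a → + 0 ≡ a - + 1 * a
      cancel = solve-∀
    ... | no x≢y = subst (+ 0 ℤ.≤_) (keep (f y)) (f≥0 y x≢y)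
      where
      keep : ∀ a → a ≡ a - + 0 * a
      keep = solve-∀
    add-back : ∀ a b → a ≡ (a - b) + b
    add-back = solve-∀
    split : ∑ elems rest + f x ≡ ∑ elems f
    split = begin
      ∑ elems rest + f x                         ≡⟨ cong (_+_ (∑ elems rest)) (sym (∑δ x f)) ⟩
      ∑ elems rest + ∑ elems (λ y → δ x y * f y) ≡⟨ sym (∑-+ elems rest _) ⟩
      ∑ elems (λ y → rest y + δ x y * f y)       ≡⟨ ∑-cong elems (λ y → sym (add-back (f y) (δ x y * f y))) ⟩
      ∑ elems f                                  ∎
      where open ≡-Reasoning

module _ (A B : FinSet) where
  private
    module A = FinSet A
    module B = FinSet B

  -- Expanding `f (φ x)` with `∑δ` and exchanging the sums avoids any comparison of the two
  -- enumerations.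
  ∑-reindex : (φ : A.Carrier → B.Carrier) (ψ : B.Carrier → A.Carrier) →
    (∀ x → ψ (φ x) ≡ x) → (∀ y → φ (ψ y) ≡ y) →
    (f : B.Carrier → ℤ) → ∑ A.elems (λ x → f (φ x)) ≡ ∑ B.elems f
  ∑-reindex φ ψ ψφ φψ f = begin
    ∑ A.elems (λ x → f (φ x))
      ≡⟨ ∑-cong A.elems (λ x → sym (B.∑δ (φ x) f)) ⟩
    ∑ A.elems (λ x → ∑ B.elems (λ y → B.δ (φ x) y * f y))
      ≡⟨ ∑-swap A.elems B.elems _ ⟩
    ∑ B.elems (λ y → ∑ A.elems (λ x → B.δ (φ x) y * f y))
      ≡⟨ ∑-cong B.elems (λ y → ∑-cong A.elems (λ x → cong (_* f y) (transpose x y))) ⟩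
    ∑ B.elems (λ y → ∑ A.elems (λ x → A.δ (ψ y) x * f y))
      ≡⟨ ∑-cong B.elems (λ y → A.∑δ (ψ y) (λ _ → f y)) ⟩
    ∑ B.elems f ∎
    where
    open ≡-Reasoning
    transpose : ∀ x y → B.δ (φ x) y ≡ A.δ (ψ y) x
    transpose x y = []-cong (φ x B.≟ y) (ψ y A.≟ x)
      (λ eq → trans (cong ψ (sym eq)) (ψφ x)) (λ eq → trans (cong φ (sym eq)) (φψ y))

-- Frobenius in a commutative ring

absorption : ∀ n k → suc k ℕ.* (suc n C suc k) ≡ suc n ℕ.* (n C k)
absorption n       zero    = trans (ℕₚ.*-identityˡ _) (trans (nC1≡n (suc n)) (sym (ℕₚ.*-identityʳ (suc n))))
absorption zero    (suc k) = ℕₚ.*-zeroʳ (suc (suc k))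
absorption (suc m) (suc k) = begin
  (2 ℕ.+ k) ℕ.* (suc n C suc (suc k))
    ≡⟨ cong ((2 ℕ.+ k) ℕ.*_) (sym (nCk+nC[k+1]≡[n+1]C[k+1] n (suc k))) ⟩
  (2 ℕ.+ k) ℕ.* ((n C suc k) ℕ.+ (n C suc (suc k)))
    ≡⟨ expand k (n C suc k) (n C suc (suc k)) ⟩
  (n C suc k) ℕ.+ (suc k ℕ.* (n C suc k) ℕ.+ (2 ℕ.+ k) ℕ.* (n C suc (suc k)))
    ≡⟨ cong ((n C suc k) ℕ.+_) (cong₂ ℕ._+_ (absorption m k) (absorption m (suc k))) ⟩
  (n C suc k) ℕ.+ (n ℕ.* (m C k) ℕ.+ n ℕ.* (m C suc k))
    ≡⟨ cong ((n C suc k) ℕ.+_) (trans (sym (ℕₚ.*-distribˡ-+ n (m C k) (m C suc k))) (cong (n ℕ.*_) (nCk+nC[k+1]≡[n+1]C[k+1] m k))) ⟩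
  suc n ℕ.* (n C suc k) ∎
  where
  open ≡-Reasoning
  n = suc m
  expand : ∀ k x y → (2 ℕ.+ k) ℕ.* (x ℕ.+ y) ≡ x ℕ.+ (suc k ℕ.* x ℕ.+ (2 ℕ.+ k) ℕ.* y)
  expand = ℕSolver.solve-∀

-- By `absorption`, `p` divides `suc k` times the binomial coefficient, and it is too large to
-- divide `suc k`.
prime∣binomial : ∀ {p} → Prime p → ∀ k → suc k ℕ.< p → p ∣ₙ (p C suc k)
prime∣binomial {zero}  p-prime k ()
prime∣binomial {suc n} p-prime k k<p
  with euclidsLemma (suc k) (suc n C suc k) p-prime
         (ℕ∣.divides (n C k) (trans (absorption n k) (ℕₚ.*-comm (suc n) (n C k))))
... | inj₁ p∣k = ⊥-elim (ℕₚ.<⇒≱ k<p (ℕ∣.∣⇒≤ p∣k))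
... | inj₂ p∣C = p∣C

module Freshman (R : CommutativeRing 0ℓ 0ℓ) where
  open CommutativeRing R renaming (_+_ to _⊕_; _*_ to _⊗_; refl to ≈-refl; sym to ≈-sym; trans to ≈-trans)
  open import Algebra.Properties.Semiring.Exp semiring public using (_^_; ^-congˡ)
  open import Algebra.Properties.Semiring.Mult semiring public using () renaming (_×_ to _·_)
  open import Algebra.Properties.Semiring.Mult semiring using (×-congʳ; ×-assocˡ; ×-congˡ; ×-homo-1)
  open import Algebra.Properties.CommutativeMonoid.Mult +-commutativeMonoid using (×-distrib-+)
  open import Algebra.Properties.Semiring.Sum semiring using (sum; sum-cong-≋; sum-init-last)
  open import Algebra.Properties.CommutativeSemiring.Binomial commutativeSemiring as Binomial using (binomialTerm)
  open import Relation.Binary.Reasoning.Setoid setoid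

  private
    ·-sum : ∀ m {n} (t : Fin n → Carrier) → sum (λ i → m · t i) ≈ m · sum t
    ·-sum m {zero}  t = ≈-sym (m·0 m)
      where
      m·0 : ∀ m → m · 0# ≈ 0#
      m·0 zero    = ≈-refl
      m·0 (suc m) = ≈-trans (+-identityˡ _) (m·0 m)
    ·-sum m {suc n} t = ≈-trans (+-congˡ (·-sum m (λ i → t (Fin.suc i)))) (≈-sym (×-distrib-+ _ _ m))

  -- The inner binomial terms are multiples of `p`. Exhibiting the error term `p · z`, instead of
  -- passing to a quotient ring, lets the congruence be read coefficient by coefficient in ℤ[G].
  freshman : ∀ {p} → Prime p → ∀ x y → ∃ λ z → (x ⊕ y) ^ p ≈ x ^ p ⊕ y ^ p ⊕ p · z
  freshman {zero}        p-prime x y with () ← prime⇒nonZero p-prime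
  freshman {suc m} p-prime x y = sum z , (begin
    (x ⊕ y) ^ p                                          ≈⟨ Binomial.theorem p x y ⟩
    sum term                                             ≈⟨ +-congˡ (sum-init-last (λ i → term (Fin.suc i))) ⟩
    term Fin.zero ⊕ (sum middle ⊕ term (fromℕ p))         ≈⟨ +-cong first (+-cong (≈-trans (sum-cong-≋ middle-p) (·-sum p z)) last) ⟩
    y ^ p ⊕ (p · sum z ⊕ x ^ p)                          ≈⟨ rotate (y ^ p) (p · sum z) (x ^ p) ⟩
    x ^ p ⊕ y ^ p ⊕ p · sum z                            ∎)
    where
    p = suc m
    term : Fin (suc p) → Carrier
    term = binomialTerm x y p
    middle : Fin m → Carrier
    middle i = term (Fin.suc (inject₁ i))
    quot : ∀ i → p ∣ₙ (p C suc (toℕ (inject₁ i)))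
    quot i = prime∣binomial p-prime (toℕ (inject₁ i)) (ℕ.s≤s (subst (ℕ._< m) (sym (Finₚ.toℕ-inject₁ i)) (Finₚ.toℕ<n i)))
    z : Fin m → Carrier
    z i = ℕ∣._∣_.quotient (quot i) · Binomial.binomial x y p (Fin.suc (inject₁ i))
    middle-p : ∀ i → middle i ≈ p · z i
    middle-p i = ≈-trans
      (×-congˡ (trans (ℕ∣._∣_.equality (quot i)) (ℕₚ.*-comm (ℕ∣._∣_.quotient (quot i)) p)))
      (≈-sym (×-assocˡ _ p (ℕ∣._∣_.quotient (quot i))))
    first : term Fin.zero ≈ y ^ p
    first = ≈-trans (×-homo-1 _) (*-identityˡ _)
    last : term (fromℕ p) ≈ x ^ p
    last rewrite Finₚ.toℕ-fromℕ m | nCn≡1 p | ℕₚ.n∸n≡0 m = ≈-trans (×-homo-1 _) (*-identityʳ _)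
    rotate : ∀ a b c → a ⊕ (b ⊕ c) ≈ c ⊕ a ⊕ b
    rotate a b c = begin
      a ⊕ (b ⊕ c) ≈⟨ +-assoc a b c ⟨
      a ⊕ b ⊕ c   ≈⟨ +-comm _ c ⟩
      c ⊕ (a ⊕ b) ≈⟨ +-assoc c a b ⟨
      c ⊕ a ⊕ b   ∎

-- Integral group rings of finite abelian groups

record FinAb : Set₁ where
  infixl 7 _∙_
  infixr 8 _↑_
  field
    finSet : FinSet
  open FinSet finSet public
  field
    _∙_            : Carrier → Carrier → Carrier
    e              : Carrier
    _⁻¹            : Carrier → Carrier
    isAbelianGroup : IsAbelianGroup _≡_ _∙_ e _⁻¹

  abelianGroup : AbelianGroup 0ℓ 0ℓ
  abelianGroup = record { isAbelianGroup = isAbelianGroup }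

  open AbelianGroup abelianGroup public
    using (assoc; comm; identityˡ; identityʳ; inverseˡ; inverseʳ; monoid; commutativeMonoid)
  open import Algebra.Properties.AbelianGroup abelianGroup public
    using (ε⁻¹≈ε; ⁻¹-involutive; ⁻¹-∙-comm; ∙-cancelˡ; inverseʳ-unique)
  open import Algebra.Properties.Monoid.Mult monoid public using (×-homo-+; ×-assocˡ)
    renaming (_×_ to _times_)
  open import Algebra.Properties.CommutativeMonoid.Mult commutativeMonoid public using (×-distrib-+)

  _↑_ : Carrier → ℕ → Carrier
  x ↑ n = n times x

  ⁻¹∙-cancel : ∀ x y → x ⁻¹ ∙ (x ∙ y) ≡ y
  ⁻¹∙-cancel x y = trans (sym (assoc _ _ _)) (trans (cong (_∙ y) (inverseˡ x)) (identityˡ y))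

  ∙⁻¹-cancel : ∀ x y → x ∙ (x ⁻¹ ∙ y) ≡ y
  ∙⁻¹-cancel x y = trans (sym (assoc _ _ _)) (trans (cong (_∙ y) (inverseʳ x)) (identityˡ y))

  e↑ : ∀ n → e ↑ n ≡ e
  e↑ zero    = refl
  e↑ (suc n) = trans (identityˡ _) (e↑ n)

  ↑-* : ∀ x m n → x ↑ (m ℕ.* n) ≡ (x ↑ n) ↑ m
  ↑-* x m n = sym (×-assocˡ x m n)

  ↑-multiple : ∀ {x m} n → x ↑ m ≡ e → x ↑ (n ℕ.* m) ≡ e
  ↑-multiple {x} {m} n eq = trans (↑-* x n m) (trans (cong (_↑ n) eq) (e↑ n))

  ↑-1+multiple : ∀ {x m} n → x ↑ m ≡ e → x ↑ (1 ℕ.+ n ℕ.* m) ≡ x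
  ↑-1+multiple n eq = trans (cong (_ ∙_) (↑-multiple n eq)) (identityʳ _)

  Exponent : ℕ → Set
  Exponent m = ∀ x → x ↑ m ≡ e

  ↑-left-inverse : ∀ {m} → Exponent m → ∀ {k} → Coprime k m → ∃ λ l → ∀ x → (x ↑ k) ↑ l ≡ x
  ↑-left-inverse {m} exp {k} k⊥m with coprime-Bézout k⊥m
  ... | Bézout.+- l y eq = l , λ x → trans (sym (↑-* x l k)) (trans (cong (x ↑_) (sym eq)) (↑-1+multiple y (exp x)))
  -- Here `l * k` is -1 modulo `m`, so the inverse exponent is `-l`, written as `l * (m - 1)` to
  -- stay in ℕ.
  ... | Bézout.-+ l y eq = l ℕ.* (m ℕ.∸ 1) , λ x → trans (sym (↑-* x (l ℕ.* (m ℕ.∸ 1)) k)) (helper m (exp x) eq)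
    where
    helper : ∀ {x} m → x ↑ m ≡ e → 1 ℕ.+ l ℕ.* k ≡ y ℕ.* m → x ↑ (l ℕ.* (m ℕ.∸ 1) ℕ.* k) ≡ x
    helper zero _ eq′ with () ← trans eq′ (ℕₚ.*-zeroʳ y)
    helper {x} (suc m) x↑ eq′ = begin
      x ↑ (l ℕ.* m ℕ.* k)
        ≡⟨ trans (sym (identityʳ _)) (cong (x ↑ (l ℕ.* m ℕ.* k) ∙_) (sym (trans (cong (x ↑_) eq′) (↑-multiple y x↑)))) ⟩
      x ↑ (l ℕ.* m ℕ.* k) ∙ x ↑ (1 ℕ.+ l ℕ.* k)
        ≡⟨ sym (×-homo-+ x (l ℕ.* m ℕ.* k) (1 ℕ.+ l ℕ.* k)) ⟩
      x ↑ (l ℕ.* m ℕ.* k ℕ.+ (1 ℕ.+ l ℕ.* k))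
        ≡⟨ cong (x ↑_) (arith l m k) ⟩
      x ↑ (1 ℕ.+ l ℕ.* k ℕ.* suc m)
        ≡⟨ ↑-1+multiple (l ℕ.* k) x↑ ⟩
      x ∎
      where
      open ≡-Reasoning
      arith : ∀ l m k → l ℕ.* m ℕ.* k ℕ.+ (1 ℕ.+ l ℕ.* k) ≡ 1 ℕ.+ l ℕ.* k ℕ.* suc m
      arith = ℕSolver.solve-∀

  ↑-injective : ∀ {m} → Exponent m → ∀ {k} → Coprime k m → ∀ {x y} → x ↑ k ≡ y ↑ k → x ≡ y
  ↑-injective exp k⊥m {x} {y} eq with ↑-left-inverse exp k⊥m
  ... | l , inv = trans (sym (inv x)) (trans (cong (_↑ l) eq) (inv y))

  ∑-translate : ∀ z f → ∑ elems (λ y → f (z ∙ y)) ≡ ∑ elems f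
  ∑-translate z = ∑-reindex finSet finSet (z ∙_) (z ⁻¹ ∙_) (⁻¹∙-cancel z) (∙⁻¹-cancel z)

  ∑-inverse : ∀ f → ∑ elems (λ y → f (y ⁻¹)) ≡ ∑ elems f
  ∑-inverse = ∑-reindex finSet finSet _⁻¹ _⁻¹ ⁻¹-involutive ⁻¹-involutive

  ∑-reflect : ∀ z f → ∑ elems (λ y → f (y ⁻¹ ∙ z)) ≡ ∑ elems f
  ∑-reflect z f = trans (∑-cong elems (λ y → cong f (comm (y ⁻¹) z))) (trans (∑-inverse (λ y → f (z ∙ y))) (∑-translate z f))

  card : ℤ
  card = ∑ elems (λ _ → + 1)

module GroupRing (G : FinAb) where
  open FinAb G

  infixl 7 _⋆_
  _⋆_ : (Carrier → ℤ) → (Carrier → ℤ) → Carrier → ℤ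
  (f ⋆ g) x = ∑ elems (λ y → f y * g (y ⁻¹ ∙ x))

  total : (Carrier → ℤ) → ℤ
  total = ∑ elems

  ⋆-cong : ∀ {f f′ g g′} → (∀ x → f x ≡ f′ x) → (∀ x → g x ≡ g′ x) → ∀ x → (f ⋆ g) x ≡ (f′ ⋆ g′) x
  ⋆-cong f≡ g≡ x = ∑-cong elems (λ y → cong₂ _*_ (f≡ y) (g≡ _))

  ⋆-comm : ∀ f g x → (f ⋆ g) x ≡ (g ⋆ f) x
  ⋆-comm f g x = trans
    (∑-cong elems (λ y → trans (ℤₚ.*-comm (f y) _) (cong (λ z → g (y ⁻¹ ∙ x) * f z) (back y))))
    (∑-reflect x (λ z → g z * f (z ⁻¹ ∙ x)))
    where
    back : ∀ y → y ≡ (y ⁻¹ ∙ x) ⁻¹ ∙ x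
    back y = sym (begin
      (y ⁻¹ ∙ x) ⁻¹ ∙ x       ≡⟨ cong (_∙ x) (sym (⁻¹-∙-comm (y ⁻¹) x)) ⟩
      (y ⁻¹ ⁻¹ ∙ x ⁻¹) ∙ x    ≡⟨ assoc _ _ _ ⟩
      y ⁻¹ ⁻¹ ∙ (x ⁻¹ ∙ x)    ≡⟨ cong₂ _∙_ (⁻¹-involutive y) (inverseˡ x) ⟩
      y ∙ e                   ≡⟨ identityʳ y ⟩
      y                       ∎)
      where open ≡-Reasoning

  ⋆-assoc : ∀ f g h x → ((f ⋆ g) ⋆ h) x ≡ (f ⋆ (g ⋆ h)) x
  ⋆-assoc f g h x = begin
    ∑ elems (λ y → ∑ elems (λ z → f z * g (z ⁻¹ ∙ y)) * h (y ⁻¹ ∙ x))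
      ≡⟨ ∑-cong elems (λ y → trans (sym (∑-*ʳ elems (h (y ⁻¹ ∙ x)) _)) (∑-cong elems (λ z → ℤₚ.*-assoc (f z) _ _))) ⟩
    ∑ elems (λ y → ∑ elems (λ z → f z * (g (z ⁻¹ ∙ y) * h (y ⁻¹ ∙ x))))
      ≡⟨ ∑-swap elems elems _ ⟩
    ∑ elems (λ z → ∑ elems (λ y → f z * (g (z ⁻¹ ∙ y) * h (y ⁻¹ ∙ x))))
      ≡⟨ ∑-cong elems (λ z → ∑-*ˡ elems (f z) _) ⟩
    ∑ elems (λ z → f z * ∑ elems (λ y → g (z ⁻¹ ∙ y) * h (y ⁻¹ ∙ x)))
      ≡⟨ ∑-cong elems (λ z → cong (f z *_) (inner z)) ⟩
    ∑ elems (λ z → f z * (g ⋆ h) (z ⁻¹ ∙ x)) ∎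
    where
    open ≡-Reasoning
    inner : ∀ z → ∑ elems (λ y → g (z ⁻¹ ∙ y) * h (y ⁻¹ ∙ x)) ≡ (g ⋆ h) (z ⁻¹ ∙ x)
    inner z = trans (sym (∑-translate z _)) (∑-cong elems (λ y → cong₂ (λ u v → g u * h v)
      (⁻¹∙-cancel z y)
      (trans (cong (_∙ x) (trans (sym (⁻¹-∙-comm z y)) (comm (z ⁻¹) (y ⁻¹)))) (assoc (y ⁻¹) (z ⁻¹) x))))

  ⋆-identityˡ : ∀ f x → (δ e ⋆ f) x ≡ f x
  ⋆-identityˡ f x = trans (∑δ e (λ y → f (y ⁻¹ ∙ x))) (cong f (trans (cong (_∙ x) ε⁻¹≈ε) (identityˡ x)))

  ⋆-distribʳ : ∀ f g h x → ((λ y → g y + h y) ⋆ f) x ≡ (g ⋆ f) x + (h ⋆ f) x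
  ⋆-distribʳ f g h x = trans (∑-cong elems (λ y → ℤₚ.*-distribʳ-+ (f (y ⁻¹ ∙ x)) (g y) (h y))) (∑-+ elems _ _)

  ⋆-distribˡ : ∀ f g h x → (f ⋆ (λ y → g y + h y)) x ≡ (f ⋆ g) x + (f ⋆ h) x
  ⋆-distribˡ f g h x = trans (∑-cong elems (λ y → ℤₚ.*-distribˡ-+ (f y) (g (y ⁻¹ ∙ x)) (h (y ⁻¹ ∙ x)))) (∑-+ elems _ _)

  ⋆-scaleˡ : ∀ c f g x → ((λ y → c * f y) ⋆ g) x ≡ c * (f ⋆ g) x
  ⋆-scaleˡ c f g x = trans (∑-cong elems (λ y → ℤₚ.*-assoc c (f y) _)) (∑-*ˡ elems c _)

  ⋆-scaleʳ : ∀ c f g x → (f ⋆ (λ y → c * g y)) x ≡ c * (f ⋆ g) x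
  ⋆-scaleʳ c f g x = trans (⋆-comm f (λ y → c * g y) x) (trans (⋆-scaleˡ c g f x) (cong (c *_) (⋆-comm g f x)))

  ⋆-∑ˡ : ∀ {A : Set} (xs : List A) (f : A → Carrier → ℤ) g x →
    ((λ y → ∑ xs (λ i → f i y)) ⋆ g) x ≡ ∑ xs (λ i → (f i ⋆ g) x)
  ⋆-∑ˡ xs f g x = trans (∑-cong elems (λ y → sym (∑-*ʳ xs (g (y ⁻¹ ∙ x)) (λ i → f i y)))) (∑-swap elems xs _)

  ⋆-total : ∀ f x → (f ⋆ (λ _ → + 1)) x ≡ total f
  ⋆-total f x = ∑-cong elems (λ y → ℤₚ.*-identityʳ (f y))

  total-⋆ : ∀ f g → total (f ⋆ g) ≡ total f * total g
  total-⋆ f g = begin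
    ∑ elems (λ x → ∑ elems (λ y → f y * g (y ⁻¹ ∙ x)))  ≡⟨ ∑-swap elems elems _ ⟩
    ∑ elems (λ y → ∑ elems (λ x → f y * g (y ⁻¹ ∙ x)))  ≡⟨ ∑-cong elems (λ y → trans (∑-*ˡ elems (f y) _) (cong (f y *_) (∑-translate (y ⁻¹) g))) ⟩
    ∑ elems (λ y → f y * total g)                       ≡⟨ ∑-*ʳ elems (total g) f ⟩
    total f * total g                                   ∎
    where open ≡-Reasoning

  Symmetric : (Carrier → ℤ) → Set
  Symmetric f = ∀ x → f (x ⁻¹) ≡ f x

  -- With `f = g` the right side is a sum of squares; this is how positivity enters the group ring.
  ⋆-at-e : ∀ f g → Symmetric g → (f ⋆ g) e ≡ ∑ elems (λ y → f y * g y)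
  ⋆-at-e f g g-sym = ∑-cong elems (λ y → cong (f y *_) (trans (cong g (identityʳ (y ⁻¹))) (g-sym y)))

  ⋆-symmetric : ∀ f g → Symmetric f → Symmetric g → Symmetric (f ⋆ g)
  ⋆-symmetric f g f-sym g-sym x = trans (sym (∑-inverse _)) (∑-cong elems (λ y → cong₂ _*_ (f-sym y)
    (trans (cong g (⁻¹-∙-comm (y ⁻¹) x)) (g-sym _))))

  ring : CommutativeRing 0ℓ 0ℓ
  ring = record
    { _≈_ = λ f g → ∀ x → f x ≡ g x
    ; _+_ = λ f g x → f x + g x
    ; _*_ = _⋆_
    ; -_  = λ f x → - f x
    ; 0#  = λ _ → + 0
    ; 1#  = δ e
    ; isCommutativeRing = record
      { isRing = record
        { +-isAbelianGroup = Pointwise.isAbelianGroup Carrier ℤₚ.+-0-isAbelianGroup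
        ; *-cong     = ⋆-cong
        ; *-assoc    = ⋆-assoc
        ; *-identity = ⋆-identityˡ , λ f x → trans (⋆-comm f (δ e) x) (⋆-identityˡ f x)
        ; distrib    = ⋆-distribˡ , ⋆-distribʳ
        }
      ; *-comm = ⋆-comm
      }
    }

  open Freshman ring public using (_^_; _·_; freshman; ^-congˡ)

  ·-at : ∀ n f x → (n · f) x ≡ + n * f x
  ·-at zero    f x = sym (ℤₚ.*-zeroˡ (f x))
  ·-at (suc n) f x = trans (cong (_+_ (f x)) (·-at n f x)) (sym (ℤₚ.suc-* (+ n) (f x)))

  δ-⋆ : ∀ g h x → (δ g ⋆ δ h) x ≡ δ (g ∙ h) x
  δ-⋆ g h x = trans (∑δ g (λ y → δ h (y ⁻¹ ∙ x))) ([]-cong (h ≟ (g ⁻¹ ∙ x)) ((g ∙ h) ≟ x)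
    (λ eq → trans (cong (g ∙_) eq) (∙⁻¹-cancel g x)) (λ eq → trans (sym (⁻¹∙-cancel g h)) (cong (g ⁻¹ ∙_) eq)))

  δ-^ : ∀ g n x → (δ g ^ n) x ≡ δ (g ↑ n) x
  δ-^ g zero    x = refl
  δ-^ g (suc n) x = trans (⋆-cong {δ g} {δ g} (λ _ → refl) (δ-^ g n) x) (δ-⋆ g (g ↑ n) x)

  -- The image of `f` under the ring endomorphism of ℤ[G] induced by the endomorphism `y ↦ y ↑ p` of
  -- the group.
  pushforward : ℕ → (Carrier → ℤ) → Carrier → ℤ
  pushforward p f x = ∑ elems (λ y → f y * δ (y ↑ p) x)

  module _ {p} (p-prime : Prime p) where
    private
      Frob : (Carrier → ℤ) → Set
      Frob f = ∀ x → + p ∣ (f ^ p) x - pushforward p f x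

      Frob-cong : ∀ {f g} → (∀ x → f x ≡ g x) → Frob f → Frob g
      Frob-cong f≡g Ff x = subst (+ p ∣_) (cong₂ _-_ (^-congˡ p f≡g x) (∑-cong elems (λ y → cong (_* δ (y ↑ p) x) (f≡g y)))) (Ff x)

      Frob-δ : ∀ g → Frob (δ g)
      Frob-δ g x = divides (+ 0) (trans (cong₂ _-_ (δ-^ g p x) (∑δ g (λ y → δ (y ↑ p) x))) (ℤₚ.+-inverseʳ (δ (g ↑ p) x)))

      push-+ : ∀ f g x → pushforward p (λ y → f y + g y) x ≡ pushforward p f x + pushforward p g x
      push-+ f g x = trans (∑-cong elems (λ y → ℤₚ.*-distribʳ-+ (δ (y ↑ p) x) (f y) (g y))) (∑-+ elems _ _)

      push-0 : ∀ x → pushforward p (λ _ → + 0) x ≡ + 0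
      push-0 x = trans (∑-cong elems (λ y → ℤₚ.*-zeroˡ (δ (y ↑ p) x))) (∑-zero elems)

      0^p : ∀ {n} → ℕ.NonZero n → ∀ x → ((λ _ → + 0) ^ n) x ≡ + 0
      0^p {suc n} _ x = trans (∑-cong elems (λ y → ℤₚ.*-zeroˡ (((λ _ → + 0) ^ n) (y ⁻¹ ∙ x)))) (∑-zero elems)

      Frob-0 : Frob (λ _ → + 0)
      Frob-0 x = divides (+ 0) (cong₂ _-_ (0^p (prime⇒nonZero p-prime) x) (push-0 x))

      difference : ∀ f g x → ∃ λ z → ((λ y → f y + g y) ^ p) x - pushforward p (λ y → f y + g y) x
        ≡ ((f ^ p) x - pushforward p f x) + ((g ^ p) x - pushforward p g x) + z * + p
      difference f g x with z , eq ← freshman p-prime f g = z x ,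
        trans (cong₂ _-_ (trans (eq x) (cong (_+_ ((f ^ p) x + (g ^ p) x)) (·-at p z x))) (push-+ f g x))
              (regroup ((f ^ p) x) ((g ^ p) x) (+ p) (z x) (pushforward p f x) (pushforward p g x))
        where
        regroup : ∀ a b c d u v → (a + b + c * d) - (u + v) ≡ (a - u) + (b - v) + d * c
        regroup = solve-∀

      Frob-+ : ∀ f g → Frob f → Frob g → Frob (λ y → f y + g y)
      Frob-+ f g Ff Fg x with z , eq ← difference f g x =
        subst (+ p ∣_) (sym eq) (ℤ∣.∣m∣n⇒∣m+n (ℤ∣.∣m∣n⇒∣m+n (Ff x) (Fg x)) (divides z refl))

      -- Additivity is applied to `f + (- f) = 0`, so the sign (-1)^p, which would single out p = 2,
      -- never has to be computed.
      Frob-neg : ∀ f → Frob f → Frob (λ y → - f y)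
      Frob-neg f Ff x with z , eq ← difference f (λ y → - f y) x =
        ℤ∣.∣m+n∣m⇒∣n (ℤ∣.∣m+n∣n⇒∣m
          (subst (+ p ∣_) eq (Frob-cong (λ y → sym (ℤₚ.+-inverseʳ (f y))) Frob-0 x))
          (divides z refl)) (Ff x)

      Frob-ℕ* : ∀ n f → Frob f → Frob (λ y → + n * f y)
      Frob-ℕ* zero    f Ff = Frob-cong (λ y → sym (ℤₚ.*-zeroˡ (f y))) Frob-0
      Frob-ℕ* (suc n) f Ff = Frob-cong (λ y → sym (ℤₚ.suc-* (+ n) (f y))) (Frob-+ f _ Ff (Frob-ℕ* n f Ff))

      Frob-ℤ* : ∀ c f → Frob f → Frob (λ y → c * f y)
      Frob-ℤ* (+ n)        f Ff = Frob-ℕ* n f Ff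
      Frob-ℤ* (ℤ.-[1+ n ]) f Ff = Frob-cong (λ y → ℤₚ.neg-distribˡ-* (+ suc n) (f y)) (Frob-neg _ (Frob-ℕ* (suc n) f Ff))

      Frob-∑ : ∀ xs (f : Carrier → ℤ) → Frob (λ x → ∑ xs (λ y → f y * δ y x))
      Frob-∑ []       f = Frob-0
      Frob-∑ (y ∷ xs) f = Frob-+ _ _ (Frob-ℤ* (f y) (δ y) (Frob-δ y)) (Frob-∑ xs f)

    -- Modulo `p` both terms are additive in `f` by `freshman`, and they agree on the group elements
    -- `δ y`, of which `f` is an integral combination.
    frobenius : ∀ f x → + p ∣ (f ^ p) x - pushforward p f x
    frobenius f = Frob-cong expand (Frob-∑ elems f)
      where
      expand : ∀ x → ∑ elems (λ y → f y * δ y x) ≡ f x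
      expand x = trans (∑-cong elems (λ y → trans (ℤₚ.*-comm (f y) _) (cong (_* f y) ([]-cong (y ≟ x) (x ≟ y) sym sym)))) (∑δ x f)

    -- When the power map is injective, only `y = x` contributes to the pushforward at `x ↑ p`.
    frobenius-at : (∀ {x y} → x ↑ p ≡ y ↑ p → x ≡ y) → ∀ f x → + p ∣ (f ^ p) (x ↑ p) - f x
    frobenius-at inj f x = subst (λ z → + p ∣ (f ^ p) (x ↑ p) - z) collapse (frobenius f (x ↑ p))
      where
      collapse : pushforward p f (x ↑ p) ≡ f x
      collapse = trans (∑-cong elems (λ y → trans (ℤₚ.*-comm (f y) _) (cong (_* f y)
        ([]-cong ((y ↑ p) ≟ (x ↑ p)) (x ≟ y) (λ eq → sym (inj eq)) (λ eq → cong (_↑ p) (sym eq)))))) (∑δ x f)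

-- Divisibility by primes

prime-divisor : ∀ n → .{{ℕ.NonZero n}} → n ≢ 1 → ∃ λ q → Prime q × q ∣ₙ n
prime-divisor n n≢1 with factorise n
... | record { factors = [] ; isFactorisation = eq } = ⊥-elim (n≢1 eq)
... | record { factors = q ∷ qs ; isFactorisation = eq ; factorsPrime = q-prime ∷ _ } =
  q , q-prime , subst (q ∣ₙ_) (sym eq) (ℕ∣.m∣m*n (product qs))

coprime-from-primes : ∀ m n → .{{ℕ.NonZero n}} → (∀ q → Prime q → q ∣ₙ m → ¬ q ∣ₙ n) → Coprime m n
coprime-from-primes m n no-common {zero} (_ , 0∣n) = ⊥-elim (ℕ.≢-nonZero⁻¹ n (ℕ∣.0∣⇒≡0 0∣n))
coprime-from-primes m n no-common {suc i} (i∣m , i∣n) with suc i ℕₚ.≟ 1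
... | yes i≡1 = i≡1
... | no  i≢1 with q , q-prime , q∣i ← prime-divisor (suc i) i≢1 =
  ⊥-elim (no-common q q-prime (ℕ∣.∣-trans q∣i i∣m) (ℕ∣.∣-trans q∣i i∣n))

prime∤⇒coprime : ∀ {p n} → Prime p → ¬ p ∣ₙ n → Coprime p n
prime∤⇒coprime p-prime p∤n (i∣p , i∣n) with prime⇒irreducible p-prime i∣p
... | inj₁ i≡1  = i≡1
... | inj₂ refl = ⊥-elim (p∤n i∣n)

coprime⇒prime∤ : ∀ {p n} → Prime p → Coprime p n → ¬ p ∣ₙ n
coprime⇒prime∤ p-prime p⊥n p∣n with refl ← p⊥n (ℕ∣.∣-refl , p∣n) = ¬prime[1] p-prime

coprime-∣ : ∀ {d m n} → d ∣ₙ m → Coprime m n → Coprime d n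
coprime-∣ d∣m m⊥n (i∣d , i∣n) = m⊥n (ℕ∣.∣-trans i∣d d∣m , i∣n)

coprime-*ˡ : ∀ m n k → Coprime m k → Coprime n k → Coprime (m ℕ.* n) k
coprime-*ˡ m n k m⊥k n⊥k {i} (i∣mn , i∣k) =
  n⊥k (Coprimality.coprime-divisor (coprime-∣ i∣k (Coprimality.sym m⊥k)) i∣mn , i∣k)

-- `j` is the product of the prime factors of `m` that do not divide `k`. If `w` is coprime to `k`,
-- then no prime factor of `m` divides `k + j * w`: each of them divides exactly one of the two
-- summands.
coprime-part : ∀ k m → .{{ℕ.NonZero m}} → ∃ λ j →
  (∀ q → Prime q → q ∣ₙ m → ¬ q ∣ₙ k → q ∣ₙ j) × (∀ q → Prime q → q ∣ₙ k → ¬ q ∣ₙ j)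
coprime-part k m with factorise m
... | record { factors = qs ; isFactorisation = eq ; factorsPrime = primes } = product kept , contains , avoids
  where
  kept : List ℕ
  kept = filter (λ q → ¬? (q ℕ∣.∣? k)) qs
  contains : ∀ q → Prime q → q ∣ₙ m → ¬ q ∣ₙ k → q ∣ₙ product kept
  contains q q-prime q∣m q∤k = ∈⇒∣product (∈-filter⁺ _ (factorisationHasAllPrimeFactors q-prime (subst (q ∣ₙ_) eq q∣m) primes) q∤k)
  avoids : ∀ q → Prime q → q ∣ₙ k → ¬ q ∣ₙ product kept
  avoids q q-prime q∣k q∣j = proj₂ (∈-filter⁻ (λ q → ¬? (q ℕ∣.∣? k)) {xs = qs}
    (factorisationHasAllPrimeFactors q-prime q∣j (All.filter⁺ _ primes))) q∣k

2∤1 : ¬ 2 ∣ₙ 1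
2∤1 2∣1 with () ← ℕ∣.∣1⇒≡1 2∣1

euclidℤ : ∀ {p} → Prime p → ∀ i j → + p ∣ i * j → + p ∣ i ⊎ + p ∣ j
euclidℤ {p} p-prime i j p∣ij with euclidsLemma ℤ.∣ i ∣ ℤ.∣ j ∣ p-prime (subst (p ∣ₙ_) (ℤₚ.abs-* i j) (ℤ∣.∣⇒∣ᵤ p∣ij))
... | inj₁ p∣i = inj₁ (ℤ∣.∣ᵤ⇒∣ p∣i)
... | inj₂ p∣j = inj₂ (ℤ∣.∣ᵤ⇒∣ p∣j)

parity-ℕ : ∀ n → ∃ λ k → + n ≡ + 2 * k ⊎ + n ≡ + 1 + + 2 * k
parity-ℕ zero = + 0 , inj₁ refl
parity-ℕ (suc n) with parity-ℕ n
... | k , inj₁ eq = k , inj₂ (cong (_+_ (+ 1)) eq)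
... | k , inj₂ eq = + 1 + k , inj₁ (trans (cong (_+_ (+ 1)) eq) (shift k))
  where
  shift : ∀ k → + 1 + (+ 1 + + 2 * k) ≡ + 2 * (+ 1 + k)
  shift = solve-∀

parity : ∀ n → ∃ λ k → n ≡ + 2 * k ⊎ n ≡ + 1 + + 2 * k
parity (+ n)      = parity-ℕ n
parity ℤ.-[1+ n ] with parity-ℕ (suc n)
... | k , inj₁ eq = - k , inj₁ (trans (cong -_ eq) (negate k))
  where
  negate : ∀ k → - (+ 2 * k) ≡ + 2 * - k
  negate = solve-∀
... | k , inj₂ eq = - k - + 1 , inj₂ (trans (cong -_ eq) (negate k))
  where
  negate : ∀ k → - (+ 1 + + 2 * k) ≡ + 1 + + 2 * (- k - + 1)
  negate = solve-∀

2∣n²-n : ∀ n → + 2 ∣ n * n - n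
2∣n²-n n with parity n
... | k , inj₁ refl = divides (k * (+ 2 * k - + 1)) (factor k)
  where
  factor : ∀ k → (+ 2 * k) * (+ 2 * k) - + 2 * k ≡ k * (+ 2 * k - + 1) * + 2
  factor = solve-∀
... | k , inj₂ refl = divides (k * (+ 1 + + 2 * k)) (factor k)
  where
  factor : ∀ k → (+ 1 + + 2 * k) * (+ 1 + + 2 * k) - (+ 1 + + 2 * k) ≡ k * (+ 1 + + 2 * k) * + 2
  factor = solve-∀

-- Consequences of Frobenius

module Arithmetic (G : FinAb) where
  open FinAb G
  open GroupRing G

  -- Over 𝔽_q the group ring is reduced, because Frobenius only permutes coefficients.
  reduced : ∀ {q M} → Prime q → Exponent M → Coprime q M →
    ∀ F → (∀ x → + q ∣ (F ⋆ F) x) → ∀ x → + q ∣ F x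
  reduced {zero}        q-prime with () ← prime⇒nonZero q-prime
  reduced {suc zero}    q-prime = ⊥-elim (¬prime[1] q-prime)
  reduced {suc (suc n)} q-prime exp q⊥M F q∣F² x =
    subst (+ q ∣_) (cancel ((F ^ q) (x ↑ q)) (F x)) (ℤ∣.∣m∣n⇒∣m-n q∣F^q (frobenius-at q-prime (↑-injective exp q⊥M) F x))
    where
    q = suc (suc n)
    -- As `q` is at least 2, `F ^ q` contains the factor `F ⋆ F`.
    q∣F^q : + q ∣ (F ^ q) (x ↑ q)
    q∣F^q = subst (+ q ∣_) (⋆-assoc F F (F ^ n) (x ↑ q)) (∑-divides elems _ (λ y → ℤ∣.∣m⇒∣m*n _ (q∣F² y)))
    cancel : ∀ a b → a - (a - b) ≡ b
    cancel = solve-∀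

  private
    product-divides : ∀ {M} → Exponent M → ∀ qs → All Prime qs → All (λ q → Coprime q M) qs →
      ∀ c k F → (∀ x → (F ⋆ F) x ≡ + product qs * c * F x + + product qs * + product qs * k) →
      ∀ x → + product qs ∣ F x
    product-divides exp []       []                []             c k F F² x = divides (F x) (sym (ℤₚ.*-identityʳ (F x)))
    product-divides exp (q ∷ qs) (q-prime ∷ primes) (q⊥M ∷ coprimes) c k F F² x =
      divides (ℤ∣._∣_.quotient rest) (begin
        F x                                           ≡⟨ ℤ∣._∣_.equality (q∣F x) ⟩
        F′ x * + q                                    ≡⟨ cong (_* + q) (ℤ∣._∣_.equality rest) ⟩
        ℤ∣._∣_.quotient rest * + product qs * + q     ≡⟨ collect (ℤ∣._∣_.quotient rest) (+ product qs) (+ q) ⟩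
        ℤ∣._∣_.quotient rest * (+ q * + product qs)   ≡⟨ cong (ℤ∣._∣_.quotient rest *_) (sym (ℤₚ.pos-* q (product qs))) ⟩
        ℤ∣._∣_.quotient rest * + product (q ∷ qs)     ∎)
      where
      open ≡-Reasoning
      m = + product qs
      collect : ∀ a b c → a * b * c ≡ a * (c * b)
      collect = solve-∀
      F²′ : ∀ x → (F ⋆ F) x ≡ (+ q * m) * c * F x + (+ q * m) * (+ q * m) * k
      F²′ x = trans (F² x) (cong (λ z → z * c * F x + z * z * k) (ℤₚ.pos-* q (product qs)))
      factor : ∀ q m c f k → (q * m) * c * f + (q * m) * (q * m) * k ≡ (m * c * f + m * (q * m) * k) * q
      factor = solve-∀
      q∣F : ∀ x → + q ∣ F x
      q∣F = reduced q-prime exp q⊥M F (λ x → divides (m * c * F x + m * (+ q * m) * k) (trans (F²′ x) (factor (+ q) m c (F x) k)))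
      F′ : Carrier → ℤ
      F′ x = ℤ∣._∣_.quotient (q∣F x)
      F≡qF′ : ∀ x → F x ≡ + q * F′ x
      F≡qF′ x = trans (ℤ∣._∣_.equality (q∣F x)) (ℤₚ.*-comm (F′ x) (+ q))
      instance
        q≢0 : ℕ.NonZero q
        q≢0 = prime⇒nonZero q-prime
      q²F′² : ∀ x → + q * (+ q * (F′ ⋆ F′) x) ≡ + q * (+ q * (m * c * F′ x + m * m * k))
      q²F′² x = begin
        + q * (+ q * (F′ ⋆ F′) x)                             ≡⟨ cong (+ q *_) (sym (⋆-scaleˡ (+ q) F′ F′ x)) ⟩
        + q * ((λ y → + q * F′ y) ⋆ F′) x                     ≡⟨ sym (⋆-scaleʳ (+ q) (λ y → + q * F′ y) F′ x) ⟩
        ((λ y → + q * F′ y) ⋆ (λ y → + q * F′ y)) x           ≡⟨ sym (⋆-cong F≡qF′ F≡qF′ x) ⟩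
        (F ⋆ F) x                                             ≡⟨ F²′ x ⟩
        (+ q * m) * c * F x + (+ q * m) * (+ q * m) * k       ≡⟨ cong (λ z → (+ q * m) * c * z + (+ q * m) * (+ q * m) * k) (F≡qF′ x) ⟩
        (+ q * m) * c * (+ q * F′ x) + (+ q * m) * (+ q * m) * k ≡⟨ pull (+ q) m c (F′ x) k ⟩
        + q * (+ q * (m * c * F′ x + m * m * k))              ∎
        where
        pull : ∀ q m c f k → (q * m) * c * (q * f) + (q * m) * (q * m) * k ≡ q * (q * (m * c * f + m * m * k))
        pull = solve-∀
      rest : m ∣ F′ x
      rest = product-divides exp qs primes coprimes c k F′
        (λ x → ℤₚ.*-cancelˡ-≡ (+ q) _ _ (ℤₚ.*-cancelˡ-≡ (+ q) _ _ (q²F′² x))) x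

  abstract
    -- The primes of `m` are peeled off one at a time: such a `q` divides `F ⋆ F`, hence `F` by
    -- `reduced`, and `F / q` satisfies the same equation with `m / q` in place of `m`, with `c` and
    -- `k` unchanged.
    divides-quasi-idempotent : ∀ {m M} .{{_ : ℕ.NonZero m}} → Exponent M → Coprime m M →
      ∀ c k F → (∀ x → (F ⋆ F) x ≡ + m * c * F x + + m * + m * k) → ∀ x → + m ∣ F x
    divides-quasi-idempotent {m} {M} exp m⊥M c k F F² x with factorise m
    ... | record { factors = qs ; isFactorisation = refl ; factorsPrime = primes } =
      product-divides exp qs primes (coprimes qs (λ q∈ → q∈)) c k F F² x
      where
      coprimes : ∀ ps → (∀ {q} → q ∈ₗ ps → q ∈ₗ qs) → All (λ q → Coprime q M) ps
      coprimes []       ⊆ = []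
      coprimes (q ∷ ps) ⊆ = coprime-∣ (∈⇒∣product (⊆ (here refl))) m⊥M ∷ coprimes ps (λ q∈ → ⊆ (there q∈))

  -- Frobenius for the prime 2 at the identity: `(f ⋆ f) e` is congruent to `f e`, while by symmetry
  -- it is the sum of the squares `f y * f y`, each congruent to `f y`.
  total-parity : ∀ {M} → Exponent M → Coprime 2 M → ∀ f → Symmetric f → + 2 ∣ total f - f e
  total-parity exp 2⊥M f f-sym = subst (+ 2 ∣_) (telescope (total f) (∑ elems (λ y → f y * f y)) (f e))
    (ℤ∣.∣m∣n⇒∣m-n f²≡fe f²≡f)
    where
    telescope : ∀ a b c → (b - c) - (b - a) ≡ a - c
    telescope = solve-∀
    f⋆f : (f ^ 2) (e ↑ 2) ≡ ∑ elems (λ y → f y * f y)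
    f⋆f = trans (cong (f ^ 2) (e↑ 2)) (trans
      (⋆-cong {f} {f} (λ _ → refl) (λ x → trans (⋆-comm f (δ e) x) (⋆-identityˡ f x)) e)
      (⋆-at-e f f f-sym))
    f²≡fe : + 2 ∣ ∑ elems (λ y → f y * f y) - f e
    f²≡fe = subst (λ z → + 2 ∣ z - f e) f⋆f (frobenius-at prime[2] (↑-injective exp 2⊥M) f e)
    f²≡f : + 2 ∣ ∑ elems (λ y → f y * f y) - total f
    f²≡f = subst (+ 2 ∣_) (trans (∑-+ elems (λ y → f y * f y) (λ y → - f y)) (cong (_+_ (∑ elems (λ y → f y * f y))) (∑-neg elems f)))
      (∑-divides elems (λ y → f y * f y - f y) (λ y → 2∣n²-n (f y)))

  -- This takes the place of Cauchy's theorem. Convolution with the all-ones element multiplies it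
  -- by `card`, so a prime dividing `card` would divide its `q`-th power; Frobenius compares that
  -- power with the coefficient 1.
  prime∤card : ∀ {q M} → Prime q → Exponent M → Coprime q M → ¬ + q ∣ card
  prime∤card {zero}        q-prime with () ← prime⇒nonZero q-prime
  prime∤card {suc zero}    q-prime = ⊥-elim (¬prime[1] q-prime)
  prime∤card {suc (suc n)} q-prime exp q⊥M q∣card = 1-not-divisible (ℤ∣.∣⇒∣ᵤ
    (subst (+ q ∣_) (cancel ((one ^ q) (e ↑ q)) (+ 1)) (ℤ∣.∣m∣n⇒∣m-n q∣one^q (frobenius-at q-prime (↑-injective exp q⊥M) one e))))
    where
    q = suc (suc n)
    one : Carrier → ℤ
    one _ = + 1
    cancel : ∀ a b → a - (a - b) ≡ b
    cancel = solve-∀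
    constant : ∀ m → ∃ λ c → ∀ x → (one ^ suc m) x ≡ c
    constant m = total (one ^ m) , λ x → trans (⋆-comm one (one ^ m) x) (⋆-total (one ^ m) x)
    q∣one^q : + q ∣ (one ^ q) (e ↑ q)
    q∣one^q with c , eq ← constant n = subst (+ q ∣_)
      (sym (trans (∑-cong elems (λ y → cong (_*_ (+ 1)) (eq _))) (∑-*ʳ elems c one)))
      (ℤ∣.∣m⇒∣m*n c q∣card)
    1-not-divisible : ¬ q ∣ₙ 1
    1-not-divisible q∣1 with () ← ℕ∣.∣1⇒≡1 q∣1

  -- Frobenius for the scalar `n * δ e`, whose powers are again scalars.
  fermat : ∀ {p M} → Prime p → Exponent M → Coprime p M → ∀ n → + p ∣ n ℤ.^ p - n
  fermat {p} p-prime exp p⊥M n = subst (+ p ∣_)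
    (cong₂ _-_ (trans (power p (e ↑ p)) (scaled (n ℤ.^ p) (e↑ p))) (scaled n refl))
    (frobenius-at p-prime (↑-injective exp p⊥M) (λ x → n * δ e x) e)
    where
    scaled : ∀ c {x} → x ≡ e → c * δ e x ≡ c
    scaled c refl = trans (cong (c *_) (δ-refl e)) (ℤₚ.*-identityʳ c)
    power : ∀ k x → ((λ y → n * δ e y) ^ k) x ≡ n ℤ.^ k * δ e x
    power zero    x = sym (ℤₚ.*-identityˡ _)
    power (suc k) x = begin
      ((λ y → n * δ e y) ⋆ ((λ y → n * δ e y) ^ k)) x ≡⟨ ⋆-cong {λ y → n * δ e y} (λ _ → refl) (power k) x ⟩
      ((λ y → n * δ e y) ⋆ (λ y → n ℤ.^ k * δ e y)) x ≡⟨ ⋆-scaleˡ n (δ e) (λ y → n ℤ.^ k * δ e y) x ⟩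
      n * (δ e ⋆ (λ y → n ℤ.^ k * δ e y)) x           ≡⟨ cong (n *_) (⋆-identityˡ (λ y → n ℤ.^ k * δ e y) x) ⟩
      n * (n ℤ.^ k * δ e x)                           ≡⟨ sym (ℤₚ.*-assoc n (n ℤ.^ k) (δ e x)) ⟩
      n * n ℤ.^ k * δ e x                             ∎
      where open ≡-Reasoning

  -- Solutions of P² = nP + κG are constant on generators of cyclic subgroups

  module Multiplier {v} .{{v≢0 : ℕ.NonZero v}} (exp : Exponent v) (n κ : ℤ) (n∣v : ℤ.∣ n ∣ ∣ₙ v)
    (P : Carrier → ℤ) (P² : ∀ x → (P ⋆ P) x ≡ n * P x + κ) where

    power : ∀ m → ∃ λ c → ∀ x → (P ^ suc m) x ≡ n ℤ.^ m * P x + c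
    power zero    = + 0 , λ x → trans (trans (⋆-comm P (δ e) x) (⋆-identityˡ P x)) (one (P x))
      where
      one : ∀ a → a ≡ + 1 * a + + 0
      one = solve-∀
    power (suc m) with c , eq ← power m = n ℤ.^ m * κ + c * total P , λ x → begin
      (P ⋆ (P ^ suc m)) x                          ≡⟨ ⋆-cong {P} (λ _ → refl) eq x ⟩
      (P ⋆ (λ y → n ℤ.^ m * P y + c)) x            ≡⟨ ⋆-distribˡ P (λ y → n ℤ.^ m * P y) (λ _ → c) x ⟩
      (P ⋆ (λ y → n ℤ.^ m * P y)) x + (P ⋆ (λ _ → c)) x
        ≡⟨ cong₂ _+_ (⋆-scaleʳ (n ℤ.^ m) P P x) (trans (∑-*ʳ elems c P) (ℤₚ.*-comm (total P) c)) ⟩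
      n ℤ.^ m * (P ⋆ P) x + c * total P            ≡⟨ cong (λ z → n ℤ.^ m * z + c * total P) (P² x) ⟩
      n ℤ.^ m * (n * P x + κ) + c * total P        ≡⟨ regroup (n ℤ.^ m) n (P x) κ (c * total P) ⟩
      n * n ℤ.^ m * P x + (n ℤ.^ m * κ + c * total P) ∎
      where
      open ≡-Reasoning
      regroup : ∀ k n p κ c → k * (n * p + κ) + c ≡ n * k * p + (k * κ + c)
      regroup = solve-∀

    congruence : ∀ {p} → Prime p → Coprime p v → ∀ x → + p ∣ P (x ↑ p) - P x
    congruence {zero}  p-prime with () ← prime⇒nonZero p-prime
    congruence {suc m} p-prime p⊥v x with c , eq ← power m =
      subst (+ p ∣_) (combine (n ℤ.^ m) (P (x ↑ p)) (P e) (P x) c)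
        (ℤ∣.∣m∣n⇒∣m-n (ℤ∣.∣m∣n⇒∣m-n at-x at-e) (ℤ∣.∣m⇒∣m*n (P (x ↑ p) - P e) p∣n^m-1))
      where
      p = suc m
      at-x : + p ∣ (n ℤ.^ m * P (x ↑ p) + c) - P x
      at-x = subst (λ z → + p ∣ z - P x) (eq (x ↑ p)) (frobenius-at p-prime (↑-injective exp p⊥v) P x)
      -- Comparison with the identity, which the power map fixes, eliminates the unknown constant
      -- `c`.
      at-e : + p ∣ (n ℤ.^ m * P e + c) - P e
      at-e = subst (λ z → + p ∣ z - P e) (trans (eq (e ↑ p)) (cong (λ z → n ℤ.^ m * P z + c) (e↑ p)))
        (frobenius-at p-prime (↑-injective exp p⊥v) P e)
      -- Here `m` is `p - 1`, and `p` does not divide `n` because `n` divides `v`.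
      p∣n^m-1 : + p ∣ n ℤ.^ m - + 1
      p∣n^m-1 with euclidℤ p-prime n (n ℤ.^ m - + 1) (subst (+ p ∣_) (factor n (n ℤ.^ m)) (fermat p-prime exp p⊥v n))
        where
        factor : ∀ a b → a * b - a ≡ a * (b - + 1)
        factor = solve-∀
      ... | inj₁ p∣n = ⊥-elim (coprime⇒prime∤ p-prime p⊥v (ℕ∣.∣-trans (ℤ∣.∣⇒∣ᵤ p∣n) n∣v))
      ... | inj₂ p∣  = p∣
      combine : ∀ k a b d c → ((k * a + c) - d) - ((k * b + c) - b) - (k - + 1) * (a - b) ≡ a - d
      combine = solve-∀

    module _ (P01 : ∀ x → x ≢ e → P x ≡ + 0 ⊎ P x ≡ + 1) where

      -- Off the identity both values are 0 or 1, so being congruent modulo `p` they are equal.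
      prime-multiplier : ∀ {p} → Prime p → Coprime p v → ∀ x → P (x ↑ p) ≡ P x
      prime-multiplier {p} p-prime p⊥v x with x ≟ e
      ... | yes refl = cong P (e↑ p)
      ... | no  x≢e  = close (P01 (x ↑ p) (λ eq → x≢e (↑-injective exp p⊥v (trans eq (sym (e↑ p)))))) (P01 x x≢e) (congruence p-prime p⊥v x)
        where
        p∤1 : ¬ p ∣ₙ 1
        p∤1 p∣1 with refl ← ℕ∣.∣1⇒≡1 p∣1 = ¬prime[1] p-prime
        close : ∀ {i j} → i ≡ + 0 ⊎ i ≡ + 1 → j ≡ + 0 ⊎ j ≡ + 1 → + p ∣ i - j → i ≡ j
        close (inj₁ refl) (inj₁ refl) _  = refl
        close (inj₁ refl) (inj₂ refl) p∣ = ⊥-elim (p∤1 (ℤ∣.∣⇒∣ᵤ p∣))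
        close (inj₂ refl) (inj₁ refl) p∣ = ⊥-elim (p∤1 (ℤ∣.∣⇒∣ᵤ p∣))
        close (inj₂ refl) (inj₂ refl) _  = refl

      multiplier : ∀ s → .{{ℕ.NonZero s}} → Coprime s v → ∀ x → P (x ↑ s) ≡ P x
      multiplier s s⊥v x with factorise s
      ... | record { factors = qs ; isFactorisation = refl ; factorsPrime = primes } = go qs primes s⊥v
        where
        go : ∀ qs → All Prime qs → Coprime (product qs) v → P (x ↑ product qs) ≡ P x
        go []       []                   _   = cong P (identityʳ x)
        go (q ∷ qs) (q-prime ∷ primes) qs⊥v = trans (cong P (↑-* x q (product qs)))
          (trans (prime-multiplier q-prime (coprime-∣ (ℕ∣.m∣m*n (product qs)) qs⊥v) _)
                 (go qs primes (coprime-∣ (ℕ∣.n∣m*n q) qs⊥v)))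

      -- x^w = e for w = kl - 1, which is coprime to k, so k can be shifted by multiples of w to become coprime to v.
      same-cyclic : ∀ x k l → (x ↑ k) ↑ l ≡ x → P (x ↑ k) ≡ P x
      same-cyclic x k l back with k ℕ.* l in kl≡
      ... | zero = cong P (trans (cong (_↑ k) x≡e) (trans (e↑ k) (sym x≡e)))
        where
        x≡e : x ≡ e
        x≡e = trans (sym back) (trans (sym (↑-* x l k)) (cong (x ↑_) (trans (ℕₚ.*-comm l k) kl≡)))
      ... | suc w with j , contains , avoids ← coprime-part k v = trans (cong P (sym x↑s)) (multiplier s s⊥v x)
        where
        s = k ℕ.+ j ℕ.* w
        x↑w : x ↑ w ≡ e
        x↑w = ∙-cancelˡ x _ _ (trans (trans (sym (cong (x ↑_) (trans (ℕₚ.*-comm l k) kl≡))) (trans (↑-* x l k) back)) (sym (identityʳ x)))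
        x↑s : x ↑ s ≡ x ↑ k
        x↑s = trans (×-homo-+ x k (j ℕ.* w)) (trans (cong (x ↑ k ∙_) (↑-multiple j x↑w)) (identityʳ _))
        s⊥v : Coprime s v
        s⊥v = coprime-from-primes s v λ q q-prime q∣s q∣v → case-q q q-prime q∣s q∣v (q ℕ∣.∣? k)
          where
          case-q : ∀ q → Prime q → q ∣ₙ s → q ∣ₙ v → Dec (q ∣ₙ k) → ⊥
          case-q q q-prime q∣s q∣v (yes q∣k) with euclidsLemma j w q-prime (ℕ∣.∣m+n∣m⇒∣n q∣s q∣k)
          ... | inj₁ q∣j = avoids q q-prime q∣k q∣j
          ... | inj₂ q∣w with refl ← ℕ∣.∣1⇒≡1 (ℕ∣.∣m+n∣m⇒∣n (subst (q ∣ₙ_) (trans kl≡ (ℕₚ.+-comm 1 w)) (ℕ∣.∣m⇒∣m*n l q∣k)) q∣w) = ¬prime[1] q-prime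
          case-q q q-prime q∣s q∣v (no q∤k) =
            q∤k (ℕ∣.∣m+n∣m⇒∣n (subst (q ∣ₙ_) (ℕₚ.+-comm k (j ℕ.* w)) q∣s) (ℕ∣.∣m⇒∣m*n w (contains q q-prime q∣v q∤k)))
        instance
          s≢0 : ℕ.NonZero s
          s≢0 = ℕ.≢-nonZero λ s≡0 → ℕₚ.1+n≢0 (trans (sym kl≡) (cong (ℕ._* l) (ℕₚ.m+n≡0⇒m≡0 k s≡0)))

-- Rational idempotents

∑-mono : ∀ {A : Set} (xs : List A) (f g : A → ℤ) → (∀ x → f x ℤ.≤ g x) → ∑ xs f ℤ.≤ ∑ xs g
∑-mono []       f g f≤g = ℤₚ.≤-refl
∑-mono (x ∷ xs) f g f≤g = ℤₚ.+-mono-≤ (f≤g x) (∑-mono xs f g f≤g)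

[]-nonneg : ∀ {P : Set} (p? : Dec P) → + 0 ℤ.≤ [ p? ]
[]-nonneg (yes _) = ℤ.+≤+ ℕ.z≤n
[]-nonneg (no _)  = ℤₚ.≤-refl

[]-mono : ∀ {P Q : Set} (p? : Dec P) (q? : Dec Q) → (P → Q) → [ p? ] ℤ.≤ [ q? ]
[]-mono (yes p) (yes q) f = ℤₚ.≤-refl
[]-mono (yes p) (no ¬q) f = ⊥-elim (¬q (f p))
[]-mono (no ¬p) q?      f = []-nonneg q?

square-nonneg : ∀ i → + 0 ℤ.≤ i * i
square-nonneg (+ n)      = subst (+ 0 ℤ.≤_) (ℤₚ.pos-* n n) (ℤ.+≤+ ℕ.z≤n)
square-nonneg ℤ.-[1+ n ] = ℤ.+≤+ ℕ.z≤n

*-nonneg : ∀ {i j} → + 0 ℤ.≤ i → + 0 ℤ.≤ j → + 0 ℤ.≤ i * j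
*-nonneg {i} {j} 0≤i 0≤j = subst (ℤ._≤ i * j) (ℤₚ.*-zeroʳ i) (ℤₚ.*-monoˡ-≤-nonNeg i {{ℤ.nonNegative 0≤i}} 0≤j)

nonneg-cancel : ∀ s i → + 0 ℤ.< s → + 0 ℤ.≤ s * i → + 0 ℤ.≤ i
nonneg-cancel s i 0<s 0≤si = ℤₚ.*-cancelˡ-≤-pos (+ 0) i s {{ℤ.positive 0<s}} (subst (ℤ._≤ s * i) (sym (ℤₚ.*-zeroʳ s)) 0≤si)

*-positive : ∀ {i j} → + 0 ℤ.< i → + 0 ℤ.< j → + 0 ℤ.< i * j
*-positive {i} {j} 0<i 0<j = subst (ℤ._< i * j) (ℤₚ.*-zeroʳ i) (ℤₚ.*-monoˡ-<-pos i {{ℤ.positive 0<i}} 0<j)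

module Spectral (G : FinAb) {m} .{{m≢0 : ℕ.NonZero m}} (exp : FinAb.Exponent G m) where
  open FinAb G
  open GroupRing G
  open CommutativeRing ring using (*-commutativeSemigroup)
  open import Algebra.Properties.CommutativeSemigroup *-commutativeSemigroup using (interchange; x∙yz≈y∙xz)

  infix 4 _∈⟨_⟩
  _∈⟨_⟩ : Carrier → Carrier → Set
  x ∈⟨ g ⟩ = ∃ λ (k : Fin m) → x ≡ g ↑ toℕ k

  _∈⟨_⟩? : ∀ x g → Dec (x ∈⟨ g ⟩)
  x ∈⟨ g ⟩? = Finₚ.any? (λ k → x ≟ (g ↑ toℕ k))

  ∈⟨⟩-power : ∀ g k → g ↑ k ∈⟨ g ⟩
  ∈⟨⟩-power g k = fromℕ< (DivMod.m%n<n k m) , (begin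
    g ↑ k                               ≡⟨ cong (g ↑_) (DivMod.m≡m%n+[m/n]*n k m) ⟩
    g ↑ (k % m ℕ.+ (k DivMod./ m) ℕ.* m) ≡⟨ ×-homo-+ g (k % m) _ ⟩
    g ↑ (k % m) ∙ g ↑ ((k DivMod./ m) ℕ.* m) ≡⟨ cong (g ↑ (k % m) ∙_) (↑-multiple (k DivMod./ m) (exp g)) ⟩
    g ↑ (k % m) ∙ e                     ≡⟨ identityʳ _ ⟩
    g ↑ (k % m)                         ≡⟨ cong (g ↑_) (sym (Finₚ.toℕ-fromℕ< (DivMod.m%n<n k m))) ⟩
    g ↑ toℕ (fromℕ< (DivMod.m%n<n k m)) ∎)
    where open ≡-Reasoning

  ∈⟨⟩-refl : ∀ g → g ∈⟨ g ⟩
  ∈⟨⟩-refl g = subst (_∈⟨ g ⟩) (identityʳ g) (∈⟨⟩-power g 1)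

  ∈⟨⟩-trans : ∀ {x y z} → x ∈⟨ y ⟩ → y ∈⟨ z ⟩ → x ∈⟨ z ⟩
  ∈⟨⟩-trans {z = z} (k , refl) (l , refl) = subst (_∈⟨ z ⟩) (↑-* z (toℕ k) (toℕ l)) (∈⟨⟩-power z (toℕ k ℕ.* toℕ l))

  ∈⟨⟩-∙ : ∀ {x y z} → x ∈⟨ z ⟩ → y ∈⟨ z ⟩ → x ∙ y ∈⟨ z ⟩
  ∈⟨⟩-∙ {z = z} (k , refl) (l , refl) = subst (_∈⟨ z ⟩) (×-homo-+ z (toℕ k) (toℕ l)) (∈⟨⟩-power z (toℕ k ℕ.+ toℕ l))

  ⁻¹-power : ∀ x → x ⁻¹ ≡ x ↑ (ℕ.pred m)
  ⁻¹-power x = sym (inverseʳ-unique x _ (trans (cong (x ↑_) (ℕₚ.suc-pred m)) (exp x)))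

  ∈⟨⟩-⁻¹ : ∀ {x z} → x ∈⟨ z ⟩ → x ⁻¹ ∈⟨ z ⟩
  ∈⟨⟩-⁻¹ {x} x∈ = ∈⟨⟩-trans (subst (_∈⟨ x ⟩) (sym (⁻¹-power x)) (∈⟨⟩-power x (ℕ.pred m))) x∈

  cyc : Carrier → Carrier → ℤ
  cyc g x = [ x ∈⟨ g ⟩? ]

  cyc-e : ∀ g → cyc g e ≡ + 1
  cyc-e g = []-yes (e ∈⟨ g ⟩?) (∈⟨⟩-power g 0)

  cyc-sym : ∀ g → Symmetric (cyc g)
  cyc-sym g x = []-cong (x ⁻¹ ∈⟨ g ⟩?) (x ∈⟨ g ⟩?) (λ x∈ → subst (_∈⟨ g ⟩) (⁻¹-involutive x) (∈⟨⟩-⁻¹ x∈)) ∈⟨⟩-⁻¹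

  cyc-⋆ : ∀ g x → (cyc g ⋆ cyc g) x ≡ total (cyc g) * cyc g x
  cyc-⋆ g x = trans (∑-cong elems absorb) (∑-*ʳ elems (cyc g x) (cyc g))
    where
    absorb : ∀ y → cyc g y * cyc g (y ⁻¹ ∙ x) ≡ cyc g y * cyc g x
    absorb y with y ∈⟨ g ⟩?
    ... | yes y∈ = cong (_*_ (+ 1)) ([]-cong ((y ⁻¹ ∙ x) ∈⟨ g ⟩?) (x ∈⟨ g ⟩?)
            (λ p → subst (_∈⟨ g ⟩) (∙⁻¹-cancel y x) (∈⟨⟩-∙ y∈ p)) (∈⟨⟩-∙ (∈⟨⟩-⁻¹ y∈)))
    ... | no _ = refl

  cyc-total-positive : ∀ g → + 0 ℤ.< total (cyc g)
  cyc-total-positive g = ℤₚ.<-≤-trans (ℤ.+<+ (ℕ.s≤s ℕ.z≤n)) (subst (ℤ._≤ total (cyc g)) (cyc-e g)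
    (∑-≥-term e (cyc g) (λ y _ → []-nonneg (y ∈⟨ g ⟩?))))

  -- `F` acts as the scalar `c` on the ideal generated by `E`. In terms of characters, `c` is the
  -- common value at `F` of all characters that do not vanish at `E`.
  record Eigen (E F : Carrier → ℤ) (c : ℤ) : Set where
    constructor mkEigen
    field
      acts : ∀ x → (F ⋆ E) x ≡ c * E x

  open Eigen

  Eigen-δ : ∀ {E} → Eigen E (δ e) (+ 1)
  Eigen-δ {E} = mkEigen λ x → trans (⋆-identityˡ E x) (sym (ℤₚ.*-identityˡ (E x)))

  Eigen-+ : ∀ {E F F′ c c′} → Eigen E F c → Eigen E F′ c′ → Eigen E (λ x → F x + F′ x) (c + c′)
  Eigen-+ {E} {F} {F′} {c} {c′} EF EF′ = mkEigen λ x →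
    trans (⋆-distribʳ E F F′ x) (trans (cong₂ _+_ (acts EF x) (acts EF′ x)) (sym (ℤₚ.*-distribʳ-+ (E x) c c′)))

  Eigen-scale : ∀ {E F c} k → Eigen E F c → Eigen E (λ x → k * F x) (k * c)
  Eigen-scale {E} {F} {c} k EF = mkEigen λ x → trans (⋆-scaleˡ k F E x) (trans (cong (k *_) (acts EF x)) (sym (ℤₚ.*-assoc k c (E x))))

  Eigen-⋆ : ∀ {E F F′ c c′} → Eigen E F c → Eigen E F′ c′ → Eigen E (F ⋆ F′) (c * c′)
  Eigen-⋆ {E} {F} {F′} {c} {c′} EF EF′ = mkEigen λ x → begin
    ((F ⋆ F′) ⋆ E) x          ≡⟨ ⋆-assoc F F′ E x ⟩
    (F ⋆ (F′ ⋆ E)) x          ≡⟨ ⋆-cong {F} (λ _ → refl) (acts EF′) x ⟩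
    (F ⋆ (λ y → c′ * E y)) x  ≡⟨ ⋆-scaleʳ c′ F E x ⟩
    c′ * (F ⋆ E) x            ≡⟨ cong (c′ *_) (acts EF x) ⟩
    c′ * (c * E x)            ≡⟨ swap c c′ (E x) ⟩
    c * c′ * E x              ∎
    where
    open ≡-Reasoning
    swap : ∀ c c′ x → c′ * (c * x) ≡ c * c′ * x
    swap = solve-∀

  Eigen-cong : ∀ {E F F′ c} → (∀ x → F x ≡ F′ x) → Eigen E F c → Eigen E F′ c
  Eigen-cong {E} {F} {F′} F≡ EF = mkEigen λ x → trans (sym (⋆-cong {F} {F′} {E} F≡ (λ _ → refl) x)) (acts EF x)

  Eigen-∑ : ∀ {A : Set} (xs : List A) {E} {F : A → Carrier → ℤ} {c : A → ℤ} →
    (∀ i → Eigen E (F i) (c i)) → Eigen E (λ x → ∑ xs (λ i → F i x)) (∑ xs c)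
  Eigen-∑ xs {E} {F} {c} EF = mkEigen λ x → trans (⋆-∑ˡ xs F E x) (trans (∑-cong xs (λ i → acts (EF i) x)) (∑-*ʳ xs (E x) c))

  Eigen-unique : ∀ {E F c c′} → E e ≢ + 0 → Eigen E F c → Eigen E F c′ → c ≡ c′
  Eigen-unique {E} {F} {c} {c′} Ee≢0 EF EF′ = ℤₚ.*-cancelʳ-≡ c c′ (E e) {{ℤ.≢-nonZero Ee≢0}} (trans (sym (acts EF e)) (acts EF′ e))

  -- `E / scale` is a rational idempotent; carrying the scale along avoids denominators. Symmetry
  -- makes `(E ⋆ E) e` a sum of squares, whence `nonneg-at-e`.
  record QuasiIdempotent (E : Carrier → ℤ) : Set where
    field
      scale     : ℤ
      positive  : + 0 ℤ.< scale
      square    : ∀ x → (E ⋆ E) x ≡ scale * E x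
      symmetric : Symmetric E

    nonneg-at-e : + 0 ℤ.≤ E e
    nonneg-at-e = nonneg-cancel scale (E e) positive
      (subst (+ 0 ℤ.≤_) (trans (sym (⋆-at-e E E symmetric)) (square e)) (∑-nonneg elems _ (λ y → square-nonneg (E y))))

  open QuasiIdempotent

  _⋆-quasi_ : ∀ {E F} → QuasiIdempotent E → QuasiIdempotent F → QuasiIdempotent (E ⋆ F)
  _⋆-quasi_ {E} {F} qE qF = record
    { scale     = scale qE * scale qF
    ; positive  = *-positive (positive qE) (positive qF)
    ; square    = λ x → begin
        ((E ⋆ F) ⋆ (E ⋆ F)) x                             ≡⟨ interchange E F E F x ⟩
        ((E ⋆ E) ⋆ (F ⋆ F)) x                             ≡⟨ ⋆-cong (square qE) (square qF) x ⟩
        ((λ y → scale qE * E y) ⋆ (λ y → scale qF * F y)) x ≡⟨ ⋆-scaleˡ (scale qE) E (λ y → scale qF * F y) x ⟩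
        scale qE * (E ⋆ (λ y → scale qF * F y)) x         ≡⟨ cong (scale qE *_) (⋆-scaleʳ (scale qF) E F x) ⟩
        scale qE * (scale qF * (E ⋆ F) x)                 ≡⟨ sym (ℤₚ.*-assoc (scale qE) (scale qF) _) ⟩
        scale qE * scale qF * (E ⋆ F) x                   ∎
    ; symmetric = ⋆-symmetric E F (symmetric qE) (symmetric qF)
    }
    where open ≡-Reasoning

  cyc-quasi : ∀ g → QuasiIdempotent (cyc g)
  cyc-quasi g = record { scale = total (cyc g) ; positive = cyc-total-positive g ; square = cyc-⋆ g ; symmetric = cyc-sym g }

  -- A multiple of the idempotent complementary to that of ⟨g⟩: it cuts out the characters that are
  -- nontrivial on `g`.
  co-cyc : Carrier → Carrier → ℤ
  co-cyc g x = total (cyc g) * δ e x + - + 1 * cyc g x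

  δe-sym : Symmetric (δ e)
  δe-sym x = []-cong (e ≟ (x ⁻¹)) (e ≟ x)
    (λ eq → trans (trans (sym ε⁻¹≈ε) (cong _⁻¹ eq)) (⁻¹-involutive x)) (λ eq → trans (sym ε⁻¹≈ε) (cong _⁻¹ eq))

  cyc-⋆-co-cyc : ∀ g x → (co-cyc g ⋆ cyc g) x ≡ + 0
  cyc-⋆-co-cyc g x = trans (acts (Eigen-+ {cyc g} (Eigen-scale (total (cyc g)) Eigen-δ) (Eigen-scale (- + 1) (mkEigen (cyc-⋆ g)))) x) (vanish (total (cyc g)) (cyc g x))
    where
    vanish : ∀ t k → (t * + 1 + - + 1 * t) * k ≡ + 0
    vanish = solve-∀

  cyc-kills : ∀ g → Eigen (co-cyc g) (cyc g) (+ 0)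
  cyc-kills g = mkEigen λ x → trans (⋆-comm (cyc g) (co-cyc g) x) (trans (cyc-⋆-co-cyc g x) (sym (ℤₚ.*-zeroˡ (co-cyc g x))))

  co-cyc-quasi : ∀ g → QuasiIdempotent (co-cyc g)
  co-cyc-quasi g = record
    { scale = total (cyc g)
    ; positive = cyc-total-positive g
    ; square = λ x → trans (acts (Eigen-+ {co-cyc g} (Eigen-scale (total (cyc g)) Eigen-δ) (Eigen-scale (- + 1) (cyc-kills g))) x) (scale-only (total (cyc g)) (co-cyc g x))
    ; symmetric = λ x → cong₂ (λ u v → total (cyc g) * u + - + 1 * v) (δe-sym x) (cyc-sym g x)
    }
    where
    scale-only : ∀ t k → (t * + 1 + - + 1 * + 0) * k ≡ t * k
    scale-only = solve-∀

  -- A common eigenspace of all cyclic subgroup sums. `E = 0` is allowed, since repeated splitting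
  -- may produce it; this is why `Eigen-unique` asks for a nonzero `E e`.
  record Simple (E : Carrier → ℤ) : Set where
    field
      quasi : QuasiIdempotent E
      eigen : ∀ g → ∃ (Eigen E (cyc g))

  Eigen-⋆-right : ∀ {E F c} X → Eigen E F c → Eigen (X ⋆ E) F c
  Eigen-⋆-right {E} {F} {c} X EF = mkEigen λ x → trans (x∙yz≈y∙xz F X E x) (trans (⋆-cong {X} (λ _ → refl) (acts EF) x) (⋆-scaleʳ c X E x))

  Eigen-⋆-left : ∀ {X F c} E → Eigen X F c → Eigen (X ⋆ E) F c
  Eigen-⋆-left {X} {F} {c} E XF = mkEigen λ x → trans (sym (⋆-assoc F X E x)) (trans (⋆-cong {F ⋆ X} {_} {E} (acts XF) (λ _ → refl) x) (⋆-scaleˡ c X E x))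

  elems-complete : ∀ x → x ∈ₗ elems
  elems-complete x = go elems (λ eq → 0≢1 (trans (sym eq) (δ-total x)))
    where
    0≢1 : + 0 ≢ + 1
    0≢1 ()
    go : ∀ xs → ∑ xs (δ x) ≢ + 0 → x ∈ₗ xs
    go []       ≢0 = ⊥-elim (≢0 refl)
    go (y ∷ xs) ≢0 with x ≟ y
    ... | yes refl = here refl
    ... | no _     = there (go xs (λ eq → ≢0 (trans (ℤₚ.+-identityˡ _) eq)))

  -- |⟨g⟩| E = ⟨g⟩ E + (|⟨g⟩| - ⟨g⟩) E splits E into two parts on each of which ⟨g⟩ acts as a scalar.
  nonneg-from-simple : ∀ F → (∀ E → Simple E → + 0 ℤ.≤ (F ⋆ E) e) → + 0 ℤ.≤ F e
  nonneg-from-simple F simple≥0 = subst (+ 0 ℤ.≤_) (trans (⋆-comm F (δ e) e) (⋆-identityˡ F e))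
    (split elems (δ e) δ-quasi (λ g → inj₁ (elems-complete g)))
    where
    δ-quasi : QuasiIdempotent (δ e)
    δ-quasi = record { scale = + 1 ; positive = ℤ.+<+ (ℕ.s≤s ℕ.z≤n) ; square = acts (Eigen-δ {δ e}) ; symmetric = δe-sym }
    split : ∀ gs E → QuasiIdempotent E → (∀ g → g ∈ₗ gs ⊎ ∃ (Eigen E (cyc g))) → + 0 ℤ.≤ (F ⋆ E) e
    split []       E qE rest = simple≥0 E (record { quasi = qE ; eigen = λ g → resolved (rest g) })
      where
      resolved : ∀ {g} → g ∈ₗ [] ⊎ ∃ (Eigen E (cyc g)) → ∃ (Eigen E (cyc g))
      resolved (inj₂ p) = p
    split (g ∷ gs) E qE rest = nonneg-cancel (total (cyc g)) ((F ⋆ E) e) (cyc-total-positive g)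
      (subst (+ 0 ℤ.≤_) recombine (ℤₚ.+-mono-≤
        (split gs (cyc g ⋆ E) (cyc-quasi g ⋆-quasi qE) (λ h → narrow (cyc g) h (total (cyc g) , mkEigen (cyc-⋆ g)) (rest h)))
        (split gs (co-cyc g ⋆ E) (co-cyc-quasi g ⋆-quasi qE) (λ h → narrow (co-cyc g) h (+ 0 , cyc-kills g) (rest h)))))
      where
      narrow : ∀ X h → ∃ (Eigen X (cyc g)) → h ∈ₗ g ∷ gs ⊎ ∃ (Eigen E (cyc h)) → h ∈ₗ gs ⊎ ∃ (Eigen (X ⋆ E) (cyc h))
      narrow X h (c , eig) (inj₁ (here refl)) = inj₂ (c , Eigen-⋆-left E eig)
      narrow X h _         (inj₁ (there h∈))  = inj₁ h∈
      narrow X h _         (inj₂ (c , eig))   = inj₂ (c , Eigen-⋆-right X eig)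
      recombine : (F ⋆ (cyc g ⋆ E)) e + (F ⋆ (co-cyc g ⋆ E)) e ≡ total (cyc g) * (F ⋆ E) e
      recombine = begin
        (F ⋆ (cyc g ⋆ E)) e + (F ⋆ (co-cyc g ⋆ E)) e     ≡⟨ sym (⋆-distribˡ F (cyc g ⋆ E) (co-cyc g ⋆ E) e) ⟩
        (F ⋆ (λ x → (cyc g ⋆ E) x + (co-cyc g ⋆ E) x)) e ≡⟨ ⋆-cong {F} (λ _ → refl) pieces e ⟩
        (F ⋆ (λ x → total (cyc g) * E x)) e              ≡⟨ ⋆-scaleʳ (total (cyc g)) F E e ⟩
        total (cyc g) * (F ⋆ E) e                        ∎
        where
        open ≡-Reasoning
        pieces : ∀ x → (cyc g ⋆ E) x + (co-cyc g ⋆ E) x ≡ total (cyc g) * E x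
        pieces x = begin
          (cyc g ⋆ E) x + (co-cyc g ⋆ E) x
            ≡⟨ cong (_+_ ((cyc g ⋆ E) x)) (⋆-distribʳ E (λ y → total (cyc g) * δ e y) (λ y → - + 1 * cyc g y) x) ⟩
          (cyc g ⋆ E) x + (((λ y → total (cyc g) * δ e y) ⋆ E) x + ((λ y → - + 1 * cyc g y) ⋆ E) x)
            ≡⟨ cong (_+_ ((cyc g ⋆ E) x)) (cong₂ _+_ (trans (⋆-scaleˡ (total (cyc g)) (δ e) E x) (cong (total (cyc g) *_) (⋆-identityˡ E x))) (⋆-scaleˡ (- + 1) (cyc g) E x)) ⟩
          (cyc g ⋆ E) x + (total (cyc g) * E x + - + 1 * (cyc g ⋆ E) x)
            ≡⟨ cancel ((cyc g ⋆ E) x) (total (cyc g) * E x) ⟩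
          total (cyc g) * E x ∎
          where
          cancel : ∀ a b → a + (b + - + 1 * a) ≡ b
          cancel = solve-∀

  -- The premise says that `x ↑ k` generates the same cyclic subgroup as `x`.
  Invariant : (Carrier → ℤ) → Set
  Invariant F = ∀ x k l → (x ↑ k) ↑ l ≡ x → F (x ↑ k) ≡ F x

  invariant-∈⟨⟩ : ∀ {F} → Invariant F → ∀ {x y} → y ∈⟨ x ⟩ → x ∈⟨ y ⟩ → F y ≡ F x
  invariant-∈⟨⟩ F-inv {x} (k , refl) (l , eq) = F-inv x (toℕ k) (toℕ l) (sym eq)

  cyc-invariant : ∀ g → Invariant (cyc g)
  cyc-invariant g x k l back = []-cong ((x ↑ k) ∈⟨ g ⟩?) (x ∈⟨ g ⟩?)
    (λ p → subst (_∈⟨ g ⟩) back (∈⟨⟩-trans (∈⟨⟩-power (x ↑ k) l) p)) (∈⟨⟩-trans (∈⟨⟩-power x k))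

  ord : Carrier → ℕ
  ord x = ℤ.∣ total (cyc x) ∣

  +ord : ∀ x → + ord x ≡ total (cyc x)
  +ord x = ℤₚ.0≤i⇒+∣i∣≡i (ℤₚ.<⇒≤ (cyc-total-positive x))

  ord-mono : ∀ {x y} → y ∈⟨ x ⟩ → ord y ℕ.≤ ord x
  ord-mono {x} {y} y∈x = ℤ.drop‿+≤+ (subst₂ ℤ._≤_ (sym (+ord y)) (sym (+ord x))
    (∑-mono elems (cyc y) (cyc x) (λ z → []-mono (z ∈⟨ y ⟩?) (z ∈⟨ x ⟩?) (λ z∈ → ∈⟨⟩-trans z∈ y∈x))))

  -- The indicator of ⟨x⟩ minus that of ⟨y⟩ is nonnegative with sum 0, so it cannot be 1 at `x`.
  ord-≡⇒∈⟨⟩ : ∀ {x y} → y ∈⟨ x ⟩ → ord y ≡ ord x → x ∈⟨ y ⟩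
  ord-≡⇒∈⟨⟩ {x} {y} y∈x eq with x ∈⟨ y ⟩? in dec
  ... | yes x∈y = x∈y
  ... | no  x∉y = ⊥-elim (ℤₚ.<⇒≱ (ℤ.+<+ (ℕ.s≤s ℕ.z≤n)) (subst₂ ℤ._≤_ at-x sum-zero
    (∑-≥-term x diff (λ z _ → diff≥0 z))))
    where
    diff : Carrier → ℤ
    diff z = cyc x z - cyc y z
    diff≥0 : ∀ z → + 0 ℤ.≤ diff z
    diff≥0 z = ℤₚ.i≤j⇒0≤j-i ([]-mono (z ∈⟨ y ⟩?) (z ∈⟨ x ⟩?) (λ z∈ → ∈⟨⟩-trans z∈ y∈x))
    at-x : diff x ≡ + 1
    at-x = cong₂ _-_ ([]-yes (x ∈⟨ x ⟩?) (∈⟨⟩-refl x)) ([]-no (x ∈⟨ y ⟩?) x∉y)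
    sum-zero : ∑ elems diff ≡ + 0
    sum-zero = trans (∑-+ elems (cyc x) (λ z → - cyc y z)) (trans (cong (_+_ (total (cyc x))) (∑-neg elems (cyc y)))
      (ℤₚ.i≡j⇒i-j≡0 (trans (sym (+ord x)) (trans (cong +_ (sym eq)) (+ord y)))))

  module _ {E} (simple : Simple E) where
    private
      Supported : ℕ → (Carrier → ℤ) → Set
      Supported o F = ∀ x → F x ≢ + 0 → ord x ℕ.< o

      -- Removing multiples of cyclic subgroup sums clears the elements of highest order.
      reduce : ∀ o F → Invariant F → Supported o F → ∃ (Eigen E F)
      clear  : ∀ o xs F → Invariant F → Supported (suc o) F → (∀ x → ord x ≡ o → F x ≢ + 0 → x ∈ₗ xs) → ∃ (Eigen E F)

      reduce zero    F F-inv supp = + 0 , Eigen-cong F-zero (mkEigen λ x → trans (∑-cong elems (λ y → ℤₚ.*-zeroˡ (E (y ⁻¹ ∙ x)))) (trans (∑-zero elems) (sym (ℤₚ.*-zeroˡ (E x)))))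
        where
        F-zero : ∀ x → + 0 ≡ F x
        F-zero x with F x ℤₚ.≟ + 0
        ... | yes eq = sym eq
        ... | no  ≢0 with () ← supp x ≢0
      reduce (suc o) F F-inv supp = clear o elems F F-inv supp (λ x _ _ → elems-complete x)

      clear o []       F F-inv supp top = reduce o F F-inv supp′
        where
        supp′ : Supported o F
        supp′ x ≢0 = ℕₚ.≤∧≢⇒< (ℕ.s≤s⁻¹ (supp x ≢0)) λ eq → nothing (top x eq ≢0)
          where
          nothing : ¬ x ∈ₗ []
          nothing ()
      clear o (x ∷ xs) F F-inv supp top with ord x ℕₚ.≟ o
      ... | no ord≢ = clear o xs F F-inv supp λ y eq ≢0 → tail (top y eq ≢0) eq
        where
        tail : ∀ {y} → y ∈ₗ x ∷ xs → ord y ≡ o → y ∈ₗ xs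
        tail (here refl) eq = ⊥-elim (ord≢ eq)
        tail (there y∈)  _  = y∈
      ... | yes ord≡ = combine (clear o xs F′ F′-inv supp′ top′) (Simple.eigen simple x)
        where
        F′ : Carrier → ℤ
        F′ y = F y - F x * cyc x y
        restore : ∀ y → F′ y + F x * cyc x y ≡ F y
        restore y = back (F y) (F x * cyc x y)
          where
          back : ∀ a b → (a - b) + b ≡ a
          back = solve-∀
        combine : ∃ (Eigen E F′) → ∃ (Eigen E (cyc x)) → ∃ (Eigen E F)
        combine (c , eig) (k , eigx) = c + F x * k , Eigen-cong restore (Eigen-+ eig (Eigen-scale (F x) eigx))
        F′-inv : Invariant F′
        F′-inv y k l back = cong₂ (λ u v → u - F x * v) (F-inv y k l back) (cyc-invariant x y k l back)
        F′-outside : ∀ y → ¬ y ∈⟨ x ⟩ → F′ y ≡ F y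
        F′-outside y y∉ = trans (cong (λ z → F y - F x * z) ([]-no (y ∈⟨ x ⟩?) y∉)) (keep (F y) (F x))
          where
          keep : ∀ a b → a - b * + 0 ≡ a
          keep = solve-∀
        F′-generator : ∀ y → F y ≡ F x → y ∈⟨ x ⟩ → F′ y ≡ + 0
        F′-generator y eq y∈ = trans (cong₂ (λ u v → u - F x * v) eq ([]-yes (y ∈⟨ x ⟩?) y∈)) (gone (F x))
          where
          gone : ∀ a → a - a * + 1 ≡ + 0
          gone = solve-∀
        -- The subtraction changes coefficients only inside ⟨x⟩, where no order exceeds that of `x`.
        supp′ : Supported (suc o) F′
        supp′ y ≢0 with y ∈⟨ x ⟩?
        ... | yes y∈ = ℕ.s≤s (subst (ord y ℕ.≤_) ord≡ (ord-mono y∈))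
        ... | no  y∉ = supp y λ eq → ≢0 (trans (keep (F y) (F x)) eq)
          where
          keep : ∀ a b → a - b * + 0 ≡ a
          keep = solve-∀
        top′ : ∀ y → ord y ≡ o → F′ y ≢ + 0 → y ∈ₗ xs
        top′ y eq ≢0 = pick (y ∈⟨ x ⟩?)
          where
          tail : y ∈ₗ x ∷ xs → y ∈ₗ xs
          tail (here refl) = ⊥-elim (≢0 (F′-generator x refl (∈⟨⟩-refl x)))
          tail (there y∈)  = y∈
          pick : Dec (y ∈⟨ x ⟩) → y ∈ₗ xs
          -- An element of ⟨x⟩ with the order of `x` generates ⟨x⟩; by invariance its coefficient
          -- equals that of `x` and has been cleared together with it.
          pick (yes y∈) = ⊥-elim (≢0 (F′-generator y (invariant-∈⟨⟩ F-inv y∈ (ord-≡⇒∈⟨⟩ y∈ (trans eq (sym ord≡)))) y∈))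
          pick (no  y∉) = tail (top y eq (λ Fy≡0 → ≢0 (trans (F′-outside y y∉) Fy≡0)))

    abstract
      -- The eigenvalue is an integer because the reduction uses only integral multiples of the
      -- `cyc x`, each of which acts on `E` as an integer. It starts above `card`, which bounds
      -- every order.
      invariant⇒eigen : ∀ F → Invariant F → ∃ (Eigen E F)
      invariant⇒eigen F F-inv = reduce (suc ℤ.∣ card ∣) F F-inv λ x _ → ℕ.s≤s (ℤ.drop‿+≤+
        (subst₂ ℤ._≤_ (sym (+ord x)) (sym (ℤₚ.0≤i⇒+∣i∣≡i (∑-nonneg elems (λ _ → + 1) (λ _ → ℤ.+≤+ ℕ.z≤n))))
          (∑-mono elems (cyc x) (λ _ → + 1) (λ y → []≤1 (y ∈⟨ x ⟩?)))))
        where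
        []≤1 : ∀ {P : Set} (p? : Dec P) → [ p? ] ℤ.≤ + 1
        []≤1 (yes _) = ℤₚ.≤-refl
        []≤1 (no _)  = ℤ.+≤+ ℕ.z≤n

-- Splitting a finite abelian group into coprime parts

uip : ∀ {A : Set} {x y : A} (p q : x ≡ y) → p ≡ q
uip refl refl = refl

module Fixed (G : FinAb) (s : ℕ) where
  open FinAb G

  Fix : Set
  Fix = ∃ λ x → x ↑ s ≡ x

  fix-≡ : {x y : Fix} → proj₁ x ≡ proj₁ y → x ≡ y
  fix-≡ {x , p} {.x , q} refl = cong (x ,_) (uip p q)

  fix-≟ : (x y : Fix) → Dec (x ≡ y)
  fix-≟ x y with proj₁ x ≟ proj₁ y
  ... | yes eq = yes (fix-≡ eq)
  ... | no  ≢  = no λ eq → ≢ (cong proj₁ eq)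

  collect : List Carrier → List Fix
  collect []       = []
  collect (x ∷ xs) with (x ↑ s) ≟ x
  ... | yes eq = (x , eq) ∷ collect xs
  ... | no  _  = collect xs

  ∑-collect : ∀ xs (f : Carrier → ℤ) → ∑ (collect xs) (λ x → f (proj₁ x)) ≡ ∑ xs (λ x → f x * [ (x ↑ s) ≟ x ])
  ∑-collect []       f = refl
  ∑-collect (x ∷ xs) f with (x ↑ s) ≟ x
  ... | yes eq = cong₂ _+_ (sym (ℤₚ.*-identityʳ (f x))) (∑-collect xs f)
  ... | no  _  = trans (∑-collect xs f) (trans (sym (ℤₚ.+-identityˡ (∑ xs (λ x → f x * [ (x ↑ s) ≟ x ])))) (cong (_+ ∑ xs (λ x → f x * [ (x ↑ s) ≟ x ])) (sym (ℤₚ.*-zeroʳ (f x)))))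

  fix-finSet : FinSet
  fix-finSet = record
    { Carrier = Fix
    ; _≟_     = fix-≟
    ; elems   = collect elems
    ; δ-total = λ x → begin
        ∑ (collect elems) (λ y → [ fix-≟ x y ])         ≡⟨ ∑-cong (collect elems) (λ y → []-cong (fix-≟ x y) (proj₁ x ≟ proj₁ y) (cong proj₁) fix-≡) ⟩
        ∑ (collect elems) (λ y → δ (proj₁ x) (proj₁ y)) ≡⟨ ∑-collect elems (δ (proj₁ x)) ⟩
        ∑ elems (λ y → δ (proj₁ x) y * [ (y ↑ s) ≟ y ]) ≡⟨ ∑δ (proj₁ x) (λ y → [ (y ↑ s) ≟ y ]) ⟩
        [ (proj₁ x ↑ s) ≟ proj₁ x ]                     ≡⟨ []-yes ((proj₁ x ↑ s) ≟ proj₁ x) (proj₂ x) ⟩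
        + 1 ∎
    }
    where open ≡-Reasoning

  ⁻¹-↑ : ∀ x n → (x ⁻¹) ↑ n ≡ (x ↑ n) ⁻¹
  ⁻¹-↑ x zero    = sym ε⁻¹≈ε
  ⁻¹-↑ x (suc n) = trans (cong (x ⁻¹ ∙_) (⁻¹-↑ x n)) (⁻¹-∙-comm x (x ↑ n))

  fix-∙ : Fix → Fix → Fix
  fix-∙ (x , p) (y , q) = x ∙ y , trans (×-distrib-+ x y s) (cong₂ _∙_ p q)

  fix-⁻¹ : Fix → Fix
  fix-⁻¹ (x , p) = x ⁻¹ , trans (⁻¹-↑ x s) (cong _⁻¹ p)

  fixed : FinAb
  fixed = record
    { finSet = fix-finSet
    ; _∙_ = fix-∙
    ; e   = e , e↑ s
    ; _⁻¹ = fix-⁻¹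
    ; isAbelianGroup = record
      { isGroup = record
        { isMonoid = record
          { isSemigroup = record
            { isMagma = record { isEquivalence = isEquivalence ; ∙-cong = cong₂ fix-∙ }
            ; assoc = λ x y z → fix-≡ (assoc (proj₁ x) (proj₁ y) (proj₁ z))
            }
          ; identity = (λ x → fix-≡ (identityˡ (proj₁ x))) , λ x → fix-≡ (identityʳ (proj₁ x))
          }
        ; inverse = (λ x → fix-≡ (inverseˡ (proj₁ x))) , λ x → fix-≡ (inverseʳ (proj₁ x))
        ; ⁻¹-cong = cong fix-⁻¹
        }
      ; comm = λ x y → fix-≡ (comm (proj₁ x) (proj₁ y))
      }
    }

  fixed-↑ : ∀ x n → proj₁ (FinAb._↑_ fixed x n) ≡ proj₁ x ↑ n
  fixed-↑ x zero    = refl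
  fixed-↑ x (suc n) = cong (proj₁ x ∙_) (fixed-↑ x n)

-- `s` is 1 modulo `A` and 0 modulo `B`, and `s′` the reverse: raising to these powers projects onto
-- the two coprime parts of the group. In the witnesses `pred v` stands for -1 modulo `A * B`.
orthogonal-exponents : ∀ A B → .{{ℕ.NonZero (A ℕ.* B)}} → Coprime A B →
  ∃ λ s → ∃ λ s′ → ∃ λ q → B ∣ₙ s × A ∣ₙ s′ × s ℕ.+ s′ ≡ 1 ℕ.+ q ℕ.* (A ℕ.* B)
orthogonal-exponents A B A⊥B with coprime-Bézout A⊥B
... | Bézout.+- x y eq = y ℕ.* B ℕ.* ℕ.pred v , x ℕ.* A , y ℕ.* B , ℕ∣.∣m⇒∣m*n (ℕ.pred v) (ℕ∣.n∣m*n y) , ℕ∣.n∣m*n x ,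
  trans (cong (y ℕ.* B ℕ.* ℕ.pred v ℕ.+_) (sym eq)) (trans (arith (y ℕ.* B) (ℕ.pred v)) (cong (λ z → 1 ℕ.+ y ℕ.* B ℕ.* z) (ℕₚ.suc-pred v)))
  where
  v = A ℕ.* B
  arith : ∀ u w → u ℕ.* w ℕ.+ (1 ℕ.+ u) ≡ 1 ℕ.+ u ℕ.* suc w
  arith = ℕSolver.solve-∀
... | Bézout.-+ x y eq = y ℕ.* B , x ℕ.* A ℕ.* ℕ.pred v , x ℕ.* A , ℕ∣.n∣m*n y , ℕ∣.∣m⇒∣m*n (ℕ.pred v) (ℕ∣.n∣m*n x) ,
  trans (cong (ℕ._+ x ℕ.* A ℕ.* ℕ.pred v) (sym eq)) (trans (arith (x ℕ.* A) (ℕ.pred v)) (cong (λ z → 1 ℕ.+ x ℕ.* A ℕ.* z) (ℕₚ.suc-pred v)))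
  where
  v = A ℕ.* B
  arith : ∀ u w → (1 ℕ.+ u) ℕ.+ u ℕ.* w ≡ 1 ℕ.+ u ℕ.* suc w
  arith = ℕSolver.solve-∀

module Splitting (G : FinAb) (A B : ℕ) .{{A≢0 : ℕ.NonZero A}} .{{B≢0 : ℕ.NonZero B}} (A⊥B : Coprime A B)
  (exp : FinAb.Exponent G (A ℕ.* B)) (card≡ : FinAb.card G ≡ + (A ℕ.* B))
  (s s′ q : ℕ) (B∣s : B ∣ₙ s) (A∣s′ : A ∣ₙ s′) (s+s′ : s ℕ.+ s′ ≡ 1 ℕ.+ q ℕ.* (A ℕ.* B)) where
  open FinAb G

  private
    ↑-v∣ : ∀ x {k} → A ℕ.* B ∣ₙ k → x ↑ k ≡ e
    ↑-v∣ x (ℕ∣.divides q refl) = ↑-multiple q (exp x)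

    decompose : ∀ x → x ↑ s ∙ x ↑ s′ ≡ x
    decompose x = trans (sym (×-homo-+ x s s′)) (trans (cong (x ↑_) s+s′) (↑-1+multiple q (exp x)))

    kill : ∀ x → (x ↑ s′) ↑ s ≡ e
    kill x = trans (sym (↑-* x s s′)) (↑-v∣ x (subst (A ℕ.* B ∣ₙ_) (ℕₚ.*-comm s′ s) (ℕ∣.*-pres-∣ A∣s′ B∣s)))

    kill′ : ∀ x → (x ↑ s) ↑ s′ ≡ e
    kill′ x = trans (sym (↑-* x s′ s)) (↑-v∣ x (ℕ∣.*-pres-∣ A∣s′ B∣s))

    fixed-s : ∀ x → (x ↑ s) ↑ s ≡ x ↑ s
    fixed-s x = begin
      (x ↑ s) ↑ s                     ≡⟨ sym (identityʳ _) ⟩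
      (x ↑ s) ↑ s ∙ e                 ≡⟨ cong ((x ↑ s) ↑ s ∙_) (sym (kill x)) ⟩
      (x ↑ s) ↑ s ∙ (x ↑ s′) ↑ s      ≡⟨ sym (×-distrib-+ (x ↑ s) (x ↑ s′) s) ⟩
      (x ↑ s ∙ x ↑ s′) ↑ s            ≡⟨ cong (_↑ s) (decompose x) ⟩
      x ↑ s                           ∎
      where open ≡-Reasoning

    fixed-s′ : ∀ x → (x ↑ s′) ↑ s′ ≡ x ↑ s′
    fixed-s′ x = begin
      (x ↑ s′) ↑ s′                   ≡⟨ sym (identityˡ _) ⟩
      e ∙ (x ↑ s′) ↑ s′               ≡⟨ cong (_∙ (x ↑ s′) ↑ s′) (sym (kill′ x)) ⟩
      (x ↑ s) ↑ s′ ∙ (x ↑ s′) ↑ s′    ≡⟨ sym (×-distrib-+ (x ↑ s) (x ↑ s′) s′) ⟩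
      (x ↑ s ∙ x ↑ s′) ↑ s′           ≡⟨ cong (_↑ s′) (decompose x) ⟩
      x ↑ s′                          ∎
      where open ≡-Reasoning

  N H : FinAb
  N = Fixed.fixed G s
  H = Fixed.fixed G s′

  private
    module N = FinAb N
    module H = FinAb H

  infixl 7 _⊙_
  _⊙_ : N.Carrier → H.Carrier → Carrier
  n ⊙ h = proj₁ n ∙ proj₁ h

  ⊙-↑s : ∀ n h → (n ⊙ h) ↑ s ≡ proj₁ n
  ⊙-↑s (n , n-fix) (h , h-fix) = begin
    (n ∙ h) ↑ s              ≡⟨ ×-distrib-+ n h s ⟩
    n ↑ s ∙ h ↑ s            ≡⟨ cong₂ _∙_ n-fix (trans (cong (_↑ s) (sym h-fix)) (kill h)) ⟩
    n ∙ e                    ≡⟨ identityʳ n ⟩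
    n                        ∎
    where open ≡-Reasoning

  ⊙-↑s′ : ∀ n h → (n ⊙ h) ↑ s′ ≡ proj₁ h
  ⊙-↑s′ (n , n-fix) (h , h-fix) = begin
    (n ∙ h) ↑ s′             ≡⟨ ×-distrib-+ n h s′ ⟩
    n ↑ s′ ∙ h ↑ s′          ≡⟨ cong₂ _∙_ (trans (cong (_↑ s′) (sym n-fix)) (kill′ n)) h-fix ⟩
    e ∙ h                    ≡⟨ identityˡ h ⟩
    h                        ∎
    where open ≡-Reasoning

  -- Chinese remaindering of exponents. Invariance of `P` concerns powers in the whole group; this
  -- turns it into invariance in each factor separately.
  ⊙-power : ∀ n h k l → ∃ λ m → (n ⊙ h) ↑ m ≡ (n N.↑ k) ⊙ (h H.↑ l)
  ⊙-power n h k l = k ℕ.* s ℕ.+ l ℕ.* s′ , (begin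
    x ↑ (k ℕ.* s ℕ.+ l ℕ.* s′)       ≡⟨ ×-homo-+ x (k ℕ.* s) (l ℕ.* s′) ⟩
    x ↑ (k ℕ.* s) ∙ x ↑ (l ℕ.* s′)   ≡⟨ cong₂ _∙_ (↑-* x k s) (↑-* x l s′) ⟩
    (x ↑ s) ↑ k ∙ (x ↑ s′) ↑ l       ≡⟨ cong₂ (λ u w → u ↑ k ∙ w ↑ l) (⊙-↑s n h) (⊙-↑s′ n h) ⟩
    proj₁ n ↑ k ∙ proj₁ h ↑ l        ≡⟨ cong₂ _∙_ (sym (Fixed.fixed-↑ G s n k)) (sym (Fixed.fixed-↑ G s′ h l)) ⟩
    (n N.↑ k) ⊙ (h H.↑ l)            ∎)
    where
    open ≡-Reasoning
    x = n ⊙ h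

  ∑-split : ∀ f → ∑ N.elems (λ n → ∑ H.elems (λ h → f (n ⊙ h))) ≡ ∑ elems f
  ∑-split f = begin
    ∑ N.elems (λ n → ∑ H.elems (λ h → f (n ⊙ h)))
      ≡⟨ ∑-cong N.elems (λ n → trans (∑-cong H.elems (λ h → sym (∑δ (n ⊙ h) f))) (∑-swap H.elems elems _)) ⟩
    ∑ N.elems (λ n → ∑ elems (λ x → ∑ H.elems (λ h → δ (n ⊙ h) x * f x)))
      ≡⟨ ∑-swap N.elems elems _ ⟩
    ∑ elems (λ x → ∑ N.elems (λ n → ∑ H.elems (λ h → δ (n ⊙ h) x * f x)))
      ≡⟨ ∑-cong elems (λ x → ∑-cong N.elems (λ n → trans
           (∑-cong H.elems (λ h → trans (cong (_* f x) (δ-⊙ n h x)) (ℤₚ.*-assoc (N.δ (πN x) n) (H.δ (πH x) h) (f x))))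
           (trans (∑-*ˡ H.elems (N.δ (πN x) n) (λ h → H.δ (πH x) h * f x)) (cong (N.δ (πN x) n *_) (H.∑δ (πH x) (λ _ → f x)))))) ⟩
    ∑ elems (λ x → ∑ N.elems (λ n → N.δ (πN x) n * f x))
      ≡⟨ ∑-cong elems (λ x → N.∑δ (πN x) (λ _ → f x)) ⟩
    ∑ elems f ∎
    where
    open ≡-Reasoning
    πN : Carrier → N.Carrier
    πN x = x ↑ s , fixed-s x
    πH : Carrier → H.Carrier
    πH x = x ↑ s′ , fixed-s′ x
    δ-⊙ : ∀ n h x → δ (n ⊙ h) x ≡ N.δ (πN x) n * H.δ (πH x) h
    δ-⊙ n h x with πN x N.≟ n | πH x H.≟ h
    ... | yes refl | yes refl = []-yes ((πN x ⊙ πH x) ≟ x) (decompose x)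
    ... | yes _    | no ≢     = []-no ((n ⊙ h) ≟ x) (λ eq → ≢ (Fixed.fix-≡ G s′ (trans (cong (_↑ s′) (sym eq)) (⊙-↑s′ n h))))
    ... | no ≢     | h?       = trans ([]-no ((n ⊙ h) ≟ x) (λ eq → ≢ (Fixed.fix-≡ G s (trans (cong (_↑ s) (sym eq)) (⊙-↑s n h))))) (sym (ℤₚ.*-zeroˡ [ h? ]))

  N-exponent : N.Exponent A
  N-exponent n = Fixed.fix-≡ G s (trans (Fixed.fixed-↑ G s n A) (trans (cong (_↑ A) (sym (proj₂ n)))
    (trans (sym (↑-* (proj₁ n) A s)) (↑-v∣ (proj₁ n) (ℕ∣.*-monoʳ-∣ A B∣s)))))

  H-exponent : H.Exponent B
  H-exponent h = Fixed.fix-≡ G s′ (trans (Fixed.fixed-↑ G s′ h B) (trans (cong (_↑ B) (sym (proj₂ h)))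
    (trans (sym (↑-* (proj₁ h) B s′)) (↑-v∣ (proj₁ h) (subst (A ℕ.* B ∣ₙ_) (ℕₚ.*-comm s′ B) (ℕ∣.*-monoˡ-∣ B A∣s′))))))

  private
    +∣card∣ : ∀ (K : FinAb) → + ℤ.∣ FinAb.card K ∣ ≡ FinAb.card K
    +∣card∣ K = ℤₚ.0≤i⇒+∣i∣≡i (∑-nonneg (FinAb.elems K) (λ _ → + 1) (λ _ → ℤ.+≤+ ℕ.z≤n))

    cards : ℤ.∣ N.card ∣ ℕ.* ℤ.∣ H.card ∣ ≡ A ℕ.* B
    cards = ℤₚ.+-injective (begin
      + (ℤ.∣ N.card ∣ ℕ.* ℤ.∣ H.card ∣)              ≡⟨ ℤₚ.pos-* ℤ.∣ N.card ∣ ℤ.∣ H.card ∣ ⟩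
      + ℤ.∣ N.card ∣ * + ℤ.∣ H.card ∣                ≡⟨ cong₂ _*_ (+∣card∣ N) (+∣card∣ H) ⟩
      N.card * H.card                                ≡⟨ sym (∑-*ʳ N.elems H.card (λ _ → + 1)) ⟩
      ∑ N.elems (λ n → + 1 * H.card)                 ≡⟨ ∑-cong N.elems (λ n → ℤₚ.*-identityˡ H.card) ⟩
      ∑ N.elems (λ n → ∑ H.elems (λ h → + 1))        ≡⟨ ∑-split (λ _ → + 1) ⟩
      card                                           ≡⟨ card≡ ⟩
      + (A ℕ.* B)                                    ∎)
      where open ≡-Reasoning

    -- By `prime∤card` every prime divisor of the order divides the exponent.
    order-coprime : ∀ (K : FinAb) {M M′} .{{_ : ℕ.NonZero M′}} → FinAb.Exponent K M → Coprime M M′ → Coprime ℤ.∣ FinAb.card K ∣ M′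
    order-coprime K {M} {M′} exp′ M⊥M′ = coprime-from-primes _ M′ λ q q-prime q∣card q∣M′ →
      Arithmetic.prime∤card K q-prime exp′ (prime∤⇒coprime q-prime λ q∣M → ¬prime[1] (subst Prime (M⊥M′ (q∣M , q∣M′)) q-prime))
        (subst (+ q ∣_) (+∣card∣ K) (ℤ∣.∣ᵤ⇒∣ q∣card))

    ∣N∣⊥B : Coprime ℤ.∣ N.card ∣ B
    ∣N∣⊥B = order-coprime N N-exponent A⊥B
    ∣H∣⊥A : Coprime ℤ.∣ H.card ∣ A
    ∣H∣⊥A = order-coprime H H-exponent (Coprimality.sym A⊥B)

  -- The two orders multiply to `A * B`, the first is coprime to `B` and the second to `A`; so each
  -- of |N| and `A` divides the other.
  N-card : N.card ≡ + A
  N-card = trans (sym (+∣card∣ N)) (cong +_ (ℕ∣.∣-antisym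
    (Coprimality.coprime-divisor ∣N∣⊥B (subst (ℤ.∣ N.card ∣ ∣ₙ_) (trans cards (ℕₚ.*-comm A B)) (ℕ∣.m∣m*n ℤ.∣ H.card ∣)))
    (Coprimality.coprime-divisor (Coprimality.sym ∣H∣⊥A) (subst (A ∣ₙ_) (trans (sym cards) (ℕₚ.*-comm ℤ.∣ N.card ∣ _)) (ℕ∣.m∣m*n B)))))

  H-card : H.card ≡ + B
  H-card = trans (sym (+∣card∣ H)) (cong +_ (ℕ∣.∣-antisym
    (Coprimality.coprime-divisor ∣H∣⊥A (subst (ℤ.∣ H.card ∣ ∣ₙ_) cards (ℕ∣.n∣m*n ℤ.∣ N.card ∣)))
    (Coprimality.coprime-divisor (Coprimality.sym ∣N∣⊥B) (subst (B ∣ₙ_) (sym cards) (ℕ∣.n∣m*n A)))))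

-- Two coprime factors

nonzero-square≥1 : ∀ i → i ≢ + 0 → + 1 ℤ.≤ i * i
nonzero-square≥1 (+ zero)   i≢0 = ⊥-elim (i≢0 refl)
nonzero-square≥1 (+ suc n)  i≢0 = ℤ.+≤+ (ℕ.s≤s ℕ.z≤n)
nonzero-square≥1 ℤ.-[1+ n ] i≢0 = ℤ.+≤+ (ℕ.s≤s ℕ.z≤n)

0∨1 : ∀ {n} i → n ≢ + 0 → i * i ≡ n * i → ∃ λ g → i ≡ n * g × (g ≡ + 0 ⊎ g ≡ + 1)
0∨1 {n} i n≢0 eq with i ℤₚ.≟ + 0
... | yes refl = + 0 , sym (ℤₚ.*-zeroʳ n) , inj₁ refl
... | no  i≢0  = + 1 , trans (ℤₚ.*-cancelʳ-≡ i n i {{ℤ.≢-nonZero i≢0}} eq) (sym (ℤₚ.*-identityʳ n)) , inj₂ refl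

-- For odd `τ` and `y` of the parity of `g`, the number `1 - g` is 1 exactly when `y` and `τ` differ
-- in parity, and then their squared distance is at least 1. For even `τ` the indicator is `g`
-- itself.
odd-gap : ∀ {τ y g} → ¬ + 2 ∣ τ → + 2 ∣ y - g → g ≡ + 0 ⊎ g ≡ + 1 → + 0 ℤ.≤ (y - τ) * (y - τ) - + 1 + g
odd-gap {τ} {y} 2∤τ 2∣y-g (inj₁ refl) = subst (+ 0 ℤ.≤_) (sym (ℤₚ.+-identityʳ ((y - τ) * (y - τ) - + 1)))
  (ℤₚ.i≤j⇒0≤j-i (nonzero-square≥1 (y - τ) λ eq → 2∤τ (subst (+ 2 ∣_) (trans (ℤₚ.+-identityʳ y) (ℤₚ.i-j≡0⇒i≡j y τ eq)) 2∣y-g)))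
odd-gap {τ} {y} 2∤τ 2∣y-g (inj₂ refl) = subst (+ 0 ℤ.≤_) (restore ((y - τ) * (y - τ))) (square-nonneg (y - τ))
  where
  restore : ∀ s → s ≡ s - + 1 + + 1
  restore = solve-∀

even-gap : ∀ {τ y g} → + 2 ∣ τ → + 2 ∣ y - g → g ≡ + 0 ⊎ g ≡ + 1 → + 0 ℤ.≤ (y - τ) * (y - τ) - g
even-gap {τ} {y} 2∣τ 2∣y-g (inj₁ refl) = subst (+ 0 ℤ.≤_) (sym (ℤₚ.+-identityʳ ((y - τ) * (y - τ)))) (square-nonneg (y - τ))
even-gap {τ} {y} 2∣τ 2∣y-g (inj₂ refl) = ℤₚ.i≤j⇒0≤j-i (nonzero-square≥1 (y - τ) λ eq → 2∤1
  (ℤ∣.∣⇒∣ᵤ (subst (+ 2 ∣_) (back y) (ℤ∣.∣m∣n⇒∣m-n (subst (+ 2 ∣_) (sym (ℤₚ.i-j≡0⇒i≡j y τ eq)) 2∣τ) 2∣y-g))))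
  where
  back : ∀ y → y - (y - + 1) ≡ + 1
  back = solve-∀

<⇒0<- : ∀ {i j} → i ℤ.< j → + 0 ℤ.< j - i
<⇒0<- {i} {j} i<j = subst (ℤ._< j - i) (ℤₚ.+-inverseʳ i) (ℤₚ.+-monoˡ-< (- i) i<j)

between : ∀ {u m} → + 0 ℤ.≤ m → + 0 ℤ.≤ u * (m - u) → + 0 ℤ.≤ u × u ℤ.≤ m
between {u} {m} 0≤m 0≤prod = lower , upper
  where
  negative : ∀ {i j} → + 0 ℤ.< i → + 0 ℤ.< j → i * j ≡ - (u * (m - u)) → ⊥
  negative 0<i 0<j eq = ℤₚ.<⇒≱ (*-positive 0<i 0<j) (subst (ℤ._≤ + 0) (sym eq) (ℤₚ.neg-mono-≤ 0≤prod))
  lower : + 0 ℤ.≤ u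
  lower with + 0 ℤₚ.≤? u
  ... | yes 0≤u = 0≤u
  ... | no  0≰u = ⊥-elim (negative (ℤₚ.neg-mono-< u<0) (ℤₚ.+-mono-≤-< 0≤m (ℤₚ.neg-mono-< u<0)) (sym (ℤₚ.neg-distribˡ-* u (m - u))))
    where
    u<0 : u ℤ.< + 0
    u<0 = ℤₚ.≰⇒> 0≰u
  upper : u ℤ.≤ m
  upper with u ℤₚ.≤? m
  ... | yes u≤m = u≤m
  ... | no  u≰m = ⊥-elim (negative (ℤₚ.≤-<-trans 0≤m m<u) (<⇒0<- m<u) (flip u m))
    where
    m<u : m ℤ.< u
    m<u = ℤₚ.≰⇒> u≰m
    flip : ∀ u m → u * (u - m) ≡ - (u * (m - u))
    flip = solve-∀

nonneg-root : ∀ u → u * u ℤ.≤ + 0 → u ≡ + 0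
nonneg-root u u²≤0 with u ℤₚ.≟ + 0
... | yes u≡0 = u≡0
... | no  u≢0 = ⊥-elim (ℤₚ.<⇒≱ (ℤₚ.<-≤-trans (ℤ.+<+ (ℕ.s≤s ℕ.z≤n)) (nonzero-square≥1 u u≢0)) u²≤0)

-- If `u + v` is nonnegative the first bound makes `u * u + v * v` at most 0, otherwise the second
-- does.
squeeze : ∀ {c d} u v → + 0 ℤ.≤ c → + 0 ℤ.≤ d →
  + 0 ℤ.≤ - (c * (u + v)) - (u * u + v * v) → + 0 ℤ.≤ d * (u + v) - (u * u + v * v) → u ≡ + 0
squeeze {c} {d} u v 0≤c 0≤d lower upper = nonneg-root u (ℤₚ.≤-trans
  (subst (ℤ._≤ u * u + v * v) (ℤₚ.+-identityʳ (u * u)) (ℤₚ.+-monoʳ-≤ (u * u) (square-nonneg v))) u²+v²≤0)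
  where
  u²+v²≤0 : u * u + v * v ℤ.≤ + 0
  u²+v²≤0 with ℤₚ.≤-total (+ 0) (u + v)
  ... | inj₁ 0≤u+v = ℤₚ.≤-trans (ℤₚ.0≤i-j⇒j≤i lower) (ℤₚ.neg-mono-≤ (*-nonneg 0≤c 0≤u+v))
  ... | inj₂ u+v≤0 = ℤₚ.≤-trans (ℤₚ.0≤i-j⇒j≤i upper)
    (subst (ℤ._≤ + 0) (flip d (u + v)) (ℤₚ.neg-mono-≤ (*-nonneg 0≤d (ℤₚ.neg-mono-≤ u+v≤0))))
    where
    flip : ∀ d s → - (d * - s) ≡ d * s
    flip = solve-∀

-- `p n h` is the coefficient of `P` at the product of `n` and `h`; `r` already carries the sign, so
-- it is r' of the overview.
module TwoFactors (N H : FinAb) (a b : ℕ) .{{a≢0 : ℕ.NonZero a}} .{{b≢0 : ℕ.NonZero b}} (σ r : ℤ) (σ² : σ * σ ≡ + 1)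
  (N-exp : FinAb.Exponent N (a ℕ.* a)) (H-exp : FinAb.Exponent H (b ℕ.* b))
  (N-card : FinAb.card N ≡ + a * + a) (H-card : FinAb.card H ≡ + b * + b)
  (a⊥b² : Coprime a (b ℕ.* b)) (b⊥a² : Coprime b (a ℕ.* a)) (2⊥b² : Coprime 2 (b ℕ.* b)) (2∣b′-1 : + 2 ∣ σ * + b - + 1) (1<b : 1 ℕ.< b)
  (p : FinAb.Carrier N → FinAb.Carrier H → ℤ) where

  private
    module N = FinAb N
    module H = FinAb H
    module ℤN = GroupRing N
    module ℤH = GroupRing H
    instance
      a²≢0 : ℕ.NonZero (a ℕ.* a)
      a²≢0 = ℕₚ.m*n≢0 a a
    module S = Spectral N {a ℕ.* a} N-exp

    α b′ n′ κ : ℤ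
    α  = + a
    b′ = σ * + b
    n′ = α * b′
    κ  = r * r - r

    slice : H.Carrier → N.Carrier → ℤ
    slice h n = p n h

  module _
    (conv   : ∀ n h → ∑ H.elems (λ h₁ → (slice h₁ ℤN.⋆ slice (h₁ H.⁻¹ H.∙ h)) n) ≡ n′ * p n h + κ)
    (p-inv  : ∀ h → S.Invariant (slice h))
    (p-symᴴ : ∀ n h → p n (h H.⁻¹) ≡ p n h)
    (p-symᴺ : ∀ n h → p (n N.⁻¹) h ≡ p n h)
    (p-e    : p N.e H.e ≡ r)
    (p-01   : ∀ n → N.e ≢ n → p n H.e ≡ + 0 ⊎ p n H.e ≡ + 1)
    (p-total : ∑ N.elems (λ n → ∑ H.elems (p n)) ≡ r * n′)
    where
    private
      -- `R` and `X̄` are the images of `P` in the group rings of G/H and G/N, identified with `N`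
      -- and `H`; they inherit its quadratic equation.
      R : N.Carrier → ℤ
      R n = ∑ H.elems (p n)

      X̄ : H.Carrier → ℤ
      X̄ h = ℤN.total (slice h)

      b′² : b′ * b′ ≡ + b * + b
      b′² = trans (shuffle σ (+ b)) (trans (cong (_* (+ b * + b)) σ²) (ℤₚ.*-identityˡ (+ b * + b)))
        where
        shuffle : ∀ s b → s * b * (s * b) ≡ s * s * (b * b)
        shuffle = solve-∀

      b′≢0 : b′ ≢ + 0
      b′≢0 eq = ℕ.≢-nonZero⁻¹ b (ℤₚ.+-injective (zero-root (ℤₚ.i*j≡0⇒i≡0∨j≡0 (+ b) (trans (sym b′²) (trans (cong (_* b′) eq) (ℤₚ.*-zeroˡ b′))))))
        where
        zero-root : + b ≡ + 0 ⊎ + b ≡ + 0 → + b ≡ + 0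
        zero-root (inj₁ z) = z
        zero-root (inj₂ z) = z

      α≢0 : α ≢ + 0
      α≢0 eq = ℕ.≢-nonZero⁻¹ a (ℤₚ.+-injective eq)

      cancel-b′ : ∀ i j → b′ * i ≡ b′ * j → i ≡ j
      cancel-b′ i j = ℤₚ.*-cancelˡ-≡ b′ i j {{ℤ.≢-nonZero b′≢0}}

      cancel-α : ∀ i j → α * i ≡ α * j → i ≡ j
      cancel-α i j = ℤₚ.*-cancelˡ-≡ α i j {{ℤ.≢-nonZero α≢0}}

      ∑-const : ∀ {A : Set} (xs : List A) c → ∑ xs (λ _ → c) ≡ c * ∑ xs (λ _ → + 1)
      ∑-const xs c = trans (∑-cong xs (λ _ → sym (ℤₚ.*-identityʳ c))) (∑-*ˡ xs c (λ _ → + 1))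

      R-sym : ℤN.Symmetric R
      R-sym n = ∑-cong H.elems (p-symᴺ n)

      X̄-sym : ℤH.Symmetric X̄
      X̄-sym h = ∑-cong N.elems (λ n → p-symᴴ n h)

      R² : ∀ n → (R ℤN.⋆ R) n ≡ n′ * R n + κ * (+ b * + b)
      R² n = begin
        (R ℤN.⋆ R) n
          ≡⟨ ℤN.⋆-∑ˡ H.elems slice R n ⟩
        ∑ H.elems (λ h₁ → (slice h₁ ℤN.⋆ R) n)
          ≡⟨ ∑-cong H.elems (λ h₁ → begin
               (slice h₁ ℤN.⋆ R) n                            ≡⟨ ℤN.⋆-comm (slice h₁) R n ⟩
               (R ℤN.⋆ slice h₁) n                            ≡⟨ ℤN.⋆-∑ˡ H.elems slice (slice h₁) n ⟩
               ∑ H.elems (λ h → (slice h ℤN.⋆ slice h₁) n)    ≡⟨ ∑-cong H.elems (λ h → ℤN.⋆-comm (slice h) (slice h₁) n) ⟩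
               ∑ H.elems (λ h → (slice h₁ ℤN.⋆ slice h) n)    ≡⟨ sym (H.∑-translate (h₁ H.⁻¹) (λ h → (slice h₁ ℤN.⋆ slice h) n)) ⟩
               ∑ H.elems (λ h → (slice h₁ ℤN.⋆ slice (h₁ H.⁻¹ H.∙ h)) n) ∎) ⟩
        ∑ H.elems (λ h₁ → ∑ H.elems (λ h → (slice h₁ ℤN.⋆ slice (h₁ H.⁻¹ H.∙ h)) n))
          ≡⟨ ∑-swap H.elems H.elems (λ h₁ h → (slice h₁ ℤN.⋆ slice (h₁ H.⁻¹ H.∙ h)) n) ⟩
        ∑ H.elems (λ h → ∑ H.elems (λ h₁ → (slice h₁ ℤN.⋆ slice (h₁ H.⁻¹ H.∙ h)) n))
          ≡⟨ ∑-cong H.elems (conv n) ⟩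
        ∑ H.elems (λ h → n′ * p n h + κ)
          ≡⟨ ∑-+ H.elems (λ h → n′ * p n h) (λ _ → κ) ⟩
        ∑ H.elems (λ h → n′ * p n h) + ∑ H.elems (λ _ → κ)
          ≡⟨ cong₂ _+_ (∑-*ˡ H.elems n′ (p n)) (trans (∑-const H.elems κ) (cong (κ *_) H-card)) ⟩
        n′ * R n + κ * (+ b * + b) ∎
        where open ≡-Reasoning

      X̄² : ∀ h → (X̄ ℤH.⋆ X̄) h ≡ n′ * X̄ h + κ * (α * α)
      X̄² h = begin
        ∑ H.elems (λ h₁ → X̄ h₁ * X̄ (h₁ H.⁻¹ H.∙ h))
          ≡⟨ ∑-cong H.elems (λ h₁ → sym (ℤN.total-⋆ (slice h₁) (slice (h₁ H.⁻¹ H.∙ h)))) ⟩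
        ∑ H.elems (λ h₁ → ∑ N.elems (λ n → (slice h₁ ℤN.⋆ slice (h₁ H.⁻¹ H.∙ h)) n))
          ≡⟨ ∑-swap H.elems N.elems (λ h₁ n → (slice h₁ ℤN.⋆ slice (h₁ H.⁻¹ H.∙ h)) n) ⟩
        ∑ N.elems (λ n → ∑ H.elems (λ h₁ → (slice h₁ ℤN.⋆ slice (h₁ H.⁻¹ H.∙ h)) n))
          ≡⟨ ∑-cong N.elems (λ n → conv n h) ⟩
        ∑ N.elems (λ n → n′ * p n h + κ)
          ≡⟨ ∑-+ N.elems (λ n → n′ * p n h) (λ _ → κ) ⟩
        ∑ N.elems (λ n → n′ * p n h) + ∑ N.elems (λ _ → κ)
          ≡⟨ cong₂ _+_ (∑-*ˡ N.elems n′ (slice h)) (trans (∑-const N.elems κ) (cong (κ *_) N-card)) ⟩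
        n′ * X̄ h + κ * (α * α) ∎
        where open ≡-Reasoning

      b∣R : ∀ n → + b ∣ R n
      b∣R = Arithmetic.divides-quasi-idempotent N {b} N-exp b⊥a² (α * σ) κ R
        (λ n → trans (R² n) (shape α σ (+ b) (R n) κ))
        where
        shape : ∀ α σ b x κ → α * (σ * b) * x + κ * (b * b) ≡ b * (α * σ) * x + b * b * κ
        shape = solve-∀

      a∣X̄ : ∀ h → α ∣ X̄ h
      a∣X̄ = Arithmetic.divides-quasi-idempotent H {a} H-exp a⊥b² b′ κ X̄
        (λ h → trans (X̄² h) (shape α b′ (X̄ h) κ))
        where
        shape : ∀ α β x κ → α * β * x + κ * (α * α) ≡ α * β * x + α * α * κ
        shape = solve-∀

      -- The factor `σ` turns the quotient by `b` into the quotient by `b′`, because `σ * σ` is 1.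
      R̃ : N.Carrier → ℤ
      R̃ n = σ * ℤ∣._∣_.quotient (b∣R n)

      X : H.Carrier → ℤ
      X h = ℤ∣._∣_.quotient (a∣X̄ h)

      R≡ : ∀ n → R n ≡ b′ * R̃ n
      R≡ n = trans (ℤ∣._∣_.equality (b∣R n)) (sym (trans (shuffle σ (+ b) (ℤ∣._∣_.quotient (b∣R n)))
        (trans (cong (_* (ℤ∣._∣_.quotient (b∣R n) * + b)) σ²) (ℤₚ.*-identityˡ _))))
        where
        shuffle : ∀ s b q → s * b * (s * q) ≡ s * s * (q * b)
        shuffle = solve-∀

      X̄≡ : ∀ h → X̄ h ≡ α * X h
      X̄≡ h = trans (ℤ∣._∣_.equality (a∣X̄ h)) (ℤₚ.*-comm (X h) α)

    x₀ x₁ : ℤ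
    x₀ = X H.e
    x₁ = R̃ N.e

    private
      R̃-total : ℤN.total R̃ ≡ r * α
      R̃-total = cancel-b′ (ℤN.total R̃) (r * α) (begin
        b′ * ℤN.total R̃              ≡⟨ sym (∑-*ˡ N.elems b′ R̃) ⟩
        ∑ N.elems (λ n → b′ * R̃ n)   ≡⟨ ∑-cong N.elems (λ n → sym (R≡ n)) ⟩
        ∑ N.elems R                  ≡⟨ p-total ⟩
        r * (α * b′)                 ≡⟨ shape r α b′ ⟩
        b′ * (r * α)                 ∎)
        where
        open ≡-Reasoning
        shape : ∀ r α β → r * (α * β) ≡ β * (r * α)
        shape = solve-∀

      X-total : ℤH.total X ≡ r * b′
      X-total = cancel-α (ℤH.total X) (r * b′) (begin
        α * ℤH.total X               ≡⟨ sym (∑-*ˡ H.elems α X) ⟩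
        ∑ H.elems (λ h → α * X h)    ≡⟨ ∑-cong H.elems (λ h → sym (X̄≡ h)) ⟩
        ∑ H.elems X̄                  ≡⟨ sym (∑-swap N.elems H.elems p) ⟩
        ∑ N.elems R                  ≡⟨ p-total ⟩
        r * (α * b′)                 ≡⟨ shape r α b′ ⟩
        α * (r * b′)                 ∎)
        where
        open ≡-Reasoning
        shape : ∀ r α β → r * (α * β) ≡ α * (r * β)
        shape = solve-∀

      squares : ∀ {A : Set} (xs : List A) c {f g : A → ℤ} → (∀ x → f x ≡ c * g x) →
        ∑ xs (λ x → f x * f x) ≡ c * (c * ∑ xs (λ x → g x * g x))
      squares xs c {f} {g} f≡ = begin
        ∑ xs (λ x → f x * f x)             ≡⟨ ∑-cong xs (λ x → trans (cong₂ _*_ (f≡ x) (f≡ x)) (shape c (g x))) ⟩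
        ∑ xs (λ x → c * c * (g x * g x))   ≡⟨ ∑-*ˡ xs (c * c) (λ x → g x * g x) ⟩
        c * c * ∑ xs (λ x → g x * g x)     ≡⟨ ℤₚ.*-assoc c c (∑ xs (λ x → g x * g x)) ⟩
        c * (c * ∑ xs (λ x → g x * g x))   ∎
        where
        open ≡-Reasoning
        shape : ∀ c g → c * g * (c * g) ≡ c * c * (g * g)
        shape = solve-∀

      R̃-squares : ∑ N.elems (λ n → R̃ n * R̃ n) ≡ α * x₁ + κ
      R̃-squares = cancel-b′ _ _ (cancel-b′ _ _ (begin
        b′ * (b′ * ∑ N.elems (λ n → R̃ n * R̃ n)) ≡⟨ sym (squares N.elems b′ R≡) ⟩
        ∑ N.elems (λ n → R n * R n)             ≡⟨ sym (ℤN.⋆-at-e R R R-sym) ⟩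
        (R ℤN.⋆ R) N.e                          ≡⟨ R² N.e ⟩
        n′ * R N.e + κ * (+ b * + b)            ≡⟨ cong₂ (λ u w → n′ * u + κ * w) (R≡ N.e) (sym b′²) ⟩
        α * b′ * (b′ * x₁) + κ * (b′ * b′)      ≡⟨ shape α b′ x₁ κ ⟩
        b′ * (b′ * (α * x₁ + κ))                ∎))
        where
        open ≡-Reasoning
        shape : ∀ α β x κ → α * β * (β * x) + κ * (β * β) ≡ β * (β * (α * x + κ))
        shape = solve-∀

      X-squares : ∑ H.elems (λ h → X h * X h) ≡ b′ * x₀ + κ
      X-squares = cancel-α _ _ (cancel-α _ _ (begin
        α * (α * ∑ H.elems (λ h → X h * X h))   ≡⟨ sym (squares H.elems α X̄≡) ⟩
        ∑ H.elems (λ h → X̄ h * X̄ h)             ≡⟨ sym (ℤH.⋆-at-e X̄ X̄ X̄-sym) ⟩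
        (X̄ ℤH.⋆ X̄) H.e                          ≡⟨ X̄² H.e ⟩
        n′ * X̄ H.e + κ * (α * α)                ≡⟨ cong (λ u → n′ * u + κ * (α * α)) (X̄≡ H.e) ⟩
        α * b′ * (α * x₀) + κ * (α * α)         ≡⟨ shape α b′ x₀ κ ⟩
        α * (α * (b′ * x₀ + κ))                 ∎))
        where
        open ≡-Reasoning
        shape : ∀ α β x κ → α * β * (α * x) + κ * (α * α) ≡ α * (α * (β * x + κ))
        shape = solve-∀

      Q : N.Carrier → ℤ
      Q = slice H.e

      Q-total : ℤN.total Q ≡ α * x₀
      Q-total = X̄≡ H.e

      Q-sym : ℤN.Symmetric Q
      Q-sym n = p-symᴺ n H.e

      -- `κ` is exactly the defect of idempotence at the identity, where `Q` is `r`; elsewhere `Q`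
      -- is 0 or 1.
      Q-square-at : ∀ n → Q n * Q n ≡ Q n + κ * N.δ N.e n
      Q-square-at n with N.e N.≟ n
      ... | yes refl = trans (cong₂ _*_ p-e p-e) (trans (shape r) (cong (_+ κ * + 1) (sym p-e)))
        where
        shape : ∀ r → r * r ≡ r + (r * r - r) * + 1
        shape = solve-∀
      ... | no e≢n = idem (p-01 n e≢n)
        where
        idem : ∀ {q} → q ≡ + 0 ⊎ q ≡ + 1 → q * q ≡ q + κ * + 0
        idem (inj₁ refl) = sym (trans (ℤₚ.+-identityˡ (κ * + 0)) (ℤₚ.*-zeroʳ κ))
        idem (inj₂ refl) = sym (trans (cong (_+_ (+ 1)) (ℤₚ.*-zeroʳ κ)) refl)

      Q-squares : (Q ℤN.⋆ Q) N.e ≡ α * x₀ + κ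
      Q-squares = begin
        (Q ℤN.⋆ Q) N.e                                     ≡⟨ ℤN.⋆-at-e Q Q Q-sym ⟩
        ∑ N.elems (λ n → Q n * Q n)                        ≡⟨ ∑-cong N.elems Q-square-at ⟩
        ∑ N.elems (λ n → Q n + κ * N.δ N.e n)              ≡⟨ ∑-+ N.elems Q (λ n → κ * N.δ N.e n) ⟩
        ℤN.total Q + ∑ N.elems (λ n → κ * N.δ N.e n)       ≡⟨ cong₂ _+_ Q-total (trans (∑-*ˡ N.elems κ (N.δ N.e)) (trans (cong (κ *_) (N.δ-total N.e)) (ℤₚ.*-identityʳ κ))) ⟩
        α * x₀ + κ                                         ∎
        where open ≡-Reasoning

      mod-b′ : ∀ {x y} → + 2 ∣ b′ * x - y → + 2 ∣ x - y
      mod-b′ {x} {y} 2∣ = subst (+ 2 ∣_) (shape b′ x y) (ℤ∣.∣m∣n⇒∣m-n 2∣ (ℤ∣.∣m⇒∣m*n x 2∣b′-1))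
        where
        shape : ∀ β x y → (β * x - y) - (β - + 1) * x ≡ x - y
        shape = solve-∀

      R̃-parity : ∀ n → + 2 ∣ R̃ n - Q n
      R̃-parity n = mod-b′ (subst (λ z → + 2 ∣ z - Q n) (R≡ n) (Arithmetic.total-parity H H-exp 2⊥b² (p n) (p-symᴴ n)))

    -- Cauchy–Schwarz over the nonidentity elements of H.
    window : + 0 ℤ.≤ b′ * x₀ - r × b′ * x₀ - r ℤ.≤ + b * + b - + 1
    window = between (ℤₚ.<⇒≤ 0<m) (nonneg-cancel m (u * (m - u)) 0<m (subst (+ 0 ℤ.≤_) algebra (ℤₚ.i≤j⇒0≤j-i f-bound)))
      where
      -- `m` is the number of nonidentity elements of `H` and `S` the sum of `X` over them, so the
      -- `f` below measures squared deviation from the mean `S / m`.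
      m S u : ℤ
      m = + b * + b - + 1
      S = r * b′ - x₀
      u = b′ * x₀ - r
      0<m : + 0 ℤ.< m
      0<m = subst (+ 0 ℤ.<_) (factor (+ b)) (*-positive
        (<⇒0<- (ℤ.+<+ 1<b)) (ℤ.+<+ (ℕₚ.≤-trans (ℕ.s≤s ℕ.z≤n) (ℕₚ.m≤n+m 1 b))))
        where
        factor : ∀ b → (b - + 1) * (b + + 1) ≡ b * b - + 1
        factor = solve-∀
      f : H.Carrier → ℤ
      f h = (m * X h - S) * (m * X h - S)
      f-bound : f H.e ℤ.≤ ∑ H.elems f
      f-bound = H.∑-≥-term H.e f (λ h _ → square-nonneg (m * X h - S))
      ∑f : ∑ H.elems f ≡ m * m * (b′ * x₀ + κ) + (- + 2 * m * S * (r * b′) + S * S * (b′ * b′))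
      ∑f = begin
        ∑ H.elems f
          ≡⟨ ∑-cong H.elems (λ h → expand m (X h) S) ⟩
        ∑ H.elems (λ h → m * m * (X h * X h) + (- + 2 * m * S * X h + S * S))
          ≡⟨ trans (∑-+ H.elems (λ h → m * m * (X h * X h)) (λ h → - + 2 * m * S * X h + S * S))
               (cong (_+_ (∑ H.elems (λ h → m * m * (X h * X h)))) (∑-+ H.elems (λ h → - + 2 * m * S * X h) (λ _ → S * S))) ⟩
        ∑ H.elems (λ h → m * m * (X h * X h)) + (∑ H.elems (λ h → - + 2 * m * S * X h) + ∑ H.elems (λ _ → S * S))
          ≡⟨ cong₂ _+_ (trans (∑-*ˡ H.elems (m * m) (λ h → X h * X h)) (cong (m * m *_) X-squares))
               (cong₂ _+_ (trans (∑-*ˡ H.elems (- + 2 * m * S) X) (cong (- + 2 * m * S *_) X-total))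
                 (trans (∑-const H.elems (S * S)) (cong (S * S *_) (trans H-card (sym b′²))))) ⟩
        m * m * (b′ * x₀ + κ) + (- + 2 * m * S * (r * b′) + S * S * (b′ * b′)) ∎
        where
        open ≡-Reasoning
        expand : ∀ m x s → (m * x - s) * (m * x - s) ≡ m * m * (x * x) + (- + 2 * m * s * x + s * s)
        expand = solve-∀
      algebra : ∑ H.elems f - f H.e ≡ m * (u * (m - u))
      algebra = trans (cong (_- f H.e) ∑f) (subst
        (λ m → m * m * (b′ * x₀ + κ) + (- + 2 * m * S * (r * b′) + S * S * (b′ * b′)) - (m * x₀ - S) * (m * x₀ - S) ≡ m * (u * (m - u)))
        (cong (_- + 1) b′²) (identity b′ x₀ r))
        where
        identity : ∀ β x r → (β * β - + 1) * (β * β - + 1) * (β * x + (r * r - r))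
          + (- + 2 * (β * β - + 1) * (r * β - x) * (r * β) + (r * β - x) * (r * β - x) * (β * β))
          - ((β * β - + 1) * x - (r * β - x)) * ((β * β - + 1) * x - (r * β - x))
          ≡ (β * β - + 1) * ((β * x - r) * ((β * β - + 1) - (β * x - r)))
        identity = solve-∀

    -- Summing the local inequalities over cosets and over eigenspaces

    private
      direct : ∀ c d k → (∀ y g → + 2 ∣ y - g → g ≡ + 0 ⊎ g ≡ + 1 → + 0 ℤ.≤ y * y + c * y + d + k * g) →
        + 0 ℤ.≤ (α * x₁ + κ + c * (r * α) + d * (α * α) + k * (α * x₀)) - (x₁ * x₁ + c * x₁ + d + k * r)
      direct c d k local = subst (+ 0 ℤ.≤_) (cong₂ _-_ ∑f at-e) (ℤₚ.i≤j⇒0≤j-i (N.∑-≥-term N.e f f≥0))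
        where
        f : N.Carrier → ℤ
        f n = R̃ n * R̃ n + c * R̃ n + d + k * Q n
        f≥0 : ∀ n → N.e ≢ n → + 0 ℤ.≤ f n
        f≥0 n e≢n = local (R̃ n) (Q n) (R̃-parity n) (p-01 n e≢n)
        at-e : f N.e ≡ x₁ * x₁ + c * x₁ + d + k * r
        at-e = cong (λ q → x₁ * x₁ + c * x₁ + d + k * q) p-e
        ∑f : ∑ N.elems f ≡ α * x₁ + κ + c * (r * α) + d * (α * α) + k * (α * x₀)
        ∑f = begin
          ∑ N.elems f
            ≡⟨ ∑-+ N.elems (λ n → R̃ n * R̃ n + c * R̃ n + d) (λ n → k * Q n) ⟩
          ∑ N.elems (λ n → R̃ n * R̃ n + c * R̃ n + d) + ∑ N.elems (λ n → k * Q n)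
            ≡⟨ cong₂ _+_ (∑-+ N.elems (λ n → R̃ n * R̃ n + c * R̃ n) (λ _ → d)) (trans (∑-*ˡ N.elems k Q) (cong (k *_) Q-total)) ⟩
          ∑ N.elems (λ n → R̃ n * R̃ n + c * R̃ n) + ∑ N.elems (λ _ → d) + k * (α * x₀)
            ≡⟨ cong (_+ k * (α * x₀)) (cong₂ _+_
                 (trans (∑-+ N.elems (λ n → R̃ n * R̃ n) (λ n → c * R̃ n)) (cong₂ _+_ R̃-squares (trans (∑-*ˡ N.elems c R̃) (cong (c *_) R̃-total))))
                 (trans (∑-const N.elems d) (cong (d *_) N-card))) ⟩
          α * x₁ + κ + c * (r * α) + d * (α * α) + k * (α * x₀) ∎
          where open ≡-Reasoning

      R-inv : S.Invariant R
      R-inv n k l back = ∑-cong H.elems (λ h → p-inv h n k l back)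

      R̃-inv : S.Invariant R̃
      R̃-inv n k l back = cancel-b′ (R̃ (n N.↑ k)) (R̃ n) (trans (sym (R≡ (n N.↑ k))) (trans (R-inv n k l back) (R≡ n)))

      one : N.Carrier → ℤ
      one _ = + 1

      -- On a nontrivial simple constituent the slices act as integers a·x_h whose sum over h is b′g.
      constituent : ∀ {E} → S.Simple E → E N.e ≢ + 0 → S.Eigen E one (+ 0) →
        ∃ λ y → ∃ λ g → + 2 ∣ y - g × (g ≡ + 0 ⊎ g ≡ + 1) × S.Eigen E Q (α * y) × S.Eigen E R̃ (α * g)
      constituent {E} simple Ee≢0 one-0 = finish (0∨1 (ℤH.total x) b′≢0 x-total²) (S.invariant⇒eigen simple R̃ R̃-inv)
        where
        λₕ : H.Carrier → ℤ
        λₕ h = proj₁ (S.invariant⇒eigen simple (slice h) (p-inv h))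
        λₕ-eigen : ∀ h → S.Eigen E (slice h) (λₕ h)
        λₕ-eigen h = proj₂ (S.invariant⇒eigen simple (slice h) (p-inv h))
        -- The all-ones element acts as 0 here, so the equation for `P` loses its constant term.
        λₕ² : ∀ h → (λₕ ℤH.⋆ λₕ) h ≡ n′ * λₕ h + κ * + 0
        λₕ² h = S.Eigen-unique {E} {square} {(λₕ ℤH.⋆ λₕ) h} {n′ * λₕ h + κ * + 0} Ee≢0
          (S.Eigen-cong {E} {λ n → ∑ H.elems (λ h₁ → (slice h₁ ℤN.⋆ slice (h₁ H.⁻¹ H.∙ h)) n)} {square} {(λₕ ℤH.⋆ λₕ) h}
            (λ n → trans (conv n h) (cong (_+_ (n′ * p n h)) (sym (ℤₚ.*-identityʳ κ))))
            (S.Eigen-∑ H.elems {E} {λ h₁ → slice h₁ ℤN.⋆ slice (h₁ H.⁻¹ H.∙ h)} {λ h₁ → λₕ h₁ * λₕ (h₁ H.⁻¹ H.∙ h)}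
              (λ h₁ → S.Eigen-⋆ {E} {slice h₁} {slice (h₁ H.⁻¹ H.∙ h)} (λₕ-eigen h₁) (λₕ-eigen (h₁ H.⁻¹ H.∙ h)))))
          (S.Eigen-+ {E} {λ n → n′ * p n h} {λ n → κ * + 1} (S.Eigen-scale {E} {slice h} n′ (λₕ-eigen h)) (S.Eigen-scale {E} {one} κ one-0))
          where
          square : N.Carrier → ℤ
          square n = n′ * p n h + κ * + 1
        a∣λₕ : ∀ h → α ∣ λₕ h
        a∣λₕ = Arithmetic.divides-quasi-idempotent H {a} H-exp a⊥b² b′ (+ 0) λₕ
          (λ h → trans (λₕ² h) (shape α b′ (λₕ h) κ))
          where
          shape : ∀ α β x κ → α * β * x + κ * + 0 ≡ α * β * x + α * α * + 0
          shape = solve-∀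
        x : H.Carrier → ℤ
        x h = ℤ∣._∣_.quotient (a∣λₕ h)
        λₕ≡ : ∀ h → λₕ h ≡ α * x h
        λₕ≡ h = trans (ℤ∣._∣_.equality (a∣λₕ h)) (ℤₚ.*-comm (x h) α)
        x-sym : ℤH.Symmetric x
        x-sym h = cancel-α (x (h H.⁻¹)) (x h) (trans (sym (λₕ≡ (h H.⁻¹))) (trans
          (S.Eigen-unique Ee≢0 (S.Eigen-cong (λ n → p-symᴴ n h) (λₕ-eigen (h H.⁻¹))) (λₕ-eigen h)) (λₕ≡ h)))
        λₕ-total : ℤH.total λₕ ≡ α * ℤH.total x
        λₕ-total = trans (∑-cong H.elems λₕ≡) (∑-*ˡ H.elems α x)
        x-total² : ℤH.total x * ℤH.total x ≡ b′ * ℤH.total x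
        x-total² = cancel-α _ _ (cancel-α _ _ (begin
          α * (α * (ℤH.total x * ℤH.total x))           ≡⟨ regroup α (ℤH.total x) ⟩
          (α * ℤH.total x) * (α * ℤH.total x)           ≡⟨ cong₂ _*_ (sym λₕ-total) (sym λₕ-total) ⟩
          ℤH.total λₕ * ℤH.total λₕ                     ≡⟨ sym (ℤH.total-⋆ λₕ λₕ) ⟩
          ∑ H.elems (λₕ ℤH.⋆ λₕ)                        ≡⟨ ∑-cong H.elems (λ h → trans (λₕ² h) (drop (n′ * λₕ h) κ)) ⟩
          ∑ H.elems (λ h → n′ * λₕ h)                   ≡⟨ ∑-*ˡ H.elems n′ λₕ ⟩
          n′ * ℤH.total λₕ                              ≡⟨ cong (n′ *_) λₕ-total ⟩
          α * b′ * (α * ℤH.total x)                     ≡⟨ pull α b′ (ℤH.total x) ⟩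
          α * (α * (b′ * ℤH.total x))                   ∎))
          where
          open ≡-Reasoning
          regroup : ∀ α t → α * (α * (t * t)) ≡ (α * t) * (α * t)
          regroup = solve-∀
          drop : ∀ u κ → u + κ * + 0 ≡ u
          drop = solve-∀
          pull : ∀ α β t → α * β * (α * t) ≡ α * (α * (β * t))
          pull = solve-∀
        finish : (∃ λ g → ℤH.total x ≡ b′ * g × (g ≡ + 0 ⊎ g ≡ + 1)) → ∃ (S.Eigen E R̃) →
          ∃ λ y → ∃ λ g → + 2 ∣ y - g × (g ≡ + 0 ⊎ g ≡ + 1) × S.Eigen E Q (α * y) × S.Eigen E R̃ (α * g)
        finish (g , x-total , g-01) (ρ , R̃-eigen) =
          x H.e , g , parity-y , g-01 , subst (S.Eigen E Q) (λₕ≡ H.e) (λₕ-eigen H.e) , subst (S.Eigen E R̃) ρ≡ R̃-eigen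
          where
          swap-sign : ∀ u w → - (u - w) ≡ w - u
          swap-sign = solve-∀
          parity-y : + 2 ∣ x H.e - g
          parity-y = subst (+ 2 ∣_) (swap-sign g (x H.e)) (ℤ∣.∣m⇒∣-m (mod-b′ {g} {x H.e}
            (subst (λ z → + 2 ∣ z - x H.e) x-total (Arithmetic.total-parity H H-exp 2⊥b² x x-sym))))
          R-eigen : S.Eigen E (λ n → b′ * R̃ n) (ℤH.total λₕ)
          R-eigen = S.Eigen-cong {E} {R} {λ n → b′ * R̃ n} {ℤH.total λₕ} R≡ (S.Eigen-∑ H.elems {E} {slice} {λₕ} λₕ-eigen)
          -- `b′ * R̃` is the sum of all slices, so it acts as the sum of the `λₕ h`.
          ρ≡ : ρ ≡ α * g
          ρ≡ = cancel-b′ ρ (α * g) (trans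
            (S.Eigen-unique {E} {λ n → b′ * R̃ n} {b′ * ρ} {ℤH.total λₕ} Ee≢0 (S.Eigen-scale {E} {R̃} {ρ} b′ R̃-eigen) R-eigen)
            (trans λₕ-total (trans (cong (α *_) x-total) (swap α b′ g))))
            where
            swap : ∀ α β g → α * (β * g) ≡ β * (α * g)
            swap = solve-∀

      -- `Z` is `W` with its trivial component removed, times `α * α`. It acts on every constituent
      -- as a nonnegative number, hence `Z N.e` is nonnegative; and `Z N.e` is `α * α` times `W N.e`
      -- minus the sum of all coefficients of `W`. This amounts to summing the local inequality over
      -- the nontrivial characters of `N`.
      spectral : ∀ c d k → (∀ y g → + 2 ∣ y - g → g ≡ + 0 ⊎ g ≡ + 1 → + 0 ℤ.≤ (α * y) * (α * y) + c * (α * y) + d * + 1 + k * (α * g)) →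
        + 0 ℤ.≤ α * α * (α * x₀ + κ + c * r + d * + 1 + k * x₁) - ((α * x₀) * (α * x₀) + c * (α * x₀) + d * + 1 + k * (r * α))
      spectral c d k local = subst (+ 0 ℤ.≤_) Z-e (S.nonneg-from-simple Z nonneg)
        where
        W trivial Z : N.Carrier → ℤ
        W n = (Q ℤN.⋆ Q) n + c * Q n + d * N.δ N.e n + k * R̃ n
        trivial n = α * α * N.δ N.e n + - + 1 * one n
        Z = trivial ℤN.⋆ W
        W-e : W N.e ≡ α * x₀ + κ + c * r + d * + 1 + k * x₁
        W-e = cong (_+ k * x₁) (cong₂ _+_ (cong₂ _+_ Q-squares (cong (c *_) p-e)) (cong (d *_) (N.δ-refl N.e)))
        W-total : ℤN.total W ≡ (α * x₀) * (α * x₀) + c * (α * x₀) + d * + 1 + k * (r * α)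
        W-total = begin
          ∑ N.elems W
            ≡⟨ ∑-+ N.elems (λ n → (Q ℤN.⋆ Q) n + c * Q n + d * N.δ N.e n) (λ n → k * R̃ n) ⟩
          ∑ N.elems (λ n → (Q ℤN.⋆ Q) n + c * Q n + d * N.δ N.e n) + ∑ N.elems (λ n → k * R̃ n)
            ≡⟨ cong₂ _+_ (∑-+ N.elems (λ n → (Q ℤN.⋆ Q) n + c * Q n) (λ n → d * N.δ N.e n)) (trans (∑-*ˡ N.elems k R̃) (cong (k *_) R̃-total)) ⟩
          ∑ N.elems (λ n → (Q ℤN.⋆ Q) n + c * Q n) + ∑ N.elems (λ n → d * N.δ N.e n) + k * (r * α)
            ≡⟨ cong (_+ k * (r * α)) (cong₂ _+_
                 (trans (∑-+ N.elems (Q ℤN.⋆ Q) (λ n → c * Q n)) (cong₂ _+_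
                   (trans (ℤN.total-⋆ Q Q) (cong₂ _*_ Q-total Q-total)) (trans (∑-*ˡ N.elems c Q) (cong (c *_) Q-total))))
                 (trans (∑-*ˡ N.elems d (N.δ N.e)) (cong (d *_) (N.δ-total N.e)))) ⟩
          (α * x₀) * (α * x₀) + c * (α * x₀) + d * + 1 + k * (r * α) ∎
          where open ≡-Reasoning
        Z-e : Z N.e ≡ α * α * (α * x₀ + κ + c * r + d * + 1 + k * x₁) - ((α * x₀) * (α * x₀) + c * (α * x₀) + d * + 1 + k * (r * α))
        Z-e = begin
          (trivial ℤN.⋆ W) N.e
            ≡⟨ ℤN.⋆-distribʳ W (λ n → α * α * N.δ N.e n) (λ n → - + 1 * one n) N.e ⟩
          ((λ n → α * α * N.δ N.e n) ℤN.⋆ W) N.e + ((λ n → - + 1 * one n) ℤN.⋆ W) N.e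
            ≡⟨ cong₂ _+_ (trans (ℤN.⋆-scaleˡ (α * α) (N.δ N.e) W N.e) (cong (α * α *_) (ℤN.⋆-identityˡ W N.e)))
                 (trans (ℤN.⋆-scaleˡ (- + 1) one W N.e) (cong (- + 1 *_) (trans (ℤN.⋆-comm one W N.e) (ℤN.⋆-total W N.e)))) ⟩
          α * α * W N.e + - + 1 * ℤN.total W
            ≡⟨ cong₂ (λ u w → α * α * u + w) W-e (trans (ℤₚ.-1*i≡-i (ℤN.total W)) (cong -_ W-total)) ⟩
          α * α * (α * x₀ + κ + c * r + d * + 1 + k * x₁) - ((α * x₀) * (α * x₀) + c * (α * x₀) + d * + 1 + k * (r * α)) ∎
          where open ≡-Reasoning
        W-eigen : ∀ {E} q ρ → S.Eigen E Q q → S.Eigen E R̃ ρ → S.Eigen E W (q * q + c * q + d * + 1 + k * ρ)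
        W-eigen {E} q ρ Q-eigen R̃-eigen =
          S.Eigen-+ {E} {λ n → (Q ℤN.⋆ Q) n + c * Q n + d * N.δ N.e n} {λ n → k * R̃ n} {q * q + c * q + d * + 1} {k * ρ}
            (S.Eigen-+ {E} {λ n → (Q ℤN.⋆ Q) n + c * Q n} {λ n → d * N.δ N.e n} {q * q + c * q} {d * + 1}
              (S.Eigen-+ {E} {Q ℤN.⋆ Q} {λ n → c * Q n} {q * q} {c * q}
                (S.Eigen-⋆ {E} {Q} {Q} {q} {q} Q-eigen Q-eigen) (S.Eigen-scale {E} {Q} {q} c Q-eigen))
              (S.Eigen-scale {E} {N.δ N.e} {+ 1} d (S.Eigen-δ {E})))
            (S.Eigen-scale {E} {R̃} {ρ} k R̃-eigen)
        trivial-eigen : ∀ {E} t → S.Eigen E one t → S.Eigen E trivial (α * α * + 1 + - + 1 * t)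
        trivial-eigen {E} t one-eigen = S.Eigen-+ {E} {λ n → α * α * N.δ N.e n} {λ n → - + 1 * one n} {α * α * + 1} {(- + 1) * t}
          (S.Eigen-scale {E} {N.δ N.e} {+ 1} (α * α) (S.Eigen-δ {E})) (S.Eigen-scale {E} {one} {t} (- + 1) one-eigen)
        Z-eigen : ∀ {E} t w → S.Eigen E one t → S.Eigen E W w → S.Eigen E Z ((α * α * + 1 + - + 1 * t) * w)
        Z-eigen {E} t w one-eigen W-eig = S.Eigen-⋆ {E} {trivial} {W} {α * α * + 1 + - + 1 * t} {w} (trivial-eigen t one-eigen) W-eig
        -- Only 0 and `α * α` remain for `t`: the constituent is nontrivial or trivial.
        t² : ∀ {E} t → E N.e ≢ + 0 → S.Eigen E one t → t * t ≡ α * α * t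
        t² {E} t Ee≢0 one-eigen = S.Eigen-unique {E} {λ n → α * α * one n} {t * t} {α * α * t} Ee≢0
          (S.Eigen-cong {E} {one ℤN.⋆ one} {λ n → α * α * one n} {t * t}
            (λ n → trans (ℤN.⋆-total one n) (trans N-card (sym (ℤₚ.*-identityʳ (α * α))))) (S.Eigen-⋆ {E} {one} {one} {t} {t} one-eigen one-eigen))
          (S.Eigen-scale {E} {one} {t} (α * α) one-eigen)
        vanishing : ∀ {E} → S.Simple E → ∀ t → S.Eigen E one t → (∀ w → (α * α * + 1 + - + 1 * t) * w * E N.e ≡ + 0) → + 0 ℤ.≤ (Z ℤN.⋆ E) N.e
        vanishing {E} simple t one-eigen zero-at-e = conclude (S.invariant⇒eigen simple Q (p-inv H.e)) (S.invariant⇒eigen simple R̃ R̃-inv)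
          where
          conclude : ∃ (S.Eigen E Q) → ∃ (S.Eigen E R̃) → + 0 ℤ.≤ (Z ℤN.⋆ E) N.e
          conclude (q , Q-eigen) (ρ , R̃-eigen) = ℤₚ.≤-reflexive (sym (trans
            (S.Eigen.acts (Z-eigen t (q * q + c * q + d * + 1 + k * ρ) one-eigen (W-eigen q ρ Q-eigen R̃-eigen)) N.e)
            (zero-at-e (q * q + c * q + d * + 1 + k * ρ))))
        nontrivial : ∀ {E} → S.Simple E → S.Eigen E one (+ 0) →
          (∃ λ y → ∃ λ g → + 2 ∣ y - g × (g ≡ + 0 ⊎ g ≡ + 1) × S.Eigen E Q (α * y) × S.Eigen E R̃ (α * g)) → + 0 ℤ.≤ (Z ℤN.⋆ E) N.e
        nontrivial {E} simple one-eigen (y , g , y≡g , g-01 , Q-eigen , R̃-eigen) = subst (+ 0 ℤ.≤_)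
          (sym (S.Eigen.acts (Z-eigen (+ 0) ((α * y) * (α * y) + c * (α * y) + d * + 1 + k * (α * g)) one-eigen (W-eigen (α * y) (α * g) Q-eigen R̃-eigen)) N.e))
          (*-nonneg (*-nonneg (subst (+ 0 ℤ.≤_) (plain (α * α)) (square-nonneg α)) (local y g y≡g g-01))
            (S.QuasiIdempotent.nonneg-at-e (S.Simple.quasi simple)))
          where
          plain : ∀ u → u ≡ u * + 1 + - + 1 * + 0
          plain = solve-∀
        nonneg : ∀ E → S.Simple E → + 0 ℤ.≤ (Z ℤN.⋆ E) N.e
        nonneg E simple = cases (S.invariant⇒eigen simple one (λ _ _ _ _ → refl)) (E N.e ℤₚ.≟ + 0)
          where
          cases : ∃ (S.Eigen E one) → Dec (E N.e ≡ + 0) → + 0 ℤ.≤ (Z ℤN.⋆ E) N.e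
          -- Eigenvalues are not unique when `E N.e` is 0, but then the coefficient at the identity
          -- vanishes whatever they are.
          cases (t , one-eigen) (yes Ee≡0) = vanishing simple t one-eigen (λ w → trans (cong ((α * α * + 1 + - + 1 * t) * w *_) Ee≡0) (ℤₚ.*-zeroʳ ((α * α * + 1 + - + 1 * t) * w)))
          cases (t , one-eigen) (no Ee≢0) = by-trivial (t ℤₚ.≟ + 0)
            where
            by-trivial : Dec (t ≡ + 0) → + 0 ℤ.≤ (Z ℤN.⋆ E) N.e
            by-trivial (yes t≡0) = nontrivial simple one-0 (constituent simple Ee≢0 one-0)
              where
              one-0 : S.Eigen E one (+ 0)
              one-0 = subst (S.Eigen E one) t≡0 one-eigen
            by-trivial (no t≢0) = vanishing simple t one-eigen
              (λ w → trans (cong (λ u → (α * α * + 1 + - + 1 * u) * w * E N.e) (ℤₚ.*-cancelʳ-≡ t (α * α) t {{ℤ.≢-nonZero t≢0}} (t² t Ee≢0 one-eigen)))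
                (zero-out (α * α) w (E N.e)))
              where
              zero-out : ∀ u w e → (u * + 1 + - + 1 * u) * w * e ≡ + 0
              zero-out = solve-∀

      -- What is left of the summed local inequality for odd and for even `τ`, once the exceptional
      -- term is removed. With `x₀` first it comes from eigenspaces, with `x₁` first from cosets;
      -- that one formula serves both is the duality between the two sides.
      Odd Even : ℤ → ℤ → ℤ → ℤ
      Odd  τ x y = (α * τ - r) * (α * τ - r) - + 2 * r + α * (x + y) - α * α + + 1 - (x - τ) * (x - τ)
      Even τ x y = (α * τ - r) * (α * τ - r) + α * (x - y) - (x - τ) * (x - τ)

      0<α² : + 0 ℤ.< α * α
      0<α² = *-positive 0<α 0<α
        where
        0<α : + 0 ℤ.< α
        0<α = ℤ.+<+ (ℕ.>-nonZero⁻¹ a)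

      direct-odd : ∀ τ → ¬ + 2 ∣ τ → + 0 ℤ.≤ Odd τ x₁ x₀
      direct-odd τ 2∤τ = subst (+ 0 ℤ.≤_) (shape α r x₀ x₁ τ) (direct (- + 2 * τ) (τ * τ - + 1) (+ 1)
        (λ y g y≡g g-01 → subst (+ 0 ℤ.≤_) (square y g τ) (odd-gap {τ} {y} {g} 2∤τ y≡g g-01)))
        where
        square : ∀ y g τ → (y - τ) * (y - τ) - + 1 + g ≡ y * y + (- + 2 * τ) * y + (τ * τ - + 1) + + 1 * g
        square = solve-∀
        shape : ∀ α r x y τ →
          (α * y + (r * r - r) + (- + 2 * τ) * (r * α) + (τ * τ - + 1) * (α * α) + + 1 * (α * x)) - (y * y + (- + 2 * τ) * y + (τ * τ - + 1) + + 1 * r)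
          ≡ (α * τ - r) * (α * τ - r) - + 2 * r + α * (y + x) - α * α + + 1 - (y - τ) * (y - τ)
        shape = solve-∀

      direct-even : ∀ τ → + 2 ∣ τ → + 0 ℤ.≤ Even τ x₁ x₀
      direct-even τ 2∣τ = subst (+ 0 ℤ.≤_) (shape α r x₀ x₁ τ) (direct (- + 2 * τ) (τ * τ) (- + 1)
        (λ y g y≡g g-01 → subst (+ 0 ℤ.≤_) (square y g τ) (even-gap {τ} {y} {g} 2∣τ y≡g g-01)))
        where
        square : ∀ y g τ → (y - τ) * (y - τ) - g ≡ y * y + (- + 2 * τ) * y + τ * τ + - + 1 * g
        square = solve-∀
        shape : ∀ α r x y τ →
          (α * y + (r * r - r) + (- + 2 * τ) * (r * α) + (τ * τ) * (α * α) + - + 1 * (α * x)) - (y * y + (- + 2 * τ) * y + τ * τ + - + 1 * r)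
          ≡ (α * τ - r) * (α * τ - r) + α * (y - x) - (y - τ) * (y - τ)
        shape = solve-∀

      spectral-odd : ∀ τ → ¬ + 2 ∣ τ → + 0 ℤ.≤ Odd τ x₀ x₁
      spectral-odd τ 2∤τ = nonneg-cancel (α * α) (Odd τ x₀ x₁) 0<α² (subst (+ 0 ℤ.≤_) (shape α r x₀ x₁ τ)
        -- The eigenvalues are `α * y` and `α * g`, so these coefficients are those of the local
        -- inequality multiplied by `α * α`.
        (spectral (- + 2 * α * τ) (α * α * (τ * τ - + 1)) α
          (λ y g y≡g g-01 → subst (+ 0 ℤ.≤_) (square α y g τ) (*-nonneg (square-nonneg α) (odd-gap {τ} {y} {g} 2∤τ y≡g g-01)))))
        where
        square : ∀ α y g τ → α * α * ((y - τ) * (y - τ) - + 1 + g)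
          ≡ (α * y) * (α * y) + (- + 2 * α * τ) * (α * y) + α * α * (τ * τ - + 1) * + 1 + α * (α * g)
        square = solve-∀
        shape : ∀ α r x y τ →
          α * α * (α * x + (r * r - r) + (- + 2 * α * τ) * r + α * α * (τ * τ - + 1) * + 1 + α * y)
            - ((α * x) * (α * x) + (- + 2 * α * τ) * (α * x) + α * α * (τ * τ - + 1) * + 1 + α * (r * α))
          ≡ α * α * ((α * τ - r) * (α * τ - r) - + 2 * r + α * (x + y) - α * α + + 1 - (x - τ) * (x - τ))
        shape = solve-∀

      spectral-even : ∀ τ → + 2 ∣ τ → + 0 ℤ.≤ Even τ x₀ x₁
      spectral-even τ 2∣τ = nonneg-cancel (α * α) (Even τ x₀ x₁) 0<α² (subst (+ 0 ℤ.≤_) (shape α r x₀ x₁ τ)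
        (spectral (- + 2 * α * τ) (α * α * (τ * τ)) (- α)
          (λ y g y≡g g-01 → subst (+ 0 ℤ.≤_) (square α y g τ) (*-nonneg (square-nonneg α) (even-gap {τ} {y} {g} 2∣τ y≡g g-01)))))
        where
        square : ∀ α y g τ → α * α * ((y - τ) * (y - τ) - g)
          ≡ (α * y) * (α * y) + (- + 2 * α * τ) * (α * y) + α * α * (τ * τ) * + 1 + - α * (α * g)
        square = solve-∀
        shape : ∀ α r x y τ →
          α * α * (α * x + (r * r - r) + (- + 2 * α * τ) * r + α * α * (τ * τ) * + 1 + - α * y)
            - ((α * x) * (α * x) + (- + 2 * α * τ) * (α * x) + α * α * (τ * τ) * + 1 + - α * (r * α))
          ≡ α * α * ((α * τ - r) * (α * τ - r) + α * (x - y) - (x - τ) * (x - τ))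
        shape = solve-∀

      2∤τ⇒2∣τ-1 : ∀ τ → ¬ + 2 ∣ τ → + 2 ∣ τ - + 1
      2∤τ⇒2∣τ-1 τ 2∤τ with parity τ
      ... | k , inj₁ refl = ⊥-elim (2∤τ (divides k (ℤₚ.*-comm (+ 2) k)))
      ... | k , inj₂ refl = divides k (shape k)
        where
        shape : ∀ k → + 1 + + 2 * k - + 1 ≡ k * + 2
        shape = solve-∀

      2∣τ⇒2∤τ-1 : ∀ τ → + 2 ∣ τ → ¬ + 2 ∣ τ - + 1
      2∣τ⇒2∤τ-1 τ 2∣τ 2∣τ-1 = 2∤1 (ℤ∣.∣⇒∣ᵤ (subst (+ 2 ∣_) (shape τ) (ℤ∣.∣m∣n⇒∣m-n 2∣τ 2∣τ-1)))
        where
        shape : ∀ τ → τ - (τ - + 1) ≡ + 1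
        shape = solve-∀

    -- The value of x₀

    module _ (T : ℤ) (0≤c : + 0 ℤ.≤ α * T - r) (c≤α-1 : + 0 ℤ.≤ α - + 1 - (α * T - r)) where

      private
        double : ∀ {i} → + 0 ℤ.≤ i → + 0 ℤ.≤ + 2 * i
        double {i} = *-nonneg {+ 2} {i} (ℤ.+≤+ ℕ.z≤n)
        succ : ∀ {i} → + 0 ℤ.≤ i → + 0 ℤ.≤ i + + 1
        succ 0≤i = ℤₚ.+-mono-≤ 0≤i (ℤ.+≤+ ℕ.z≤n)

      -- Both sums of an inequality and its dual vanish when `x₀` and `x₁` equal `x*`. In the
      -- deviations from `x*` the one for `T` has slope `-2(c + 1)` and the one for `T - 1` has
      -- slope `2(α - c)`, where `c = α * T - r`.
      x₀-odd : ¬ + 2 ∣ T → x₀ ≡ r - (T - + 1) * (α - + 1)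
      x₀-odd 2∤T = sym (ℤₚ.i-j≡0⇒i≡j (r - (T - + 1) * (α - + 1)) x₀ (squeeze (x* - x₀) (x* - x₁)
        (double (succ 0≤c)) (double (succ c≤α-1))
        (subst (+ 0 ℤ.≤_) (lower α r x₀ x₁ T) (ℤₚ.+-mono-≤ (spectral-odd T 2∤T) (direct-odd T 2∤T)))
        (subst (+ 0 ℤ.≤_) (upper α r x₀ x₁ T) (ℤₚ.+-mono-≤ (spectral-even (T - + 1) 2∣T-1) (direct-even (T - + 1) 2∣T-1)))))
        where
        x* = r - (T - + 1) * (α - + 1)
        2∣T-1 : + 2 ∣ T - + 1
        2∣T-1 = 2∤τ⇒2∣τ-1 T 2∤T
        lower : ∀ α r x y T →
          ((α * T - r) * (α * T - r) - + 2 * r + α * (x + y) - α * α + + 1 - (x - T) * (x - T))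
            + ((α * T - r) * (α * T - r) - + 2 * r + α * (y + x) - α * α + + 1 - (y - T) * (y - T))
          ≡ - (+ 2 * (α * T - r + + 1) * ((r - (T - + 1) * (α - + 1) - x) + (r - (T - + 1) * (α - + 1) - y)))
            - ((r - (T - + 1) * (α - + 1) - x) * (r - (T - + 1) * (α - + 1) - x) + (r - (T - + 1) * (α - + 1) - y) * (r - (T - + 1) * (α - + 1) - y))
        lower = solve-∀
        upper : ∀ α r x y T →
          ((α * (T - + 1) - r) * (α * (T - + 1) - r) + α * (x - y) - (x - (T - + 1)) * (x - (T - + 1)))
            + ((α * (T - + 1) - r) * (α * (T - + 1) - r) + α * (y - x) - (y - (T - + 1)) * (y - (T - + 1)))
          ≡ + 2 * (α - + 1 - (α * T - r) + + 1) * ((r - (T - + 1) * (α - + 1) - x) + (r - (T - + 1) * (α - + 1) - y))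
            - ((r - (T - + 1) * (α - + 1) - x) * (r - (T - + 1) * (α - + 1) - x) + (r - (T - + 1) * (α - + 1) - y) * (r - (T - + 1) * (α - + 1) - y))
        upper = solve-∀

      -- The parities of `T` and `T - 1` are exchanged, which changes the common zero. The slopes
      -- are now `-2c` and `2(α - 1 - c)`, so the two hypotheses on `T` are exactly what `squeeze`
      -- asks for.
      x₀-even : + 2 ∣ T → x₀ ≡ (α + + 1) * T - r
      x₀-even 2∣T = ℤₚ.i-j≡0⇒i≡j x₀ ((α + + 1) * T - r) (squeeze (x₀ - x*) (x₁ - x*)
        (double 0≤c) (double c≤α-1)
        (subst (+ 0 ℤ.≤_) (lower α r x₀ x₁ T) (ℤₚ.+-mono-≤ (spectral-even T 2∣T) (direct-even T 2∣T)))
        (subst (+ 0 ℤ.≤_) (upper α r x₀ x₁ T) (ℤₚ.+-mono-≤ (spectral-odd (T - + 1) 2∤T-1) (direct-odd (T - + 1) 2∤T-1))))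
        where
        x* = (α + + 1) * T - r
        2∤T-1 : ¬ + 2 ∣ T - + 1
        2∤T-1 = 2∣τ⇒2∤τ-1 T 2∣T
        lower : ∀ α r x y T →
          ((α * T - r) * (α * T - r) + α * (x - y) - (x - T) * (x - T)) + ((α * T - r) * (α * T - r) + α * (y - x) - (y - T) * (y - T))
          ≡ - (+ 2 * (α * T - r) * ((x - ((α + + 1) * T - r)) + (y - ((α + + 1) * T - r))))
            - ((x - ((α + + 1) * T - r)) * (x - ((α + + 1) * T - r)) + (y - ((α + + 1) * T - r)) * (y - ((α + + 1) * T - r)))
        lower = solve-∀
        upper : ∀ α r x y T →
          ((α * (T - + 1) - r) * (α * (T - + 1) - r) - + 2 * r + α * (x + y) - α * α + + 1 - (x - (T - + 1)) * (x - (T - + 1)))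
            + ((α * (T - + 1) - r) * (α * (T - + 1) - r) - + 2 * r + α * (y + x) - α * α + + 1 - (y - (T - + 1)) * (y - (T - + 1)))
          ≡ + 2 * (α - + 1 - (α * T - r)) * ((x - ((α + + 1) * T - r)) + (y - ((α + + 1) * T - r)))
            - ((x - ((α + + 1) * T - r)) * (x - ((α + + 1) * T - r)) + (y - ((α + + 1) * T - r)) * (y - ((α + + 1) * T - r)))
        upper = solve-∀

      Within : ℤ → Set
      Within x = + 0 ℤ.≤ b′ * x - r × b′ * x - r ℤ.≤ + b * + b - + 1

      alternatives : Within ((α + + 1) * T - r) ⊎ Within (r - (T - + 1) * (α - + 1))
      alternatives with + 2 ℤ∣.∣? T
      ... | yes 2∣T = inj₁ (subst Within (x₀-even 2∣T) window)
      ... | no  2∤T = inj₂ (subst Within (x₀-odd 2∤T) window)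

-- Comparing fractions with integers

toℚᵘ-/ : ∀ p d → ℚ.toℚᵘ (p ℚ./ suc d) ℚᵘ.≃ ℚᵘ.mkℚᵘ p d
toℚᵘ-/ p d = ℚₚ.toℚᵘ-fromℚᵘ (ℚᵘ.mkℚᵘ p d)

int≤frac : ∀ {i p} d → .{{ℕ.NonZero d}} → i * + d ℤ.≤ p → i ℚ./ 1 ℚ.≤ p // d
int≤frac {i} {p} (suc d) i≤ = ℚₚ.toℚᵘ-cancel-≤ (ℚᵘₚ.≤-respʳ-≃ (ℚᵘₚ.≃-sym (toℚᵘ-/ p d)) (ℚᵘₚ.≤-respˡ-≃ (ℚᵘₚ.≃-sym (toℚᵘ-/ i 0))
  (ℚᵘ.*≤* (subst (i * + suc d ℤ.≤_) (sym (ℤₚ.*-identityʳ p)) i≤))))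

frac≤int : ∀ {i p} d → .{{ℕ.NonZero d}} → p ℤ.≤ i * + d → p // d ℚ.≤ i ℚ./ 1
frac≤int {i} {p} (suc d) ≤i = ℚₚ.toℚᵘ-cancel-≤ (ℚᵘₚ.≤-respʳ-≃ (ℚᵘₚ.≃-sym (toℚᵘ-/ i 0)) (ℚᵘₚ.≤-respˡ-≃ (ℚᵘₚ.≃-sym (toℚᵘ-/ p d))
  (ℚᵘ.*≤* (subst (ℤ._≤ i * + suc d) (sym (ℤₚ.*-identityʳ p)) ≤i))))

int≤frac⁻¹ : ∀ {i p} d → .{{ℕ.NonZero d}} → i ℚ./ 1 ℚ.≤ p // d → i * + d ℤ.≤ p
int≤frac⁻¹ {i} {p} (suc d) i≤ = subst (i * + suc d ℤ.≤_) (ℤₚ.*-identityʳ p)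
  (ℚᵘₚ.drop-*≤* (ℚᵘₚ.≤-respʳ-≃ (toℚᵘ-/ p d) (ℚᵘₚ.≤-respˡ-≃ (toℚᵘ-/ i 0) (ℚₚ.toℚᵘ-mono-≤ i≤))))

frac<int⁻¹ : ∀ {i p} d → .{{ℕ.NonZero d}} → p // d ℚ.< i ℚ./ 1 → p ℤ.< i * + d
frac<int⁻¹ {i} {p} (suc d) <i = subst (ℤ._< i * + suc d) (ℤₚ.*-identityʳ p)
  (ℚᵘₚ.drop-*<* (ℚᵘₚ.<-respʳ-≃ (toℚᵘ-/ i 0) (ℚᵘₚ.<-respˡ-≃ (toℚᵘ-/ p d) (ℚₚ.toℚᵘ-mono-< <i))))

int-+ : ∀ i j → i ℚ./ 1 ℚ.+ j ℚ./ 1 ≡ (i + j) ℚ./ 1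
int-+ i j = ℚₚ.toℚᵘ-injective (ℚᵘₚ.≃-trans (ℚₚ.toℚᵘ-homo-+ (i ℚ./ 1) (j ℚ./ 1))
  (ℚᵘₚ.≃-trans (ℚᵘₚ.+-cong (toℚᵘ-/ i 0) (toℚᵘ-/ j 0))
  (ℚᵘₚ.≃-trans (ℚᵘ.*≡* (shape i j)) (ℚᵘₚ.≃-sym (toℚᵘ-/ (i + j) 0)))))
  where
  shape : ∀ i j → (i * + 1 + j * + 1) * + 1 ≡ (i + j) * + 1
  shape = solve-∀

frac-int≤int : ∀ {i j p} d → .{{ℕ.NonZero d}} → p ℤ.≤ (i + j) * + d → p // d ℚ.- j ℚ./ 1 ℚ.≤ i ℚ./ 1
frac-int≤int {i} {j} {p} d ≤i+j = subst (p // d ℚ.- j ℚ./ 1 ℚ.≤_) cancel (ℚₚ.+-monoˡ-≤ (ℚ.- (j ℚ./ 1)) (frac≤int {i + j} {p} d ≤i+j))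
  where
  cancel : (i + j) ℚ./ 1 ℚ.- j ℚ./ 1 ≡ i ℚ./ 1
  cancel = begin
    (i + j) ℚ./ 1 ℚ.- j ℚ./ 1              ≡⟨ cong (ℚ._- j ℚ./ 1) (sym (int-+ i j)) ⟩
    i ℚ./ 1 ℚ.+ j ℚ./ 1 ℚ.- j ℚ./ 1        ≡⟨ ℚₚ.+-assoc (i ℚ./ 1) (j ℚ./ 1) (ℚ.- (j ℚ./ 1)) ⟩
    i ℚ./ 1 ℚ.+ (j ℚ./ 1 ℚ.- j ℚ./ 1)      ≡⟨ cong (i ℚ./ 1 ℚ.+_) (ℚₚ.+-inverseʳ (j ℚ./ 1)) ⟩
    i ℚ./ 1 ℚ.+ ℚ.0ℚ                       ≡⟨ ℚₚ.+-identityʳ (i ℚ./ 1) ⟩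
    i ℚ./ 1                                ∎
    where open ≡-Reasoning

int≤frac+int : ∀ {i j p} d → .{{ℕ.NonZero d}} → (i - j) * + d ℤ.≤ p → i ℚ./ 1 ℚ.≤ p // d ℚ.+ j ℚ./ 1
int≤frac+int {i} {j} {p} d i-j≤ = subst (ℚ._≤ p // d ℚ.+ j ℚ./ 1) (trans (int-+ (i - j) j) (cong (ℚ._/ 1) (restore i j)))
  (ℚₚ.+-monoˡ-≤ (j ℚ./ 1) (int≤frac {i - j} {p} d i-j≤))
  where
  restore : ∀ i j → i - j + j ≡ i
  restore = solve-∀

-- Partial difference sets

∑-tabulate : ∀ {A : Set} n (f : Fin n → A) (g : A → ℤ) → ∑ (tabulate f) g ≡ ∑ (allFin n) (λ i → g (f i))
∑-tabulate zero    f g = refl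
∑-tabulate (suc n) f g = cong (_+_ (g (f Fin.zero))) (trans (∑-tabulate n (λ i → f (Fin.suc i)) g)
  (sym (∑-tabulate n Fin.suc (λ i → g (f i)))))

∑-allFin-suc : ∀ n (g : Fin (suc n) → ℤ) → ∑ (allFin (suc n)) g ≡ g Fin.zero + ∑ (allFin n) (λ i → g (Fin.suc i))
∑-allFin-suc n g = cong (_+_ (g Fin.zero)) (∑-tabulate n Fin.suc g)

finFinSet : ℕ → FinSet
finFinSet n = record { Carrier = Fin n ; _≟_ = Finₚ._≟_ ; elems = allFin n ; δ-total = once n }
  where
  once : ∀ n (x : Fin n) → ∑ (allFin n) (λ y → [ x Finₚ.≟ y ]) ≡ + 1
  once (suc n) Fin.zero    = trans (∑-allFin-suc n (λ y → [ Fin.zero Finₚ.≟ y ])) (cong (_+_ (+ 1)) (∑-zero (allFin n)))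
  once (suc n) (Fin.suc x) = trans (∑-allFin-suc n (λ y → [ Fin.suc x Finₚ.≟ y ])) (trans (ℤₚ.+-identityˡ _)
    (trans (∑-cong (allFin n) (λ y → []-cong (Fin.suc x Finₚ.≟ Fin.suc y) (x Finₚ.≟ y) Finₚ.suc-injective (cong Fin.suc))) (once n x)))

∑-allFin-1 : ∀ n → ∑ (allFin n) (λ _ → + 1) ≡ + n
∑-allFin-1 zero    = refl
∑-allFin-1 (suc n) = trans (∑-allFin-suc n (λ _ → + 1)) (cong (_+_ (+ 1)) (∑-allFin-1 n))

∑-subset : ∀ {n} (D : Subset n) → ∑ (allFin n) (λ i → [ i ∈? D ]) ≡ + ∣ D ∣ˢ
∑-subset Vec.[] = refl
∑-subset {suc n} (s Vec.∷ D) = trans (∑-allFin-suc n (λ i → [ i ∈? (s Vec.∷ D) ])) (trans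
  (cong (_+_ [ Fin.zero ∈? (s Vec.∷ D) ]) (trans (∑-cong (allFin n) (λ i → []-cong (Fin.suc i ∈? (s Vec.∷ D)) (i ∈? D) drop-there Vec.there)) (∑-subset D)))
  (head s))
  where
  head : ∀ s → [ Fin.zero ∈? (s Vec.∷ D) ] + + ∣ D ∣ˢ ≡ + ∣ s Vec.∷ D ∣ˢ
  head inside  = refl
  head outside = refl

+sum : ∀ {A : Set} (xs : List A) (f : A → ℕ) → + sumₙ (map f xs) ≡ ∑ xs (λ x → + f x)
+sum []       f = refl
+sum (x ∷ xs) f = trans (ℤₚ.pos-+ (f x) (sumₙ (map f xs))) (cong (_+_ (+ f x)) (+sum xs f))

+filter : ∀ {A : Set} {P : A → Set} (P? : ∀ x → Dec (P x)) (xs : List A) → + length (filter P? xs) ≡ ∑ xs (λ x → [ P? x ])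
+filter P? []       = refl
+filter P? (x ∷ xs) with P? x
... | yes _ = cong (_+_ (+ 1)) (+filter P? xs)
... | no _  = trans (+filter P? xs) (sym (ℤₚ.+-identityˡ _))

[×] : ∀ {P Q : Set} (p? : Dec P) (q? : Dec Q) → [ p? ×-dec q? ] ≡ [ p? ] * [ q? ]
[×] (yes _) (yes _) = refl
[×] (yes _) (no _)  = refl
[×] (no _)  (yes _) = refl
[×] (no _)  (no _)  = refl

[]-idem : ∀ {P : Set} (p? : Dec P) → [ p? ] * [ p? ] ≡ [ p? ]
[]-idem (yes _) = refl
[]-idem (no _)  = refl

module Transport (G : FiniteAbelianGroup) where
  private
    module G = FiniteAbelianGroup G
    index : G.Carrier → Fin G.order
    index x = proj₁ (G.enum-surj x)

    enum-index : ∀ x → G.enum (index x) G.≈ x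
    enum-index x = proj₂ (G.enum-surj x)

    _·_ : Fin G.order → Fin G.order → Fin G.order
    i · j = index (G.enum i G.∙ G.enum j)

    unit : Fin G.order
    unit = index G.ε

    inv : Fin G.order → Fin G.order
    inv i = index (G.enum i G.⁻¹)

    ·-enum : ∀ i j → G.enum (i · j) G.≈ G.enum i G.∙ G.enum j
    ·-enum i j = enum-index _

  -- Elements are replaced by their indices, for which equality in the group becomes propositional
  -- equality.
  finAb : FinAb
  finAb = record
    { finSet = finFinSet G.order
    ; _∙_ = _·_
    ; e   = unit
    ; _⁻¹ = inv
    ; isAbelianGroup = record
      { isGroup = record
        { isMonoid = record
          { isSemigroup = record
            { isMagma = record { isEquivalence = isEquivalence ; ∙-cong = cong₂ _·_ }
            ; assoc = λ i j k → G.enum-inj _ _ (G.trans (·-enum (i · j) k) (G.trans (G.∙-congʳ (·-enum i j))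
                (G.trans (G.assoc (G.enum i) (G.enum j) (G.enum k)) (G.sym (G.trans (·-enum i (j · k)) (G.∙-congˡ (·-enum j k)))))))
            }
          ; identity = (λ i → G.enum-inj _ _ (G.trans (·-enum unit i) (G.trans (G.∙-congʳ (enum-index G.ε)) (G.identityˡ (G.enum i)))))
                     , (λ i → G.enum-inj _ _ (G.trans (·-enum i unit) (G.trans (G.∙-congˡ (enum-index G.ε)) (G.identityʳ (G.enum i)))))
          }
        ; inverse = (λ i → G.enum-inj _ _ (G.trans (·-enum (inv i) i) (G.trans (G.∙-congʳ (enum-index _)) (G.trans (G.inverseˡ (G.enum i)) (G.sym (enum-index G.ε))))))
                  , (λ i → G.enum-inj _ _ (G.trans (·-enum i (inv i)) (G.trans (G.∙-congˡ (enum-index _)) (G.trans (G.inverseʳ (G.enum i)) (G.sym (enum-index G.ε))))))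
        ; ⁻¹-cong = cong inv
        }
      ; comm = λ i j → G.enum-inj _ _ (G.trans (·-enum i j) (G.trans (G.comm (G.enum i) (G.enum j)) (G.sym (·-enum j i))))
      }
    }

  open FinAb finAb
  open GroupRing finAb

  card≡order : card ≡ + G.order
  card≡order = ∑-allFin-1 G.order

  -- Lagrange: multiplying all elements by x permutes the factors of their product.
  exponent : Exponent G.order
  exponent x = ∙-cancelʳ (S.sum id) (x ↑ G.order) e (begin
    x ↑ G.order ∙ S.sum id                   ≡⟨ cong (_∙ S.sum id) (sym (S.sum-replicate G.order {x})) ⟩
    S.sum {G.order} (λ _ → x) ∙ S.sum id     ≡⟨ sym (S.∑-distrib-+ (λ _ → x) id) ⟩
    S.sum (λ i → x ∙ i)                      ≡⟨ sym (S.sum-permute id (permutation (x ∙_) (x ⁻¹ ∙_) (∙⁻¹-cancel x) (⁻¹∙-cancel x))) ⟩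
    S.sum id                                 ≡⟨ sym (identityˡ (S.sum id)) ⟩
    e ∙ S.sum id                             ∎)
    where
    open ≡-Reasoning
    import Algebra.Properties.CommutativeMonoid.Sum commutativeMonoid as S
    open import Algebra.Properties.AbelianGroup abelianGroup using (∙-cancelʳ)
    id : Fin G.order → Carrier
    id i = i

  enum-e : ∀ {x} → G.enum x G.≈ G.ε → x ≡ e
  enum-e eq = G.enum-inj _ _ (G.trans eq (G.sym (enum-index G.ε)))

  module _ (D : Subset G.order) where

    𝟙 : Carrier → ℤ
    𝟙 x = [ x ∈? D ]

    -- The count of differences without the condition `i ≠ j`: it agrees with `repCount` off the
    -- identity and equals |D| there.
    correlation : Carrier → ℤ
    correlation x = ∑ elems (λ i → 𝟙 i * 𝟙 (i ∙ x ⁻¹))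

    +repCount : ∀ x → x ≢ e → + repCount G D x ≡ correlation x
    +repCount x x≢e = trans (+sum (allFin G.order) _) (∑-cong elems (λ i → trans (+filter _ (allFin G.order)) (begin
      ∑ elems (λ j → [ (i ∈? D) ×-dec ((j ∈? D) ×-dec (¬? (i Finₚ.≟ j) ×-dec ((G.enum i G.∙ (G.enum j G.⁻¹)) G.≈? G.enum x))) ])
        ≡⟨ ∑-cong elems (λ j → trans ([×] (i ∈? D) _) (cong (𝟙 i *_) (trans ([×] (j ∈? D) _) (trans (cong (𝟙 j *_) (quotient i j)) (ℤₚ.*-comm (𝟙 j) (δ (i ∙ x ⁻¹) j)))))) ⟩
      ∑ elems (λ j → 𝟙 i * (δ (i ∙ x ⁻¹) j * 𝟙 j))
        ≡⟨ ∑-*ˡ elems (𝟙 i) (λ j → δ (i ∙ x ⁻¹) j * 𝟙 j) ⟩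
      𝟙 i * ∑ elems (λ j → δ (i ∙ x ⁻¹) j * 𝟙 j)
        ≡⟨ cong (𝟙 i *_) (∑δ (i ∙ x ⁻¹) 𝟙) ⟩
      𝟙 i * 𝟙 (i ∙ x ⁻¹) ∎)))
      where
      open ≡-Reasoning
      enum-quotient : ∀ i j → G.enum (i ∙ j ⁻¹) G.≈ G.enum i G.∙ (G.enum j G.⁻¹)
      enum-quotient i j = G.trans (·-enum i (j ⁻¹)) (G.∙-congˡ (enum-index _))
      swap : ∀ {i j k} → i ∙ j ⁻¹ ≡ k → i ∙ k ⁻¹ ≡ j
      swap {i} {j} {k} refl = trans (cong (i ∙_) (trans (sym (⁻¹-∙-comm i (j ⁻¹))) (cong (i ⁻¹ ∙_) (⁻¹-involutive j)))) (∙⁻¹-cancel i j)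
      quotient : ∀ i j → [ ¬? (i Finₚ.≟ j) ×-dec ((G.enum i G.∙ (G.enum j G.⁻¹)) G.≈? G.enum x) ] ≡ δ (i ∙ x ⁻¹) j
      quotient i j = []-cong (¬? (i Finₚ.≟ j) ×-dec ((G.enum i G.∙ (G.enum j G.⁻¹)) G.≈? G.enum x)) ((i ∙ x ⁻¹) ≟ j)
        (λ { (_ , eq) → swap (G.enum-inj _ _ (G.trans (enum-quotient i j) eq)) })
        (λ eq → (λ { refl → x≢e (trans (sym (swap eq)) (inverseʳ i)) }) , G.trans (G.sym (enum-quotient i j)) (G.reflexive (cong G.enum (swap eq))))

    correlation-sym : ∀ x → correlation (x ⁻¹) ≡ correlation x
    correlation-sym x = trans (sym (∑-translate (x ⁻¹) (λ i → 𝟙 i * 𝟙 (i ∙ x ⁻¹ ⁻¹)))) (∑-cong elems (λ i → trans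
      (ℤₚ.*-comm (𝟙 (x ⁻¹ ∙ i)) (𝟙 (x ⁻¹ ∙ i ∙ x ⁻¹ ⁻¹)))
      (cong₂ (λ u w → 𝟙 u * 𝟙 w) (trans (comm _ _) (trans (cong (_∙ (x ⁻¹ ∙ i)) (⁻¹-involutive x)) (∙⁻¹-cancel x i))) (comm (x ⁻¹) i))))

    𝟙-total : total 𝟙 ≡ + ∣ D ∣ˢ
    𝟙-total = ∑-subset D

    correlation-e : correlation e ≡ total 𝟙
    correlation-e = ∑-cong elems (λ i → trans (cong (λ z → 𝟙 i * 𝟙 z) (trans (cong (i ∙_) ε⁻¹≈ε) (identityʳ i))) ([]-idem (i ∈? D)))

    correlation-total : total correlation ≡ total 𝟙 * total 𝟙
    correlation-total = begin
      ∑ elems (λ x → ∑ elems (λ i → 𝟙 i * 𝟙 (i ∙ x ⁻¹)))  ≡⟨ ∑-swap elems elems (λ x i → 𝟙 i * 𝟙 (i ∙ x ⁻¹)) ⟩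
      ∑ elems (λ i → ∑ elems (λ x → 𝟙 i * 𝟙 (i ∙ x ⁻¹)))  ≡⟨ ∑-cong elems (λ i → trans (∑-*ˡ elems (𝟙 i) (λ x → 𝟙 (i ∙ x ⁻¹))) (cong (𝟙 i *_) (trans (∑-inverse (λ x → 𝟙 (i ∙ x))) (∑-translate i 𝟙)))) ⟩
      ∑ elems (λ i → 𝟙 i * total 𝟙)                       ≡⟨ ∑-*ʳ elems (total 𝟙) 𝟙 ⟩
      total 𝟙 * total 𝟙                                   ∎
      where open ≡-Reasoning

    module LatinType (n r : ℤ) (v≡ : card ≡ n * n) (k≡ : total 𝟙 ≡ r * (n - + 1))
      (in-D  : ∀ x → x ≢ e → x ∈ˢ D → correlation x ≡ n + r * r - + 3 * r)
      (out-D : ∀ x → x ≢ e → ¬ x ∈ˢ D → correlation x ≡ r * r - r)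
      (β≢0 : n - + 2 * r ≢ + 0) where

      private
        μ β : ℤ
        μ = r * r - r
        β = n - + 2 * r

        off-e : ∀ x → x ≢ e → correlation x ≡ μ + β * 𝟙 x
        off-e x x≢e with x ∈? D
        ... | yes x∈ = trans (in-D x x≢e x∈) (shape n r)
          where
          shape : ∀ n r → n + r * r - + 3 * r ≡ r * r - r + (n - + 2 * r) * + 1
          shape = solve-∀
        ... | no  x∉ = trans (out-D x x≢e x∉) (shape (r * r - r) (n - + 2 * r))
          where
          shape : ∀ m b → m ≡ m + b * + 0
          shape = solve-∀

        cancel-β : ∀ {i j} → β * i ≡ β * j → i ≡ j
        cancel-β {i} {j} = ℤₚ.*-cancelˡ-≡ β i j {{ℤ.≢-nonZero β≢0}}

      -- Exchanging the two elements of a difference shows that the counts are symmetric; off the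
      -- identity they determine membership because `β` is nonzero.
      𝟙-sym : Symmetric 𝟙
      𝟙-sym x with x ≟ e
      ... | yes refl = cong 𝟙 ε⁻¹≈ε
      ... | no  x≢e  = cancel-β (ℤ+.∙-cancelˡ μ (β * 𝟙 (x ⁻¹)) (β * 𝟙 x) (trans (sym (off-e (x ⁻¹) x⁻¹≢e)) (trans (correlation-sym x) (off-e x x≢e))))
        where
        x⁻¹≢e : x ⁻¹ ≢ e
        x⁻¹≢e eq = x≢e (trans (sym (⁻¹-involutive x)) (trans (cong _⁻¹ eq) ε⁻¹≈ε))

      private
        correlation≡ : ∀ x → correlation x ≡ μ + β * 𝟙 x + δ e x * (total 𝟙 - μ - β * 𝟙 e)
        correlation≡ x with e ≟ x
        ... | yes refl = trans correlation-e (shape (total 𝟙) μ (β * 𝟙 e))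
          where
          shape : ∀ k m b → k ≡ m + b + + 1 * (k - m - b)
          shape = solve-∀
        ... | no e≢x = trans (off-e x (λ eq → e≢x (sym eq))) (shape (μ + β * 𝟙 x) (total 𝟙 - μ - β * 𝟙 e))
          where
          shape : ∀ a b → a ≡ a + + 0 * b
          shape = solve-∀

        -- Counting all pairs: the excess at e vanishes because the parameters already balance without it.
        balance : total 𝟙 * total 𝟙 ≡ μ * card + β * total 𝟙 + (total 𝟙 - μ - β * 𝟙 e)
        balance = begin
          total 𝟙 * total 𝟙
            ≡⟨ sym correlation-total ⟩
          total correlation
            ≡⟨ ∑-cong elems correlation≡ ⟩
          ∑ elems (λ x → μ + β * 𝟙 x + δ e x * (total 𝟙 - μ - β * 𝟙 e))
            ≡⟨ ∑-+ elems (λ x → μ + β * 𝟙 x) (λ x → δ e x * (total 𝟙 - μ - β * 𝟙 e)) ⟩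
          ∑ elems (λ x → μ + β * 𝟙 x) + ∑ elems (λ x → δ e x * (total 𝟙 - μ - β * 𝟙 e))
            ≡⟨ cong₂ _+_ (∑-+ elems (λ _ → μ) (λ x → β * 𝟙 x)) (∑δ e (λ _ → total 𝟙 - μ - β * 𝟙 e)) ⟩
          ∑ elems (λ _ → μ) + ∑ elems (λ x → β * 𝟙 x) + (total 𝟙 - μ - β * 𝟙 e)
            ≡⟨ cong (_+ (total 𝟙 - μ - β * 𝟙 e)) (cong₂ _+_
                 (trans (∑-cong elems (λ _ → sym (ℤₚ.*-identityʳ μ))) (∑-*ˡ elems μ (λ _ → + 1))) (∑-*ˡ elems β 𝟙)) ⟩
          μ * card + β * total 𝟙 + (total 𝟙 - μ - β * 𝟙 e) ∎
          where open ≡-Reasoning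

      𝟙-e : 𝟙 e ≡ + 0
      𝟙-e = cancel-β (begin
        β * 𝟙 e
          ≡⟨ isolate (total 𝟙) μ card β (β * 𝟙 e) balance ⟩
        μ * card + β * total 𝟙 + total 𝟙 - μ - total 𝟙 * total 𝟙
          ≡⟨ cong₂ (λ v k → μ * v + β * k + k - μ - k * k) v≡ k≡ ⟩
        μ * (n * n) + β * (r * (n - + 1)) + r * (n - + 1) - μ - r * (n - + 1) * (r * (n - + 1))
          ≡⟨ identity n r ⟩
        + 0
          ≡⟨ sym (ℤₚ.*-zeroʳ β) ⟩
        β * + 0 ∎)
        where
        open ≡-Reasoning
        isolate : ∀ k m v b z → k * k ≡ m * v + b * k + (k - m - z) → z ≡ m * v + b * k + k - m - k * k
        isolate k m v b z eq = trans (shape k m v b z) (cong (λ w → m * v + b * k + k - m - w) (sym eq))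
          where
          shape : ∀ k m v b z → z ≡ m * v + b * k + k - m - (m * v + b * k + (k - m - z))
          shape = solve-∀
        identity : ∀ n r → (r * r - r) * (n * n) + (n - + 2 * r) * (r * (n - + 1)) + r * (n - + 1) - (r * r - r) - r * (n - + 1) * (r * (n - + 1)) ≡ + 0
        identity = solve-∀

      P : Carrier → ℤ
      P x = 𝟙 x + r * δ e x

      P-e : P e ≡ r
      P-e = trans (cong₂ (λ u w → u + r * w) 𝟙-e (δ-refl e)) (trans (ℤₚ.+-identityˡ (r * + 1)) (ℤₚ.*-identityʳ r))

      P-01 : ∀ x → x ≢ e → P x ≡ + 0 ⊎ P x ≡ + 1
      P-01 x x≢e = split (x ∈? D)
        where
        drop : ∀ u → u + r * δ e x ≡ u
        drop u = trans (cong (λ w → u + r * w) ([]-no (e ≟ x) (λ eq → x≢e (sym eq)))) (trans (cong (_+_ u) (ℤₚ.*-zeroʳ r)) (ℤₚ.+-identityʳ u))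
        split : (d? : Dec (x ∈ˢ D)) → [ d? ] + r * δ e x ≡ + 0 ⊎ [ d? ] + r * δ e x ≡ + 1
        split (yes _) = inj₂ (drop (+ 1))
        split (no _)  = inj₁ (drop (+ 0))

      P-total : total P ≡ r * n
      P-total = trans (∑-+ elems 𝟙 (λ x → r * δ e x)) (trans (cong₂ _+_ k≡ (trans (∑-*ˡ elems r (δ e)) (cong (r *_) (δ-total e)))) (shape r n))
        where
        shape : ∀ r n → r * (n - + 1) + r * + 1 ≡ r * n
        shape = solve-∀

      P² : ∀ x → (P ⋆ P) x ≡ n * P x + (r * r - r)
      P² x = begin
        (P ⋆ P) x
          ≡⟨ ⋆-distribʳ P 𝟙 (λ y → r * δ e y) x ⟩
        (𝟙 ⋆ P) x + ((λ y → r * δ e y) ⋆ P) x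
          ≡⟨ cong₂ _+_ (⋆-distribˡ 𝟙 𝟙 (λ y → r * δ e y) x) (trans (⋆-scaleˡ r (δ e) P x) (cong (r *_) (⋆-identityˡ P x))) ⟩
        (𝟙 ⋆ 𝟙) x + (𝟙 ⋆ (λ y → r * δ e y)) x + r * P x
          ≡⟨ cong (_+ r * P x) (cong₂ _+_ 𝟙⋆𝟙 (trans (⋆-scaleʳ r 𝟙 (δ e) x) (cong (r *_) (trans (⋆-comm 𝟙 (δ e) x) (⋆-identityˡ 𝟙 x))))) ⟩
        correlation x + r * 𝟙 x + r * P x
          ≡⟨ cong (λ z → z + r * 𝟙 x + r * P x) (trans (correlation≡ x) (cong₂ (λ k z → μ + β * 𝟙 x + δ e x * (k - μ - β * z)) k≡ 𝟙-e)) ⟩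
        μ + β * 𝟙 x + δ e x * (r * (n - + 1) - μ - β * + 0) + r * 𝟙 x + r * (𝟙 x + r * δ e x)
          ≡⟨ shape n r (𝟙 x) (δ e x) ⟩
        n * P x + (r * r - r) ∎
        where
        open ≡-Reasoning
        -- The convolution counts products and the correlation differences; symmetry of D identifies
        -- them.
        𝟙⋆𝟙 : (𝟙 ⋆ 𝟙) x ≡ correlation x
        𝟙⋆𝟙 = ∑-cong elems (λ y → cong (𝟙 y *_) (trans (sym (𝟙-sym (y ⁻¹ ∙ x)))
          (cong 𝟙 (trans (sym (⁻¹-∙-comm (y ⁻¹) x)) (cong (_∙ x ⁻¹) (⁻¹-involutive y))))))
        shape : ∀ n r d z → r * r - r + (n - + 2 * r) * d + z * (r * (n - + 1) - (r * r - r) - (n - + 2 * r) * + 0) + r * d + r * (d + r * z)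
          ≡ n * (d + r * z) + (r * r - r)
        shape = solve-∀

-- From the difference set to the estimate for two coprime factors

coprime-squares : ∀ {a b} → Coprime a b → Coprime a (b ℕ.* b)
coprime-squares {a} {b} a⊥b = Coprimality.sym (coprime-*ˡ b b a (Coprimality.sym a⊥b) (Coprimality.sym a⊥b))

module Assembly (G : FiniteAbelianGroup) (D : Subset (FiniteAbelianGroup.order G)) (a b : ℕ)
  .{{a≢0 : ℕ.NonZero a}} .{{b≢0 : ℕ.NonZero b}} (a⊥b : Coprime a b) (2∤b : ¬ 2 ∣ₙ b) (1<b : 1 ℕ.< b)
  (σ r : ℤ) (σ² : σ * σ ≡ + 1) (2∣b′-1 : + 2 ∣ σ * + b - + 1)
  (order≡ : FiniteAbelianGroup.order G ≡ (a ℕ.* a) ℕ.* (b ℕ.* b)) where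

  open Transport G
  open FinAb finAb
  open GroupRing finAb

  private
    A B : ℕ
    A = a ℕ.* a
    B = b ℕ.* b
    instance
      A≢0 : ℕ.NonZero A
      A≢0 = ℕₚ.m*n≢0 a a
      B≢0 : ℕ.NonZero B
      B≢0 = ℕₚ.m*n≢0 b b
      v≢0 : ℕ.NonZero (A ℕ.* B)
      v≢0 = ℕₚ.m*n≢0 A B
    n : ℤ
    n = + a * (σ * + b)
    exp : Exponent (A ℕ.* B)
    exp = subst Exponent order≡ exponent
    card≡AB : card ≡ + (A ℕ.* B)
    card≡AB = trans card≡order (cong +_ order≡)
    n² : + (A ℕ.* B) ≡ n * n
    n² = begin
      + (A ℕ.* B)                     ≡⟨ ℤₚ.pos-* A B ⟩
      + A * + B                       ≡⟨ cong₂ _*_ (ℤₚ.pos-* a a) (ℤₚ.pos-* b b) ⟩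
      (+ a * + a) * (+ b * + b)       ≡⟨ sym (ℤₚ.*-identityˡ ((+ a * + a) * (+ b * + b))) ⟩
      + 1 * ((+ a * + a) * (+ b * + b)) ≡⟨ cong (_* ((+ a * + a) * (+ b * + b))) (sym σ²) ⟩
      σ * σ * ((+ a * + a) * (+ b * + b)) ≡⟨ shape σ (+ a) (+ b) ⟩
      n * n                           ∎
      where
      open ≡-Reasoning
      shape : ∀ s a b → s * s * ((a * a) * (b * b)) ≡ (a * (s * b)) * (a * (s * b))
      shape = solve-∀

  v≡n² : card ≡ n * n
  v≡n² = trans card≡AB n²

  Within : ℤ → Set
  Within x = + 0 ℤ.≤ (σ * + b) * x - r × (σ * + b) * x - r ℤ.≤ + b * + b - + 1

  module _ (k≡ : total (𝟙 D) ≡ r * (n - + 1))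
    (in-D  : ∀ x → x ≢ e → x ∈ˢ D → correlation D x ≡ n + r * r - + 3 * r)
    (out-D : ∀ x → x ≢ e → ¬ x ∈ˢ D → correlation D x ≡ r * r - r)
    (β≢0 : n - + 2 * r ≢ + 0)
    (T : ℤ) (0≤c : + 0 ℤ.≤ + a * T - r) (c≤a-1 : + 0 ℤ.≤ + a - + 1 - (+ a * T - r)) where

    private
      module L = LatinType D n r v≡n² k≡ in-D out-D β≢0
      open L using (P)

      invariance : ∀ x k l → (x ↑ k) ↑ l ≡ x → P (x ↑ k) ≡ P x
      invariance = Arithmetic.Multiplier.same-cyclic finAb exp n (r * r - r)
        (ℤ∣.∣⇒∣ᵤ (divides n n²)) P L.P² L.P-01

      split : ∀ s s′ q → B ∣ₙ s → A ∣ₙ s′ → s ℕ.+ s′ ≡ 1 ℕ.+ q ℕ.* (A ℕ.* B) →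
        Within ((+ a + + 1) * T - r) ⊎ Within (r - (T - + 1) * (+ a - + 1))
      split s s′ q B∣s A∣s′ s+s′ = TwoFactors.alternatives N H a b σ r σ² N-exponent H-exponent
        (trans N-card (ℤₚ.pos-* a a)) (trans H-card (ℤₚ.pos-* b b))
        (coprime-squares a⊥b) (coprime-squares (Coprimality.sym a⊥b)) (coprime-squares (prime∤⇒coprime prime[2] 2∤b)) 2∣b′-1 1<b
        p conv p-inv p-symᴴ p-symᴺ p-e p-01 p-total T 0≤c c≤a-1
        where
        open Splitting finAb A B (Coprimality.sym (coprime-squares (Coprimality.sym (coprime-squares a⊥b)))) exp card≡AB s s′ q B∣s A∣s′ s+s′
        module N = FinAb N
        module H = FinAb H
        module ℤN = GroupRing N
        p : N.Carrier → H.Carrier → ℤ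
        p n h = P (n ⊙ h)
        ⊙-quotient : ∀ n₁ h₁ n h → (n₁ ⊙ h₁) ⁻¹ ∙ (n ⊙ h) ≡ (n₁ N.⁻¹ N.∙ n) ⊙ (h₁ H.⁻¹ H.∙ h)
        ⊙-quotient n₁ h₁ n h = trans (cong (_∙ (n ⊙ h)) (sym (⁻¹-∙-comm (proj₁ n₁) (proj₁ h₁))))
          (interchange (proj₁ n₁ ⁻¹) (proj₁ h₁ ⁻¹) (proj₁ n) (proj₁ h))
          where open import Algebra.Properties.CommutativeSemigroup (CommutativeMonoid.commutativeSemigroup commutativeMonoid) using (interchange)
        conv : ∀ m h → ∑ H.elems (λ h₁ → ((λ n₁ → p n₁ h₁) ℤN.⋆ (λ n₁ → p n₁ (h₁ H.⁻¹ H.∙ h))) m) ≡ n * p m h + (r * r - r)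
        conv m h = begin
          ∑ H.elems (λ h₁ → ∑ N.elems (λ n₁ → p n₁ h₁ * p (n₁ N.⁻¹ N.∙ m) (h₁ H.⁻¹ H.∙ h)))
            ≡⟨ ∑-swap H.elems N.elems (λ h₁ n₁ → p n₁ h₁ * p (n₁ N.⁻¹ N.∙ m) (h₁ H.⁻¹ H.∙ h)) ⟩
          ∑ N.elems (λ n₁ → ∑ H.elems (λ h₁ → p n₁ h₁ * p (n₁ N.⁻¹ N.∙ m) (h₁ H.⁻¹ H.∙ h)))
            ≡⟨ ∑-cong N.elems (λ n₁ → ∑-cong H.elems (λ h₁ → cong (λ z → p n₁ h₁ * P z) (sym (⊙-quotient n₁ h₁ m h)))) ⟩
          ∑ N.elems (λ n₁ → ∑ H.elems (λ h₁ → P (n₁ ⊙ h₁) * P ((n₁ ⊙ h₁) ⁻¹ ∙ (m ⊙ h))))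
            ≡⟨ ∑-split (λ x → P x * P (x ⁻¹ ∙ (m ⊙ h))) ⟩
          (P ⋆ P) (m ⊙ h)
            ≡⟨ L.P² (m ⊙ h) ⟩
          n * p m h + (r * r - r) ∎
          where open ≡-Reasoning
        -- One power of `m ⊙ h` realises both given powers and another one undoes them, so the two
        -- elements generate the same cyclic subgroup of the whole group.
        same : ∀ m h k l k′ l′ → (m N.↑ k) N.↑ l ≡ m → (h H.↑ k′) H.↑ l′ ≡ h → p (m N.↑ k) (h H.↑ k′) ≡ p m h
        same m h k l k′ l′ m-back h-back = subst (λ z → P z ≡ p m h) (proj₂ there-power)
          (invariance (m ⊙ h) (proj₁ there-power) (proj₁ back-power)
            (trans (cong (_↑ proj₁ back-power) (proj₂ there-power)) (trans (proj₂ back-power) (cong₂ _⊙_ m-back h-back))))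
          where
          there-power : ∃ λ w → (m ⊙ h) ↑ w ≡ (m N.↑ k) ⊙ (h H.↑ k′)
          there-power = ⊙-power m h k k′
          back-power : ∃ λ w → ((m N.↑ k) ⊙ (h H.↑ k′)) ↑ w ≡ ((m N.↑ k) N.↑ l) ⊙ ((h H.↑ k′) H.↑ l′)
          back-power = ⊙-power (m N.↑ k) (h H.↑ k′) l l′
        p-inv : ∀ h m k l → (m N.↑ k) N.↑ l ≡ m → p (m N.↑ k) h ≡ p m h
        p-inv h m k l back = subst (λ z → p (m N.↑ k) z ≡ p m h) (H.identityʳ h)
          (same m h k l 1 1 back (trans (H.identityʳ (h H.↑ 1)) (H.identityʳ h)))
        -- Inversion is the power `pred B`, and applying it twice returns to `h`.
        p-symᴴ : ∀ m h → p m (h H.⁻¹) ≡ p m h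
        p-symᴴ m h = subst₂ (λ u w → p u w ≡ p m h) (N.identityʳ m) (sym (⁻¹-power h))
          (same m h 1 1 (ℕ.pred B) (ℕ.pred B) (trans (N.identityʳ (m N.↑ 1)) (N.identityʳ m))
            (trans (cong (H._↑ ℕ.pred B) (sym (⁻¹-power h))) (trans (sym (⁻¹-power (h H.⁻¹))) (H.⁻¹-involutive h))))
          where open Spectral H {B} H-exponent using (⁻¹-power)
        p-symᴺ : ∀ m h → p (m N.⁻¹) h ≡ p m h
        p-symᴺ m h = subst (λ u → p u h ≡ p m h) (sym (⁻¹-power m)) (p-inv h m (ℕ.pred A) (ℕ.pred A)
          (trans (cong (N._↑ ℕ.pred A) (sym (⁻¹-power m))) (trans (sym (⁻¹-power (m N.⁻¹))) (N.⁻¹-involutive m))))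
          where open Spectral N {A} N-exponent using (⁻¹-power)
        p-e : p N.e H.e ≡ r
        p-e = trans (cong P (identityˡ e)) L.P-e
        p-01 : ∀ m → N.e ≢ m → p m H.e ≡ + 0 ⊎ p m H.e ≡ + 1
        p-01 m e≢m = L.P-01 (m ⊙ H.e) (λ eq → e≢m (sym (Fixed.fix-≡ finAb s (trans (sym (identityʳ (proj₁ m))) eq))))
        p-total : ∑ N.elems (λ m → ∑ H.elems (p m)) ≡ r * n
        p-total = trans (∑-split P) L.P-total

    regular : Within ((+ a + + 1) * T - r) ⊎ Within (r - (T - + 1) * (+ a - + 1))
    regular = finish (orthogonal-exponents A B (Coprimality.sym (coprime-squares (Coprimality.sym (coprime-squares a⊥b)))))
      where
      finish : (∃ λ s → ∃ λ s′ → ∃ λ q → B ∣ₙ s × A ∣ₙ s′ × s ℕ.+ s′ ≡ 1 ℕ.+ q ℕ.* (A ℕ.* B)) →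
        Within ((+ a + + 1) * T - r) ⊎ Within (r - (T - + 1) * (+ a - + 1))
      finish (s , s′ , q , B∣s , A∣s′ , s+s′) = split s s′ q B∣s A∣s′ s+s′

-- In the degenerate case λ = μ the parameters force n = 2r and t = 0, and the bounds hold for any D.
degenerate : ∀ (a b : ℕ) .{{_ : ℕ.NonZero a}} (σ r T : ℤ) → 3 ℕ.≤ b → σ ≡ + 1 ⊎ σ ≡ - + 1 → + 2 ∣ σ * + b - + 1 →
  + a * (σ * + b) - + 2 * r ≡ + 0 → + 0 ℤ.≤ + a * T - r → + 0 ℤ.≤ + a - + 1 - (+ a * T - r) →
  + 0 ℤ.≤ (σ * + b) * ((+ a + + 1) * T - r) - r × (σ * + b) * ((+ a + + 1) * T - r) - r ℤ.≤ + b * + b - + 1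
degenerate a b σ r T 3≤b σ-cases 2∣b′-1 n≡2r 0≤c c≤a-1 =
  nonneg-cancel (+ 2) u 0<2 (subst (+ 0 ℤ.≤_) (sym 2u≡) (proj₁ (signs σ-cases))) ,
  ℤₚ.0≤i-j⇒j≤i (nonneg-cancel (+ 2) (+ b * + b - + 1 - u) 0<2 (subst (+ 0 ℤ.≤_) (sym 2rest≡) (proj₂ (signs σ-cases))))
  where
  α b′ z u : ℤ
  α  = + a
  b′ = σ * + b
  z  = + 2 * T - b′
  u  = b′ * ((α + + 1) * T - r) - r
  0<2 : + 0 ℤ.< + 2
  0<2 = ℤ.+<+ (ℕ.s≤s ℕ.z≤n)
  0<α : + 0 ℤ.< α
  0<α = ℤ.+<+ (ℕ.>-nonZero⁻¹ a)
  2r≡ : + 2 * r ≡ α * b′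
  2r≡ = sym (ℤₚ.i-j≡0⇒i≡j (α * b′) (+ 2 * r) n≡2r)
  0≤z : + 0 ℤ.≤ z
  0≤z = nonneg-cancel α z 0<α (subst (+ 0 ℤ.≤_) (trans (shape α T r) (trans (cong (_-_ (+ 2 * α * T)) 2r≡) (factor α T b′))) (*-nonneg {+ 2} (ℤ.+≤+ ℕ.z≤n) 0≤c))
    where
    shape : ∀ α T r → + 2 * (α * T - r) ≡ + 2 * α * T - + 2 * r
    shape = solve-∀
    factor : ∀ α T β → + 2 * α * T - α * β ≡ α * (+ 2 * T - β)
    factor = solve-∀
  z<2 : z ℤ.< + 2
  z<2 = ℤₚ.*-cancelˡ-<-nonNeg {z} {+ 2} α (ℤₚ.≤-<-trans (ℤₚ.0≤i-j⇒j≤i (subst (+ 0 ℤ.≤_) bound (*-nonneg {+ 2} (ℤ.+≤+ ℕ.z≤n) c≤a-1)))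
    (subst (α * + 2 - + 2 ℤ.<_) (ℤₚ.+-identityʳ (α * + 2)) (ℤₚ.+-monoʳ-< (α * + 2) ℤ.-<+)))
    where
    bound : + 2 * (α - + 1 - (α * T - r)) ≡ (α * + 2 - + 2) - α * z
    bound = trans (shape α T r) (trans (cong (λ w → α * + 2 - + 2 - (+ 2 * α * T - w)) 2r≡) (factor α T b′))
      where
      shape : ∀ α T r → + 2 * (α - + 1 - (α * T - r)) ≡ α * + 2 - + 2 - (+ 2 * α * T - + 2 * r)
      shape = solve-∀
      factor : ∀ α T β → α * + 2 - + 2 - (+ 2 * α * T - α * β) ≡ (α * + 2 - + 2) - α * (+ 2 * T - β)
      factor = solve-∀
  -- `z` has the parity of the odd number `b′`, so of the values 0 and 1 only 1 remains; this is the
  -- statement t = 0.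
  z≡1 : z ≡ + 1
  z≡1 = only 0≤z z<2 refl
    where
    only : ∀ {w} → + 0 ℤ.≤ w → w ℤ.< + 2 → z ≡ w → w ≡ + 1
    only {+ 0} _ _ z≡0 = ⊥-elim (2∤1 (ℤ∣.∣⇒∣ᵤ (subst (+ 2 ∣_) (shape b′ T)
      (ℤ∣.∣m∣n⇒∣m-n (divides T (trans (sym (ℤₚ.i-j≡0⇒i≡j (+ 2 * T) b′ z≡0)) (ℤₚ.*-comm (+ 2) T))) 2∣b′-1))))
      where
      shape : ∀ β T → β - (β - + 1) ≡ + 1
      shape = solve-∀
    only {+ 1} _ _ _ = refl
    only {+ suc (suc _)} _ (ℤ.+<+ (ℕ.s≤s (ℕ.s≤s ()))) _
  2T≡ : + 2 * T ≡ b′ + + 1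
  2T≡ = trans (restore (+ 2 * T) b′) (cong (_+_ b′) z≡1)
    where
    restore : ∀ x y → x ≡ y + (x - y)
    restore = solve-∀
  2u≡ : + 2 * u ≡ b′ * (b′ + + 1)
  2u≡ = trans (shape α b′ T r) (trans (cong₂ (λ x y → b′ * ((α + + 1) * x - y) - y) 2T≡ 2r≡) (finish α b′))
    where
    shape : ∀ α β T r → + 2 * (β * ((α + + 1) * T - r) - r) ≡ β * ((α + + 1) * (+ 2 * T) - + 2 * r) - + 2 * r
    shape = solve-∀
    finish : ∀ α β → β * ((α + + 1) * (β + + 1) - α * β) - α * β ≡ β * (β + + 1)
    finish = solve-∀
  2rest≡ : + 2 * (+ b * + b - + 1 - u) ≡ + 2 * (+ b * + b - + 1) - b′ * (b′ + + 1)
  2rest≡ = trans (shape (+ b * + b - + 1) u) (cong (_-_ (+ 2 * (+ b * + b - + 1))) 2u≡)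
    where
    shape : ∀ m u → + 2 * (m - u) ≡ + 2 * m - + 2 * u
    shape = solve-∀
  0≤b : + 0 ℤ.≤ + b
  0≤b = ℤ.+≤+ ℕ.z≤n
  0≤b+1 : + 0 ℤ.≤ + b + + 1
  0≤b+1 = ℤₚ.+-mono-≤ 0≤b (ℤ.+≤+ ℕ.z≤n)
  0≤b-1 : + 0 ℤ.≤ + b - + 1
  0≤b-1 = ℤₚ.i≤j⇒0≤j-i (ℤ.+≤+ (ℕₚ.≤-trans (ℕ.s≤s ℕ.z≤n) 3≤b))
  0≤b-2 : + 0 ℤ.≤ + b - + 2
  0≤b-2 = ℤₚ.i≤j⇒0≤j-i (ℤ.+≤+ (ℕₚ.≤-trans (ℕ.s≤s (ℕ.s≤s ℕ.z≤n)) 3≤b))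
  0≤b+2 : + 0 ℤ.≤ + b + + 2
  0≤b+2 = ℤₚ.+-mono-≤ 0≤b (ℤ.+≤+ ℕ.z≤n)
  signs : ∀ {s} → s ≡ + 1 ⊎ s ≡ - + 1 → + 0 ℤ.≤ (s * + b) * (s * + b + + 1) × + 0 ℤ.≤ + 2 * (+ b * + b - + 1) - (s * + b) * (s * + b + + 1)
  signs (inj₁ refl) = subst (+ 0 ℤ.≤_) (first (+ b)) (*-nonneg 0≤b 0≤b+1) , subst (+ 0 ℤ.≤_) (second (+ b)) (*-nonneg 0≤b-2 0≤b+1)
    where
    first : ∀ b → b * (b + + 1) ≡ (+ 1 * b) * (+ 1 * b + + 1)
    first = solve-∀
    second : ∀ b → (b - + 2) * (b + + 1) ≡ + 2 * (b * b - + 1) - (+ 1 * b) * (+ 1 * b + + 1)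
    second = solve-∀
  signs (inj₂ refl) = subst (+ 0 ℤ.≤_) (first (+ b)) (*-nonneg 0≤b 0≤b-1) , subst (+ 0 ℤ.≤_) (second (+ b)) (*-nonneg 0≤b+2 0≤b-1)
    where
    first : ∀ b → b * (b - + 1) ≡ (- + 1 * b) * (- + 1 * b + + 1)
    first = solve-∀
    second : ∀ b → (b + + 2) * (b - + 1) ≡ + 2 * (b * b - + 1) - (- + 1 * b) * (- + 1 * b + + 1)
    second = solve-∀

-- With ε = ±1 absorbed as b ↦ εb, r ↦ εr, both types have the Latin square parameters for n = εab.
integral : (a b : ℕ) .{{_ : ℕ.NonZero a}} .{{_ : ℕ.NonZero b}} → Coprime a b → ¬ 2 ∣ₙ b → 3 ℕ.≤ b →
  (G : FiniteAbelianGroup) (σ r T : ℤ) → σ ≡ + 1 ⊎ σ ≡ - + 1 → + 2 ∣ σ * + b - + 1 →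
  (D : Subset (FiniteAbelianGroup.order G)) →
  IsPDS G D (+ (a ℕ.* a ℕ.* b ℕ.* b)) (r * (+ (a ℕ.* b) - σ)) (σ * + (a ℕ.* b) + r * r - + 3 * σ * r) (r * r - σ * r) →
  + 0 ℤ.≤ + a * T - σ * r → + 0 ℤ.≤ + a - + 1 - (+ a * T - σ * r) →
  let Within = λ x → + 0 ℤ.≤ (σ * + b) * x - σ * r × (σ * + b) * x - σ * r ℤ.≤ + b * + b - + 1 in
  Within ((+ a + + 1) * T - σ * r) ⊎ Within (σ * r - (T - + 1) * (+ a - + 1))
integral a b a⊥b 2∤b 3≤b G σ r T σ-cases 2∣b′-1 D (order≡ , k≡ , counts) 0≤c c≤a-1
  -- The number tested is λ - μ.
  with + a * (σ * + b) - + 2 * (σ * r) ℤₚ.≟ + 0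
... | yes n≡2r = inj₁ (degenerate a b σ (σ * r) T 3≤b σ-cases 2∣b′-1 n≡2r 0≤c c≤a-1)
... | no  n≢2r = Assembly.regular G D a b a⊥b 2∤b (ℕₚ.≤-trans (ℕ.s≤s (ℕ.s≤s ℕ.z≤n)) 3≤b) σ (σ * r) σ² 2∣b′-1
    (trans (ℤₚ.+-injective order≡) (ℕₚ.*-assoc (a ℕ.* a) b b))
    (trans (𝟙-total D) (trans k≡ k-shape))
    (λ x x≢e x∈D → trans (sym (+repCount D x x≢e)) (trans (proj₁ (counts x (λ eq → x≢e (enum-e eq))) x∈D) λ-shape))
    (λ x x≢e x∉D → trans (sym (+repCount D x x≢e)) (trans (proj₂ (counts x (λ eq → x≢e (enum-e eq))) x∉D) μ-shape))
    n≢2r T 0≤c c≤a-1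
  where
  open Transport G
  square-one : ∀ {s} → s ≡ + 1 ⊎ s ≡ - + 1 → s * s ≡ + 1
  square-one (inj₁ refl) = refl
  square-one (inj₂ refl) = refl
  σ² : σ * σ ≡ + 1
  σ² = square-one σ-cases
  unit : ∀ x → x ≡ σ * σ * x
  unit x = trans (sym (ℤₚ.*-identityˡ x)) (cong (_* x) (sym σ²))
  k-shape : r * (+ (a ℕ.* b) - σ) ≡ σ * r * (+ a * (σ * + b) - + 1)
  k-shape = trans (cong (λ z → r * (z - σ)) (ℤₚ.pos-* a b)) (trans (cong (λ z → r * (z - σ)) (unit (+ a * + b))) (shape σ r (+ a) (+ b)))
    where
    shape : ∀ s r a b → r * (s * s * (a * b) - s) ≡ s * r * (a * (s * b) - + 1)
    shape = solve-∀
  λ-shape : σ * + (a ℕ.* b) + r * r - + 3 * σ * r ≡ + a * (σ * + b) + σ * r * (σ * r) - + 3 * (σ * r)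
  λ-shape = trans (cong₂ (λ z w → σ * z + w - + 3 * σ * r) (ℤₚ.pos-* a b) (unit (r * r))) (shape σ r (+ a) (+ b))
    where
    shape : ∀ s r a b → s * (a * b) + s * s * (r * r) - + 3 * s * r ≡ a * (s * b) + s * r * (s * r) - + 3 * (s * r)
    shape = solve-∀
  μ-shape : r * r - σ * r ≡ σ * r * (σ * r) - σ * r
  μ-shape = trans (cong (_- σ * r) (unit (r * r))) (shape σ r)
    where
    shape : ∀ s r → s * s * (r * r) - s * r ≡ s * r * (s * r) - s * r
    shape = solve-∀

-- Translation into rational bounds

floor-bounds : ∀ {a} .{{_ : ℕ.NonZero a}} {t m} → t ℚ./ 1 ℚ.≤ m // (2 ℕ.* a) → m // (2 ℕ.* a) ℚ.< (t + + 1) ℚ./ 1 →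
  ∀ {c} → m - t * (+ 2 * + a) ≡ + 2 * c → + 0 ℤ.≤ c × + 0 ℤ.≤ + a - + 1 - c
floor-bounds {a} {t} {m} t≤ <t+1 {c} m≡ =
  nonneg-cancel (+ 2) c (ℤ.+<+ (ℕ.s≤s ℕ.z≤n)) (subst (+ 0 ℤ.≤_) m≡ (ℤₚ.i≤j⇒0≤j-i (subst (λ z → t * z ℤ.≤ m) (ℤₚ.pos-* 2 a) (int≤frac⁻¹ {t} {m} (2 ℕ.* a) t≤)))) ,
  subst (+ 0 ℤ.≤_) (shape (+ a) c) (ℤₚ.i≤j⇒0≤j-i (ℤₚ.i<j⇒suc[i]≤j c<a))
  where
  instance
    2a≢0 : ℕ.NonZero (2 ℕ.* a)
    2a≢0 = ℕₚ.m*n≢0 2 a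
  shape : ∀ a c → a - (+ 1 + c) ≡ a - + 1 - c
  shape = solve-∀
  c<a : c ℤ.< + a
  c<a = ℤₚ.*-cancelˡ-<-nonNeg {c} {+ a} (+ 2) (subst₂ ℤ._<_ m≡ (expand t (+ 2 * + a))
    (ℤₚ.+-monoˡ-< (- (t * (+ 2 * + a))) (subst (λ z → m ℤ.< (t + + 1) * z) (ℤₚ.pos-* 2 a) (frac<int⁻¹ {t + + 1} {m} (2 ℕ.* a) <t+1))))
    where
    expand : ∀ t k → (t + + 1) * k - t * k ≡ k
    expand = solve-∀

-- In units of `1 / d`, the distance from `r` up to `p // d` is `2 * w` and the width `j` of the
-- interval is `2 * m`.
sub-ends : ∀ {p r} j d .{{_ : ℕ.NonZero d}} w m → + 0 ℤ.≤ w → w ℤ.≤ m → p - r * + d ≡ + 2 * w → + j * + d ≡ + 2 * m →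
  p // d ℚ.- + j ℚ./ 1 ℚ.≤ r ℚ./ 1 × r ℚ./ 1 ℚ.≤ p // d
sub-ends {p} {r} j d w m 0≤w w≤m p-rd jd =
  frac-int≤int {r} {+ j} {p} d (ℤₚ.0≤i-j⇒j≤i (subst (+ 0 ℤ.≤_) (sym rest) (*-nonneg {+ 2} (ℤ.+≤+ ℕ.z≤n) (ℤₚ.i≤j⇒0≤j-i w≤m)))) ,
  int≤frac {r} {p} d (ℤₚ.0≤i-j⇒j≤i (subst (+ 0 ℤ.≤_) (sym p-rd) (*-nonneg {+ 2} (ℤ.+≤+ ℕ.z≤n) 0≤w)))
  where
  rest : (r + + j) * + d - p ≡ + 2 * (m - w)
  rest = trans (split r (+ j) (+ d) p) (trans (cong₂ _-_ jd p-rd) (factor m w))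
    where
    split : ∀ r j d p → (r + j) * d - p ≡ j * d - (p - r * d)
    split = solve-∀
    factor : ∀ m w → + 2 * m - + 2 * w ≡ + 2 * (m - w)
    factor = solve-∀

add-ends : ∀ {p r} j d .{{_ : ℕ.NonZero d}} w m → + 0 ℤ.≤ w → w ℤ.≤ m → r * + d - p ≡ + 2 * w → + j * + d ≡ + 2 * m →
  p // d ℚ.≤ r ℚ./ 1 × r ℚ./ 1 ℚ.≤ p // d ℚ.+ + j ℚ./ 1
add-ends {p} {r} j d w m 0≤w w≤m rd-p jd =
  frac≤int {r} {p} d (ℤₚ.0≤i-j⇒j≤i (subst (+ 0 ℤ.≤_) (sym rd-p) (*-nonneg {+ 2} (ℤ.+≤+ ℕ.z≤n) 0≤w))) ,
  int≤frac+int {r} {+ j} {p} d (ℤₚ.0≤i-j⇒j≤i (subst (+ 0 ℤ.≤_) (sym rest) (*-nonneg {+ 2} (ℤ.+≤+ ℕ.z≤n) (ℤₚ.i≤j⇒0≤j-i w≤m))))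
  where
  rest : p - (r - + j) * + d ≡ + 2 * (m - w)
  rest = trans (split r (+ j) (+ d) p) (trans (cong₂ _-_ jd rd-p) (factor m w))
    where
    split : ∀ r j d p → p - (r - j) * d ≡ j * d - (r * d - p)
    split = solve-∀
    factor : ∀ m w → + 2 * m - + 2 * w ≡ + 2 * (m - w)
    factor = solve-∀

pos-∸1 : ∀ n → .{{ℕ.NonZero n}} → + (n ℕ.∸ 1) ≡ + n - + 1
pos-∸1 (suc n) = refl

theorem2 : (a b : ℕ) → gcd a b ≡ 1 → a ℕ.> 1 → b % 2 ≡ 1 → b ≥ 3 →
    (G : FiniteAbelianGroup) → (ε r t : ℤ) → (ε ≡ + 1 ⊎ ε ≡ - + 1) →
    (D : Subset (FiniteAbelianGroup.order G)) →
    IsPDS G D (+ (a ℕ.* a ℕ.* b ℕ.* b)) (r * (+ (a ℕ.* b) - ε))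
    (ε * + (a ℕ.* b) + r * r - + 3 * ε * r) (r * r - ε * r) →
    ((t ℚ./ 1) ℚ.≤ ((ε * + (a ℕ.* b) - + 2 * ε * r + + a) // (2 ℕ.* a))) →
    (((ε * + (a ℕ.* b) - + 2 * ε * r + + a) // (2 ℕ.* a)) ℚ.< ((t + + 1) ℚ./ 1)) →
    (ε ≡ + 1 →
    (((+ (a ℕ.+ 1) * + b * (+ (b ℕ.+ 1) - + 2 * t)) // (2 ℕ.* (b ℕ.+ 1))) ℚ.- ((+ (b ℕ.∸ 1)) ℚ./ 1) ℚ.≤ (r ℚ./ 1)
    × (r ℚ./ 1) ℚ.≤ ((+ (a ℕ.+ 1) * + b * (+ (b ℕ.+ 1) - + 2 * t)) // (2 ℕ.* (b ℕ.+ 1))))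
    ⊎ (((+ (a ℕ.∸ 1) * + b * (+ (b ℕ.∸ 1) - + 2 * t)) // (2 ℕ.* (b ℕ.∸ 1))) ℚ.≤ (r ℚ./ 1)
    × (r ℚ./ 1) ℚ.≤ ((+ (a ℕ.∸ 1) * + b * (+ (b ℕ.∸ 1) - + 2 * t)) // (2 ℕ.* (b ℕ.∸ 1))) ℚ.+ ((+ (b ℕ.+ 1)) ℚ./ 1))) ×
    (ε ≡ - + 1 →
    (((+ (a ℕ.+ 1) * + b * (+ (b ℕ.∸ 1) + + 2 * t)) // (2 ℕ.* (b ℕ.∸ 1))) ℚ.- ((+ (b ℕ.+ 1)) ℚ./ 1) ℚ.≤ (r ℚ./ 1)
    × (r ℚ./ 1) ℚ.≤ ((+ (a ℕ.+ 1) * + b * (+ (b ℕ.∸ 1) + + 2 * t)) // (2 ℕ.* (b ℕ.∸ 1))))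
    ⊎ (((+ (a ℕ.∸ 1) * + b * (+ (b ℕ.+ 1) + + 2 * t)) // (2 ℕ.* (b ℕ.+ 1))) ℚ.≤ (r ℚ./ 1)
    × (r ℚ./ 1) ℚ.≤ ((+ (a ℕ.∸ 1) * + b * (+ (b ℕ.+ 1) + + 2 * t)) // (2 ℕ.* (b ℕ.+ 1))) ℚ.+ ((+ (b ℕ.∸ 1)) ℚ./ 1)))
theorem2 a b gcd≡1 a>1 b-odd b≥3 G ε r t ε-cases D pds t≤ <t+1 = latin , negative
  where
  h : ℤ
  h = + (b DivMod./ 2)

  instance
    a≢0 : ℕ.NonZero a
    a≢0 = ℕ.>-nonZero (ℕₚ.<-trans (ℕ.s≤s ℕ.z≤n) a>1)
    b≢0 : ℕ.NonZero b
    b≢0 = ℕ.>-nonZero (ℕₚ.≤-trans (ℕ.s≤s ℕ.z≤n) b≥3)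
    b-1≢0 : ℕ.NonZero (b ℕ.∸ 1)
    b-1≢0 = ℕ.>-nonZero (ℕₚ.∸-monoˡ-≤ 1 (ℕₚ.≤-trans (ℕ.s≤s (ℕ.s≤s ℕ.z≤n)) b≥3))
    2[b-1]≢0 : ℕ.NonZero (2 ℕ.* (b ℕ.∸ 1))
    2[b-1]≢0 = ℕₚ.m*n≢0 2 (b ℕ.∸ 1)
    b+1≢0 : ℕ.NonZero (b ℕ.+ 1)
    b+1≢0 = ℕ.>-nonZero (ℕₚ.m≤n+m 1 b)
    2[b+1]≢0 : ℕ.NonZero (2 ℕ.* (b ℕ.+ 1))
    2[b+1]≢0 = ℕₚ.m*n≢0 2 (b ℕ.+ 1)

  b≡1+2h : + b ≡ + 1 + + 2 * h
  b≡1+2h = begin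
    + b                                        ≡⟨ cong +_ (DivMod.m≡m%n+[m/n]*n b 2) ⟩
    + (b % 2 ℕ.+ b DivMod./ 2 ℕ.* 2)           ≡⟨ cong (λ z → + (z ℕ.+ b DivMod./ 2 ℕ.* 2)) b-odd ⟩
    + 1 + + (b DivMod./ 2 ℕ.* 2)               ≡⟨ cong (_+_ (+ 1)) (trans (ℤₚ.pos-* (b DivMod./ 2) 2) (ℤₚ.*-comm h (+ 2))) ⟩
    + 1 + + 2 * h                              ∎
    where open ≡-Reasoning

  2∤b : ¬ 2 ∣ₙ b
  2∤b 2∣b with () ← trans (sym b-odd) (ℕ∣.n∣m⇒m%n≡0 b 2 2∣b)

  double-b+1 : + (2 ℕ.* (b ℕ.+ 1)) ≡ + 2 * (+ b + + 1)
  double-b+1 = ℤₚ.pos-* 2 (b ℕ.+ 1)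

  double-b-1 : + (2 ℕ.* (b ℕ.∸ 1)) ≡ + 2 * (+ b - + 1)
  double-b-1 = trans (ℤₚ.pos-* 2 (b ℕ.∸ 1)) (cong (+ 2 *_) (pos-∸1 b))

  width-sub : + (b ℕ.∸ 1) * + (2 ℕ.* (b ℕ.+ 1)) ≡ + 2 * (+ b * + b - + 1)
  width-sub = trans (cong₂ _*_ (pos-∸1 b) double-b+1) (shape (+ b))
    where
    shape : ∀ b → (b - + 1) * (+ 2 * (b + + 1)) ≡ + 2 * (b * b - + 1)
    shape = solve-∀

  width-add : + (b ℕ.+ 1) * + (2 ℕ.* (b ℕ.∸ 1)) ≡ + 2 * (+ b * + b - + 1)
  width-add = trans (cong (+ (b ℕ.+ 1) *_) double-b-1) (shape (+ b))
    where
    shape : ∀ b → (b + + 1) * (+ 2 * (b - + 1)) ≡ + 2 * (b * b - + 1)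
    shape = solve-∀

  latin : ε ≡ + 1 → _
  latin refl = bounds (integral a b (Coprimality.gcd≡1⇒coprime gcd≡1) 2∤b b≥3 G (+ 1) r T ε-cases
      (divides h (trans (cong (λ z → + 1 * z - + 1) b≡1+2h) (half h))) D pds (proj₁ T-bounds) (proj₂ T-bounds))
    where
    -- This is `(b + 1) / 2 - t`, since `b = 1 + 2h`.
    T : ℤ
    T = h + + 1 - t
    half : ∀ h → + 1 * (+ 1 + + 2 * h) - + 1 ≡ h * + 2
    half = solve-∀
    T-bounds : + 0 ℤ.≤ + a * T - + 1 * r × + 0 ℤ.≤ + a - + 1 - (+ a * T - + 1 * r)
    T-bounds = floor-bounds {a} {t} t≤ <t+1
      (trans (cong (λ z → + 1 * z - + 2 * + 1 * r + + a - t * (+ 2 * + a)) (trans (ℤₚ.pos-* a b) (cong (+ a *_) b≡1+2h))) (shape (+ a) h r t))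
      where
      shape : ∀ a h r t → + 1 * (a * (+ 1 + + 2 * h)) - + 2 * + 1 * r + a - t * (+ 2 * a) ≡ + 2 * (a * (h + + 1 - t) - + 1 * r)
      shape = solve-∀
    2T≡ : + b + + 1 - + 2 * t ≡ + 2 * T
    2T≡ = trans (cong (λ z → z + + 1 - + 2 * t) b≡1+2h) (shape h t)
      where
      shape : ∀ h t → + 1 + + 2 * h + + 1 - + 2 * t ≡ + 2 * (h + + 1 - t)
      shape = solve-∀
    2[T-1]≡ : + (b ℕ.∸ 1) - + 2 * t ≡ + 2 * (T - + 1)
    2[T-1]≡ = trans (cong (_- + 2 * t) (trans (pos-∸1 b) (cong (_- + 1) b≡1+2h))) (shape h t)
      where
      shape : ∀ h t → + 1 + + 2 * h - + 1 - + 2 * t ≡ + 2 * (h + + 1 - t - + 1)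
      shape = solve-∀
    bounds : _ → _
    bounds (inj₁ (0≤u , u≤)) = inj₁ (sub-ends {r = r} (b ℕ.∸ 1) (2 ℕ.* (b ℕ.+ 1)) ((+ 1 * + b) * ((+ a + + 1) * T - + 1 * r) - + 1 * r) (+ b * + b - + 1) 0≤u u≤
      (trans (cong₂ (λ z w → (+ a + + 1) * + b * z - r * w) 2T≡ double-b+1) (shape (+ a) (+ b) r T)) width-sub)
      where
      shape : ∀ a b r T → (a + + 1) * b * (+ 2 * T) - r * (+ 2 * (b + + 1)) ≡ + 2 * ((+ 1 * b) * ((a + + 1) * T - + 1 * r) - + 1 * r)
      shape = solve-∀
    bounds (inj₂ (0≤u , u≤)) = inj₂ (add-ends {r = r} (b ℕ.+ 1) (2 ℕ.* (b ℕ.∸ 1)) ((+ 1 * + b) * (+ 1 * r - (T - + 1) * (+ a - + 1)) - + 1 * r) (+ b * + b - + 1) 0≤u u≤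
      (trans (cong₂ (λ x z → r * + (2 ℕ.* (b ℕ.∸ 1)) - x * + b * z) (pos-∸1 a) 2[T-1]≡)
        (trans (cong (λ w → r * w - (+ a - + 1) * + b * (+ 2 * (T - + 1))) double-b-1) (shape (+ a) (+ b) r T))) width-add)
      where
      shape : ∀ a b r T → r * (+ 2 * (b - + 1)) - (a - + 1) * b * (+ 2 * (T - + 1)) ≡ + 2 * ((+ 1 * b) * (+ 1 * r - (T - + 1) * (a - + 1)) - + 1 * r)
      shape = solve-∀

  negative : ε ≡ - + 1 → _
  negative refl = bounds (integral a b (Coprimality.gcd≡1⇒coprime gcd≡1) 2∤b b≥3 G (- + 1) r T ε-cases
      (divides (- h - + 1) (trans (cong (λ z → - + 1 * z - + 1) b≡1+2h) (half h))) D pds (proj₁ T-bounds) (proj₂ T-bounds))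
    where
    -- This is `(b′ + 1) / 2 - t` for `b′ = -b`, since `(1 - b) / 2 = -h`.
    T : ℤ
    T = - h - t
    half : ∀ h → - + 1 * (+ 1 + + 2 * h) - + 1 ≡ (- h - + 1) * + 2
    half = solve-∀
    T-bounds : + 0 ℤ.≤ + a * T - - + 1 * r × + 0 ℤ.≤ + a - + 1 - (+ a * T - - + 1 * r)
    T-bounds = floor-bounds {a} {t} t≤ <t+1
      (trans (cong (λ z → - + 1 * z - + 2 * - + 1 * r + + a - t * (+ 2 * + a)) (trans (ℤₚ.pos-* a b) (cong (+ a *_) b≡1+2h))) (shape (+ a) h r t))
      where
      shape : ∀ a h r t → - + 1 * (a * (+ 1 + + 2 * h)) - + 2 * - + 1 * r + a - t * (+ 2 * a) ≡ + 2 * (a * (- h - t) - - + 1 * r)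
      shape = solve-∀
    -2T≡ : + (b ℕ.∸ 1) + + 2 * t ≡ - (+ 2 * T)
    -2T≡ = trans (cong (_+ + 2 * t) (trans (pos-∸1 b) (cong (_- + 1) b≡1+2h))) (shape h t)
      where
      shape : ∀ h t → + 1 + + 2 * h - + 1 + + 2 * t ≡ - (+ 2 * (- h - t))
      shape = solve-∀
    -2[T-1]≡ : + b + + 1 + + 2 * t ≡ - (+ 2 * (T - + 1))
    -2[T-1]≡ = trans (cong (λ z → z + + 1 + + 2 * t) b≡1+2h) (shape h t)
      where
      shape : ∀ h t → + 1 + + 2 * h + + 1 + + 2 * t ≡ - (+ 2 * (- h - t - + 1))
      shape = solve-∀
    bounds : _ → _
    -- With `b′ = -b` the coefficient of `r` in absolute value is `b - 1` instead of `b + 1`, so the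
    -- two denominators change places compared with the Latin square case.
    bounds (inj₁ (0≤u , u≤)) = inj₁ (sub-ends {r = r} (b ℕ.+ 1) (2 ℕ.* (b ℕ.∸ 1)) ((- + 1 * + b) * ((+ a + + 1) * T - - + 1 * r) - - + 1 * r) (+ b * + b - + 1) 0≤u u≤
      (trans (cong₂ (λ z w → (+ a + + 1) * + b * z - r * w) -2T≡ double-b-1) (shape (+ a) (+ b) r T)) width-add)
      where
      shape : ∀ a b r T → (a + + 1) * b * - (+ 2 * T) - r * (+ 2 * (b - + 1)) ≡ + 2 * ((- + 1 * b) * ((a + + 1) * T - - + 1 * r) - - + 1 * r)
      shape = solve-∀
    bounds (inj₂ (0≤u , u≤)) = inj₂ (add-ends {r = r} (b ℕ.∸ 1) (2 ℕ.* (b ℕ.+ 1)) ((- + 1 * + b) * (- + 1 * r - (T - + 1) * (+ a - + 1)) - - + 1 * r) (+ b * + b - + 1) 0≤u u≤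
      (trans (cong₂ (λ x z → r * + (2 ℕ.* (b ℕ.+ 1)) - x * + b * z) (pos-∸1 a) -2[T-1]≡)
        (trans (cong (λ w → r * w - (+ a - + 1) * + b * - (+ 2 * (T - + 1))) double-b+1) (shape (+ a) (+ b) r T))) width-sub)
      where
      shape : ∀ a b r T → r * (+ 2 * (b + + 1)) - (a - + 1) * b * - (+ 2 * (T - + 1)) ≡ + 2 * ((- + 1 * b) * (- + 1 * r - (T - + 1) * (a - + 1)) - - + 1 * r)
      shape = solve-∀
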